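{- Let $k\ge 2$, $r\ge 1$ and $n_1,\ldots,n_k$ be integers with $n_i\ge r$ for all $i\in[k]$, and let $\mathscr{F}\subseteq \mathcal{K}_r(n_1,\ldots,n_k)$ be an intersecting family of $r$-matchings. Then \[ |\mathscr{F}|\le \frac{(n_1-1)_{r-1}\cdots(n_k-1)_{r-1}}{(r-1)!}. \] Furthermore, equality is attained if and only if $\mathscr{F}$ is a star of $\mathcal{K}_r(n_1,\ldots,n_k)$.
   Context: For a positive integer $n$, $[n]=\{1,\ldots,n\}$. For non-negative integers $b\le a$, $(a)_b=\frac{a!}{(a-b)!}$. $\mathcal{K}(n_1,\ldots,n_k)$ denotes the complete $k$-partite $k$-graph with parts $[n_1],\ldots,[n_k]$ (regarded as disjoint); its edges are identified with the $k$-tuples $(x_1,\ldots,x_k)\in[n_1]\times\cdots\times[n_k]$. An $r$-matching is a set of $r$ pairwise vertex-disjoint edges, i.e. a set of $r$ such $k$-tuples any two of which differ in every coordinate. $\mathcal{K}_r(n_1,\ldots,n_k)$ is the set of all $r$-matchings of $\mathcal{K}(n_1,\ldots,n_k)$. A family $\mathscr{F}\subseteq\mathcal{K}_r(n_1,\ldots,n_k)$ is intersecting if every pair of members of $\mathscr{F}$ share a common edge. A star of $\mathcal{K}_r(n_1,\ldots,n_k)$ is a family of the form $\{M\in\mathcal{K}_r(n_1,\ldots,n_k): e\in M\}$ for some edge $e$ of $\mathcal{K}(n_1,\ldots,n_k)$. -}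

module Defs where

open import Data.Fin.Base using (Fin)
open import Data.Integer.Base using (+_)
open import Data.List.Base using (List; length)
import Data.List.Membership.Setoid as SetoidMembership
import Data.List.Relation.Unary.Unique.Setoid as SetoidUnique
open import Data.Nat.Base using (ℕ; _∸_; _*_; _!)
open import Data.Nat.Combinatorics using (_P_)
open import Data.Nat.Properties using (_!≢0)
open import Data.Product.Base using (∃-syntax; _×_)
open import Data.Rational.Base using (ℚ; _/_)
open import Data.Vec.Base using (Vec; foldr′; map)
import Data.Vec.Membership.Propositional as VecMembership
open import Data.Vec.Relation.Unary.All using (All)
open import Data.Vec.Relation.Unary.All.Properties using (lookup⁺)
open import Data.Vec.Relation.Unary.AllPairs using (AllPairs)
open import Function.Bundles using (_⇔_)
import Function.Properties.Equivalence as Equivalence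
open import Relation.Binary.Bundles using (Setoid)
open import Relation.Binary.PropositionalEquality.Core using (_≢_)

-- The part [m] is represented by Fin m, so an edge of 𝒦(n₁,…,n_k) is a
-- heterogeneous tuple in Fin n₁ × ⋯ × Fin n_k.

Edge : ∀ {k} → Vec ℕ k → Set
Edge n = All Fin n

Disjoint : ∀ {k} {n : Vec ℕ k} → Edge n → Edge n → Set
Disjoint e f = ∀ i → lookup⁺ e i ≢ lookup⁺ f i

-- A matching is a set of edges; it is listed in some order here, and the
-- order is forgotten by _≈_ below.  For k ≥ 1 disjoint edges are distinct,
-- so a listing of length r describes a set of exactly r edges.

record Matching {k} (n : Vec ℕ k) (r : ℕ) : Set where
  field
    edges    : Vec (Edge n) r
    disjoint : AllPairs Disjoint edges

module _ {k} {n : Vec ℕ k} {r : ℕ} where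

  infix 4 _∈ᵉ_ _≈_

  _∈ᵉ_ : Edge n → Matching n r → Set
  e ∈ᵉ M = VecMembership._∈_ e (Matching.edges M)

  _≈_ : Matching n r → Matching n r → Set
  M ≈ N = ∀ e → e ∈ᵉ M ⇔ e ∈ᵉ N

  matchingSetoid : Setoid _ _
  matchingSetoid = record
    { Carrier       = Matching n r
    ; _≈_           = _≈_
    ; isEquivalence = record
      { refl  = λ _ → Equivalence.refl
      ; sym   = λ p e → Equivalence.sym (p e)
      ; trans = λ p q e → Equivalence.trans (p e) (q e)
      }
    }

-- A subset of the finite set 𝒦_r(n₁,…,n_k), given by a listing without
-- repetitions up to equality of edge sets, so that the length of the listing
-- is the cardinality.

record Family {k} (n : Vec ℕ k) (r : ℕ) : Set where
  field
    members : List (Matching n r)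
    unique  : SetoidUnique.Unique matchingSetoid members

module _ {k} {n : Vec ℕ k} {r : ℕ} where

  infix 4 _∈ᶠ_

  _∈ᶠ_ : Matching n r → Family n r → Set
  M ∈ᶠ F = SetoidMembership._∈_ matchingSetoid M (Family.members F)

  ∣_∣ : Family n r → ℕ
  ∣ F ∣ = length (Family.members F)

  Intersecting : Family n r → Set
  Intersecting F = ∀ M N → M ∈ᶠ F → N ∈ᶠ F → ∃[ e ] (e ∈ᵉ M × e ∈ᵉ N)

  IsStar : Family n r → Set
  IsStar F = ∃[ e ] (∀ M → M ∈ᶠ F ⇔ e ∈ᵉ M)

∏ : ∀ {k} → Vec ℕ k → ℕ
∏ = foldr′ _*_ 1

-- a P b is the falling factorial (a)_b.  Truncated subtraction is harmless:
-- the bound is only used for r ≥ 1 and all nᵢ ≥ r.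

bound : ∀ {k} → Vec ℕ k → ℕ → ℚ
bound n r = (+ ∏ (map (λ m → (m ∸ 1) P (r ∸ 1)) n) / (r ∸ 1) !) {{(r ∸ 1) !≢0}}

fromℕ : ℕ → ℚ
fromℕ m = + m / 1

{-# OPTIONS --safe #-}

-- Let part m be a smallest one.  The edges of 𝒦(n₁,…,n_k) are arranged on cycles, along diagonals,
-- so that any r consecutive edges form a matching; at most r of these windows belong to an intersecting
-- family (Katona), and averaging over the action of S_{n₁} × ⋯ × S_{n_k} gives the bound.  In the case
-- of equality every arrangement contains exactly r members, and then one of its diagonals contains a
-- member; so the diagonals containing members behave like an extremal family of n_m-matchings.
--
-- Fixing all coordinates but m and another one p up to rotation turns these diagonals into an extremal
-- intersecting family of permutations (or injections): exactly one of the rotations of any arrangement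
-- belongs to it.  Such a family contains id but not some transposition (x y), after renaming.  Rotating
-- the arrangement x ↦ y, y ↦ x, w ↦ w, it follows that for each word w in the other letters the family
-- contains either the cycle (y w), which fixes x, or the cycle (x wʳ), which fixes y.  The choice cannot
-- depend on w, and every permutation moving x is disjoint from one of the cycles (y w); hence the family
-- is the star at the cell (x , x).  Finally the centres of these stars agree for all the remaining coordinates.

module Submission where

import Algebra.Properties.CommutativeSemigroup as CommSemigroup
open import Data.Bool.Base using (if_then_else_)
open import Data.Empty using (⊥; ⊥-elim)
open import Data.Fin.Base using (Fin; zero; suc; toℕ; fromℕ<; inject≤; punchIn; punchOut)
open import Data.Fin.Patterns using (0F; 1F; 2F; 3F; 4F)
open import Data.Fin.Permutation using (Permutation′; permutation; _⟨$⟩ʳ_; _⟨$⟩ˡ_; inverseˡ)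
open import Data.Fin.Permutation.Components using (transpose; transpose-inverse)
open import Data.Fin.Permutation.Transposition.List using (eval; decompose; eval-decompose)
import Data.Fin.Properties as Finₚ
open import Data.Fin.Properties using (_≟_; any?; all?; punchIn-injective; punchInᵢ≢i; punchIn-punchOut; punchOut-injective; injective⇒≤; toℕ-injective; toℕ-fromℕ<; toℕ<n; toℕ-inject≤; inject≤-injective)
import Data.Integer.Base as ℤ
import Data.Integer.Properties as ℤₚ
open import Data.List.Base using (List; []; _∷_; _++_; [_]; map; length; allFin; tabulate; reverse; cartesianProductWith)
import Data.List.Base as List
open import Data.List.Membership.Propositional using (_∈_; _∉_; find; lose)
open import Data.List.Membership.Propositional.Properties using (∈-cartesianProductWith⁺; ∈-cartesianProductWith⁻; ∈-allFin; ∈-∃++; ∈-++⁻)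
open import Data.List.Properties using (length-tabulate; length-++; map-++; unfold-reverse; reverse-++; reverse-involutive; ++-assoc; ++-identityʳ)
import Data.List.Relation.Binary.Permutation.Propositional as ↭
open import Data.List.Relation.Binary.Permutation.Propositional using (_↭_; ↭-refl; ↭-sym; ↭-trans; ↭-prep; ↭-swap; ↭-reflexive)
open import Data.List.Relation.Binary.Permutation.Propositional.Properties using (All-resp-↭; ∈-resp-↭; ↭-length; ↭-reverse; shift; ++-comm; ++⁺ˡ; ∷↭∷ʳ)
import Data.List.Relation.Unary.All as Allˡ
open import Data.List.Relation.Unary.All using ([]; _∷_)
import Data.List.Relation.Unary.AllPairs as AllPairsˡ
open import Data.List.Relation.Unary.AllPairs using ([]; _∷_)
import Data.List.Relation.Unary.Any as Any
open import Data.List.Relation.Unary.Any using (here; there)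
import Data.List.Relation.Unary.Any.Properties as Anyₚ
open import Data.List.Relation.Unary.Linked using (Linked; [-]; _∷_)
open import Data.List.Relation.Unary.Unique.Propositional using (Unique)
open import Data.List.Relation.Unary.Unique.Propositional.Properties using (allFin⁺; Unique[x∷xs]⇒x∉xs)
open import Data.Nat.Base using (ℕ; zero; suc; 2+; _+_; _*_; _∸_; _!; _<_; z≤n; s≤s; s≤s⁻¹; NonZero; >-nonZero; _%_) renaming (_≤_ to _≤ℕ_; _/_ to _div_)
open import Data.Nat.Combinatorics renaming (_P_ to _↓_) using ()
open import Data.Nat.Combinatorics.Specification using (nPk≡n!/[n∸k]!; [n∸k]!k!∣n!)
open import Data.Nat.Divisibility using (divides; ∣-trans; m∣m*n)
open import Data.Nat.DivMod hiding (_div_; _/_)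
open import Data.Nat.Properties renaming (_≟_ to _≟ℕ_)
open import Data.Nat.Solver using (module +-*-Solver)
open import Data.Product.Base using (∃-syntax; ∃₂; _×_; _,_; proj₁; proj₂)
open import Data.Rational.Base using (_≤_; _/_)
import Data.Rational.Properties as ℚₚ
open import Data.Rational.Unnormalised.Base using (mkℚᵘ; *≤*; *≡*)
import Data.Rational.Unnormalised.Properties as ℚᵘₚ
open import Data.Sum.Base using (_⊎_; inj₁; inj₂)
open import Data.Unit.Base using (⊤; tt)
import Data.Vec.Base as Vec
open import Data.Vec.Base using (Vec; []; _∷_; lookup) renaming (map to mapᵛ)
import Data.Vec.Membership.DecPropositional as DecMembershipᵛ
open import Data.Vec.Membership.Propositional.Properties using (∈-lookup)
open import Data.Vec.Properties using (lookup-map; lookup∘tabulate)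
open import Data.Vec.Relation.Unary.All using (All; []; _∷_)
open import Data.Vec.Relation.Unary.All.Properties using (lookup⁺; lookup⁻)
open import Data.Vec.Relation.Unary.AllPairs using (AllPairs; []; _∷_)
import Data.Vec.Relation.Unary.AllPairs.Properties as AllPairsₚ
import Data.Vec.Relation.Unary.Any as Anyᵛ
import Data.Vec.Relation.Unary.Any.Properties as Anyᵛₚ
open import Defs
open import Function.Base using (_∘_; id)
open import Function.Bundles using (_⇔_; mk⇔; Equivalence)
open import Relation.Binary.Bundles using (Setoid)
open import Relation.Binary.PropositionalEquality hiding ([_])
open import Relation.Nullary using (¬_; Dec; yes; no; contradiction)
open import Relation.Nullary.Decidable using (does; dec-true; dec-false; map′; toWitness; ¬?; _×-dec_; _⊎-dec_; _→-dec_)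

-- Finite sums and the enumeration of permutations

-- Katona's argument needs cycles of length at least 2r, and a diagonal has only n_m cells. For r <
-- n_m the cycle therefore moves on to the next diagonal after each turn through the rows, which
-- makes it n_m n_p long; one free row is what keeps the windows that cross over matchings. For r =
-- n_m there is no free row, but then every window is a whole diagonal. The hypothesis of equality
-- does not mention the arrangement, so it may be used for all listings of the rows and columns at
-- once. A member has only r edges and need not determine a permutation; hence the family is handled
-- through the relations that contain a member, a monotone predicate any two instances of which
-- meet. A cycle (y w) and a cycle (x w′ʳ) meet only in two letters that are consecutive in opposite
-- orders in w and w′. Rearrangements that reverse no such pair thus preserve the choice between the
-- two kinds, and they generate all rearrangements except for very short words. On two points both
-- cycles are the identity, so a part with at least three vertices is needed besides part m; if
-- there is none, all parts have at most two vertices.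

private variable
  A B C : Set
  P Q : Set

∑ : List A → (A → ℕ) → ℕ
∑ []       φ = 0
∑ (x ∷ xs) φ = φ x + ∑ xs φ

⟦_⟧ : Dec P → ℕ
⟦ d ⟧ = if does d then 1 else 0

⟦⟧-yes : (d : Dec P) → P → ⟦ d ⟧ ≡ 1
⟦⟧-yes d p rewrite dec-true d p = refl

⟦⟧-no : (d : Dec P) → ¬ P → ⟦ d ⟧ ≡ 0
⟦⟧-no d p rewrite dec-false d p = refl

⟦⟧-mono : (d : Dec P) (e : Dec Q) → (P → Q) → ⟦ d ⟧ ≤ℕ ⟦ e ⟧
⟦⟧-mono (yes p) e f = ≤-reflexive (sym (⟦⟧-yes e (f p)))
⟦⟧-mono (no ¬p) e f = z≤n

⟦⟧-cong : (d : Dec P) (e : Dec Q) → (P → Q) → (Q → P) → ⟦ d ⟧ ≡ ⟦ e ⟧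
⟦⟧-cong d e f g = ≤-antisym (⟦⟧-mono d e f) (⟦⟧-mono e d g)

opaque
  ∀? : ∀ {n} {P : Fin n → Set} → (∀ i → Dec (P i)) → Dec (∀ i → P i)
  ∀? = all?

∑-cong-∈ : ∀ (xs : List A) {φ ψ : A → ℕ} → (∀ x → x ∈ xs → φ x ≡ ψ x) → ∑ xs φ ≡ ∑ xs ψ
∑-cong-∈ []       eq = refl
∑-cong-∈ (x ∷ xs) eq = cong₂ _+_ (eq x (here refl)) (∑-cong-∈ xs (λ y y∈ → eq y (there y∈)))

∑-cong : ∀ (xs : List A) {φ ψ : A → ℕ} → (∀ x → φ x ≡ ψ x) → ∑ xs φ ≡ ∑ xs ψ
∑-cong xs eq = ∑-cong-∈ xs (λ x _ → eq x)

∑-mono-∈ : ∀ (xs : List A) {φ ψ : A → ℕ} → (∀ x → x ∈ xs → φ x ≤ℕ ψ x) → ∑ xs φ ≤ℕ ∑ xs ψ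
∑-mono-∈ []       le = z≤n
∑-mono-∈ (x ∷ xs) le = +-mono-≤ (le x (here refl)) (∑-mono-∈ xs (λ y y∈ → le y (there y∈)))

∑-const : ∀ (xs : List A) c → ∑ xs (λ _ → c) ≡ length xs * c
∑-const []       c = refl
∑-const (x ∷ xs) c = cong (c +_) (∑-const xs c)

∑-zero : ∀ (xs : List A) {φ : A → ℕ} → (∀ x → φ x ≡ 0) → ∑ xs φ ≡ 0
∑-zero xs eq = trans (∑-cong xs eq) (trans (∑-const xs 0) (*-zeroʳ (length xs)))

∑-*ʳ : ∀ (xs : List A) (φ : A → ℕ) c → ∑ xs (λ x → φ x * c) ≡ ∑ xs φ * c
∑-*ʳ []       φ c = refl
∑-*ʳ (x ∷ xs) φ c = trans (cong (φ x * c +_) (∑-*ʳ xs φ c)) (sym (*-distribʳ-+ c (φ x) (∑ xs φ)))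

∑-*ˡ : ∀ (xs : List A) (φ : A → ℕ) c → ∑ xs (λ x → c * φ x) ≡ c * ∑ xs φ
∑-*ˡ xs φ c = trans (∑-cong xs (λ x → *-comm c (φ x))) (trans (∑-*ʳ xs φ c) (*-comm _ c))

∑-+ : ∀ (xs : List A) (φ ψ : A → ℕ) → ∑ xs (λ x → φ x + ψ x) ≡ ∑ xs φ + ∑ xs ψ
∑-+ []       φ ψ = refl
∑-+ (x ∷ xs) φ ψ rewrite ∑-+ xs φ ψ = CommSemigroup.interchange +-commutativeSemigroup (φ x) (ψ x) (∑ xs φ) (∑ xs ψ)

∑-comm : ∀ (xs : List A) (ys : List B) (φ : A → B → ℕ) →
         ∑ xs (λ x → ∑ ys (φ x)) ≡ ∑ ys (λ y → ∑ xs (λ x → φ x y))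
∑-comm []       ys φ = sym (∑-zero ys (λ _ → refl))
∑-comm (x ∷ xs) ys φ = trans (cong (∑ ys (φ x) +_) (∑-comm xs ys φ)) (sym (∑-+ ys (φ x) _))

∑-++ : ∀ (xs ys : List A) (φ : A → ℕ) → ∑ (xs ++ ys) φ ≡ ∑ xs φ + ∑ ys φ
∑-++ []       ys φ = refl
∑-++ (x ∷ xs) ys φ = trans (cong (φ x +_) (∑-++ xs ys φ)) (sym (+-assoc (φ x) _ _))

∑-map : ∀ (f : A → B) xs (φ : B → ℕ) → ∑ (map f xs) φ ≡ ∑ xs (φ ∘ f)
∑-map f []       φ = refl
∑-map f (x ∷ xs) φ = cong (φ (f x) +_) (∑-map f xs φ)

∑-product : ∀ (f : A → B → C) xs ys (φ : C → ℕ) →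
            ∑ (cartesianProductWith f xs ys) φ ≡ ∑ xs (λ x → ∑ ys (λ y → φ (f x y)))
∑-product f []       ys φ = refl
∑-product f (x ∷ xs) ys φ =
  trans (∑-++ (map (f x) ys) _ φ) (cong₂ _+_ (∑-map (f x) ys φ) (∑-product f xs ys φ))

-- A term below c could not be made up for by the others. Through this the equality case of the
-- averaged bound passes to every single group element.
∑-tight : ∀ (xs : List A) {φ : A → ℕ} {c} → (∀ x → x ∈ xs → φ x ≤ℕ c) →
          length xs * c ≤ℕ ∑ xs φ → ∀ x → x ∈ xs → φ x ≡ c
∑-tight (y ∷ xs) {φ} {c} le ge .y (here refl) =
  ≤-antisym (le y (here refl)) (+-cancelʳ-≤ (length xs * c) c (φ y) (≤-trans ge (+-monoʳ-≤ (φ y)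
    (≤-trans (∑-mono-∈ xs (λ x x∈ → le x (there x∈))) (≤-reflexive (∑-const xs c))))))
∑-tight (y ∷ xs) {φ} {c} le ge x (there x∈) =
  ∑-tight xs (λ z z∈ → le z (there z∈))
    (+-cancelˡ-≤ c _ _ (≤-trans ge (+-monoˡ-≤ (∑ xs φ) (le y (here refl))))) x x∈

∑-positive : ∀ (xs : List A) {P : A → Set} (P? : ∀ x → Dec (P x)) →
             1 ≤ℕ ∑ xs (λ x → ⟦ P? x ⟧) → ∃[ x ] (x ∈ xs × P x)
∑-positive (x ∷ xs) P? pos with P? x
... | yes p = x , here refl , p
... | no  _ with y , y∈ , q ← ∑-positive xs P? pos = y , there y∈ , q

∑-tabulate : ∀ n (f : Fin n → A) (φ : A → ℕ) → ∑ (tabulate f) φ ≡ ∑ (allFin n) (φ ∘ f)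
∑-tabulate zero    f φ = refl
∑-tabulate (suc n) f φ = cong (φ (f zero) +_)
  (trans (∑-tabulate n (f ∘ suc) φ) (sym (∑-tabulate n suc (φ ∘ f))))

∑-single : ∀ {n} {φ : Fin n → ℕ} j → (∀ i → i ≢ j → φ i ≡ 0) → ∑ (allFin n) φ ≡ φ j
∑-single {suc n} {φ} zero    z =
  trans (cong (φ zero +_) (trans (∑-tabulate n suc φ) (∑-zero (allFin n) (λ i → z (suc i) λ ())))) (+-identityʳ _)
∑-single {suc n} {φ} (suc j) z =
  trans (cong₂ _+_ (z zero λ ()) (∑-tabulate n suc φ))
        (∑-single j (λ i i≢j → z (suc i) (i≢j ∘ Finₚ.suc-injective)))

∑-unique : ∀ {n} {P : Fin n → Set} (P? : ∀ i → Dec (P i)) j → P j → (∀ i → P i → i ≡ j) →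
           ∑ (allFin n) (λ i → ⟦ P? i ⟧) ≡ 1
∑-unique P? j pj uniq =
  trans (∑-single j (λ i i≢j → ⟦⟧-no (P? i) (i≢j ∘ uniq i))) (⟦⟧-yes (P? j) pj)

∑-allFin-const : ∀ n c → ∑ (allFin n) (λ _ → c) ≡ n * c
∑-allFin-const n c = trans (∑-const (allFin n) c) (cong (_* c) (length-tabulate {n = n} (λ x → x)))

Injective : (A → B) → Set
Injective f = ∀ {i j} → f i ≡ f j → i ≡ j

⟦any⟧≡∑ : ∀ {r n} (f : Fin r → Fin n) → Injective f → ∀ v →
          ⟦ any? (λ s → f s ≟ v) ⟧ ≡ ∑ (allFin r) (λ s → ⟦ f s ≟ v ⟧)
⟦any⟧≡∑ {r} f inj v with any? (λ s → f s ≟ v)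
... | yes (s , refl) = sym (∑-unique (λ t → f t ≟ f s) s refl (λ _ → inj))
... | no  ∄          = sym (∑-zero (allFin r) (λ s → ⟦⟧-no (f s ≟ v) (λ e → ∄ (s , e))))

complement-size : ∀ {r n} (f : Fin r → Fin n) → Injective f →
                  ∑ (allFin n) (λ v → ⟦ ¬? (any? (λ s → f s ≟ v)) ⟧) ≡ n ∸ r
complement-size {r} {n} f inj = begin
  ∑ (allFin n) out                        ≡⟨ m+n∸n≡m _ r ⟨
  (∑ (allFin n) out + r) ∸ r              ≡⟨ cong (λ z → (∑ (allFin n) out + z) ∸ r) hit≡r ⟨
  (∑ (allFin n) out + ∑ (allFin n) hit) ∸ r ≡⟨ cong (_∸ r) (∑-+ (allFin n) out hit) ⟨
  ∑ (allFin n) (λ v → out v + hit v) ∸ r  ≡⟨ cong (_∸ r) (∑-cong (allFin n) one) ⟩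
  ∑ (allFin n) (λ _ → 1) ∸ r              ≡⟨ cong (_∸ r) (trans (∑-allFin-const n 1) (*-identityʳ n)) ⟩
  n ∸ r                                   ∎
  where
  open ≡-Reasoning
  out hit : Fin n → ℕ
  out v = ⟦ ¬? (any? (λ s → f s ≟ v)) ⟧
  hit v = ⟦ any? (λ s → f s ≟ v) ⟧
  one : ∀ v → out v + hit v ≡ 1
  one v with any? (λ s → f s ≟ v)
  ... | yes _ = refl
  ... | no  _ = refl
  hit≡r : ∑ (allFin n) hit ≡ r
  hit≡r = begin
    ∑ (allFin n) hit                                       ≡⟨ ∑-cong (allFin n) (⟦any⟧≡∑ f inj) ⟩
    ∑ (allFin n) (λ v → ∑ (allFin r) (λ s → ⟦ f s ≟ v ⟧)) ≡⟨ ∑-comm (allFin n) (allFin r) _ ⟩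
    ∑ (allFin r) (λ s → ∑ (allFin n) (λ v → ⟦ f s ≟ v ⟧)) ≡⟨ ∑-cong (allFin r) (λ s → ∑-unique (f s ≟_) (f s) refl (λ _ → sym)) ⟩
    ∑ (allFin r) (λ _ → 1)                                 ≡⟨ trans (∑-allFin-const r 1) (*-identityʳ r) ⟩
    r                                                      ∎

perms : ∀ n → List (Vec (Fin n) n)
perms zero    = [] ∷ []
perms (suc n) = cartesianProductWith (λ v g → v ∷ mapᵛ (punchIn v) g) (allFin (suc n)) (perms n)

Extends : ∀ {r n} → (Fin r → Fin n) → (Fin r → Fin n) → Vec (Fin n) n → Set
Extends a b g = ∀ s → lookup g (a s) ≡ b s

extends? : ∀ {r n} (a b : Fin r → Fin n) g → Dec (Extends a b g)
extends? a b g = ∀? (λ s → lookup g (a s) ≟ b s)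

lookup-cons : ∀ {n} v (g : Vec (Fin n) n) {a} (0≢a : zero ≢ a) →
              lookup (v ∷ mapᵛ (punchIn v) g) a ≡ punchIn v (lookup g (punchOut 0≢a))
lookup-cons v g {zero}  0≢a = contradiction refl 0≢a
lookup-cons v g {suc a} 0≢a = lookup-map a (punchIn v) g

punchOut-lookup : ∀ {n} v (g : Vec (Fin n) n) {a b} (0≢a : zero ≢ a) (v≢b : v ≢ b) →
                  lookup (v ∷ mapᵛ (punchIn v) g) a ≡ b → lookup g (punchOut 0≢a) ≡ punchOut v≢b
punchOut-lookup v g 0≢a v≢b eq = punchIn-injective v _ _
  (trans (sym (lookup-cons v g 0≢a)) (trans eq (sym (punchIn-punchOut v≢b))))

punchIn-lookup : ∀ {n} v (g : Vec (Fin n) n) {a b} (0≢a : zero ≢ a) (v≢b : v ≢ b) →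
                 lookup g (punchOut 0≢a) ≡ punchOut v≢b → lookup (v ∷ mapᵛ (punchIn v) g) a ≡ b
punchIn-lookup v g 0≢a v≢b eq =
  trans (lookup-cons v g 0≢a) (trans (cong (punchIn v) eq) (punchIn-punchOut v≢b))

-- Induction on n, by the value at zero. If some `a s` is zero, this value must be `b s` and one
-- condition disappears; otherwise it is any value outside `b`, and each of these leaves the same
-- count.
#extensions : ∀ n {r} (a b : Fin r → Fin n) → Injective a → Injective b →
              ∑ (perms n) (λ g → ⟦ extends? a b g ⟧) ≡ (n ∸ r) !
#extensions zero {zero}  a b _ _ = cong (_+ 0) (⟦⟧-yes (extends? a b []) (λ ()))
#extensions zero {suc r} a b _ _ with () ← a zero
#extensions (suc n) {r} a b a-inj b-inj with any? (λ s → zero ≟ a s)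
#extensions (suc n) {suc r} a b a-inj b-inj | yes (s , 0≡as) =
  trans (∑-product _ (allFin (suc n)) (perms n) _)
  (trans (∑-single (b s) miss)
  (trans (∑-cong (perms n) (λ g → ⟦⟧-cong (extends? a b (b s ∷ mapᵛ (punchIn (b s)) g)) (extends? a′ b′ g) (down g) (up g)))
  (#extensions n a′ b′
    (λ e → punchIn-injective s _ _ (a-inj (punchOut-injective (0≢a _) (0≢a _) e)))
    (λ e → punchIn-injective s _ _ (b-inj (punchOut-injective (b≢b _) (b≢b _) e))))))
  where
  0≢a : ∀ t → zero ≢ a (punchIn s t)
  0≢a t 0≡a = punchInᵢ≢i s t (a-inj (trans (sym 0≡a) 0≡as))
  b≢b : ∀ t → b s ≢ b (punchIn s t)
  b≢b t e = punchInᵢ≢i s t (b-inj (sym e))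
  a′ b′ : Fin r → Fin n
  a′ t = punchOut (0≢a t)
  b′ t = punchOut (b≢b t)
  miss : ∀ v → v ≢ b s → ∑ (perms n) (λ g → ⟦ extends? a b (v ∷ mapᵛ (punchIn v) g) ⟧) ≡ 0
  miss v v≢bs = ∑-zero (perms n) λ g → ⟦⟧-no (extends? a b (v ∷ mapᵛ (punchIn v) g))
    (λ ext → v≢bs (trans (cong (lookup (v ∷ mapᵛ (punchIn v) g)) 0≡as) (ext s)))
  down : ∀ g → Extends a b (b s ∷ mapᵛ (punchIn (b s)) g) → Extends a′ b′ g
  down g ext t = punchOut-lookup (b s) g (0≢a t) (b≢b t) (ext (punchIn s t))
  up : ∀ g → Extends a′ b′ g → Extends a b (b s ∷ mapᵛ (punchIn (b s)) g)
  up g ext t with s ≟ t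
  ... | yes refl = sym (cong (lookup (b s ∷ mapᵛ (punchIn (b s)) g)) 0≡as)
  ... | no  s≢t  = subst (λ z → lookup (b s ∷ mapᵛ (punchIn (b s)) g) (a z) ≡ b z) (punchIn-punchOut s≢t)
    (punchIn-lookup (b s) g (0≢a _) (b≢b _) (ext (punchOut s≢t)))
#extensions (suc n) {r} a b a-inj b-inj | no ∄ =
  trans (∑-product _ (allFin (suc n)) (perms n) _)
  (trans (∑-cong (allFin (suc n)) each)
  (trans (∑-*ʳ (allFin (suc n)) (λ v → ⟦ ¬? (any? (λ s → b s ≟ v)) ⟧) ((n ∸ r) !))
  (trans (cong (_* (n ∸ r) !) (complement-size b b-inj))
  (trans (cong (_* (n ∸ r) !) (+-∸-assoc 1 r≤n))
  (cong _! (sym (+-∸-assoc 1 r≤n)))))))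
  where
  0≢a : ∀ t → zero ≢ a t
  0≢a t 0≡a = ∄ (t , 0≡a)
  a′ : Fin r → Fin n
  a′ t = punchOut (0≢a t)
  a′-inj : Injective a′
  a′-inj e = a-inj (punchOut-injective (0≢a _) (0≢a _) e)
  r≤n : r ≤ℕ n
  r≤n = injective⇒≤ a′-inj
  each : ∀ v → ∑ (perms n) (λ g → ⟦ extends? a b (v ∷ mapᵛ (punchIn v) g) ⟧)
             ≡ ⟦ ¬? (any? (λ s → b s ≟ v)) ⟧ * (n ∸ r) !
  each v with any? (λ s → b s ≟ v)
  ... | yes (s , refl) = ∑-zero (perms n) λ g → ⟦⟧-no (extends? a b (b s ∷ mapᵛ (punchIn (b s)) g))
    (λ ext → punchInᵢ≢i (b s) (lookup g (a′ s)) (trans (sym (lookup-cons (b s) g (0≢a s))) (ext s)))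
  ... | no  ∉ =
    trans (∑-cong (perms n) (λ g → ⟦⟧-cong (extends? a b (v ∷ mapᵛ (punchIn v) g)) (extends? a′ b′ g)
             (λ ext t → punchOut-lookup v g (0≢a t) (v≢b t) (ext t))
             (λ ext t → punchIn-lookup v g (0≢a t) (v≢b t) (ext t))))
    (trans (#extensions n a′ b′ a′-inj (λ e → b-inj (punchOut-injective (v≢b _) (v≢b _) e)))
           (sym (+-identityʳ _)))
    where
    v≢b : ∀ t → v ≢ b t
    v≢b t e = ∉ (t , sym e)
    b′ : Fin r → Fin n
    b′ t = punchOut (v≢b t)

length-perms : ∀ n → length (perms n) ≡ n !
length-perms n = trans (sym (*-identityʳ _)) (trans (sym (∑-const (perms n) 1))
  (trans (∑-cong (perms n) (λ g → sym (⟦⟧-yes (extends? {0} (λ ()) (λ ()) g) (λ ()))))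
         (#extensions n {0} (λ ()) (λ ()) (λ {}) (λ {}))))

extension : ∀ {n r} (a b : Fin r → Fin n) → Injective a → Injective b →
            ∃[ g ] (g ∈ perms n × Extends a b g)
extension {n} {r} a b a-inj b-inj = ∑-positive (perms n) (extends? a b)
  (subst (1 ≤ℕ_) (sym (#extensions n a b a-inj b-inj)) (1≤n! (n ∸ r)))

-- Matchings and their images under the product of symmetric groups

private variable
  k r : ℕ
  ns : Vec ℕ k
  Φ : ℕ → Set

injective⇒surjective : ∀ {n} (f : Fin n → Fin n) → Injective f → ∀ j → ∃[ i ] f i ≡ j
injective⇒surjective {suc n} f inj j with any? (λ i → f i ≟ j)
... | yes hit  = hit
... | no  miss = contradiction (injective⇒≤ {f = λ i → punchOut (j≢f i)} (λ e → inj (punchOut-injective (j≢f _) (j≢f _) e))) 1+n≰n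
  where
  j≢f : ∀ i → j ≢ f i
  j≢f i e = miss (i , sym e)

perm-injective : ∀ {n} (g : Vec (Fin n) n) → g ∈ perms n → Injective (lookup g)
perm-injective {suc n} g g∈ {i} {j} eq
  with v , h , _ , h∈ , refl ← ∈-cartesianProductWith⁻ (λ v g → v ∷ mapᵛ (punchIn v) g) (allFin (suc n)) (perms n) g∈
  with i | j
... | zero  | zero  = refl
... | zero  | suc j = contradiction (sym (trans eq (lookup-map j (punchIn v) h))) (punchInᵢ≢i v _)
... | suc i | zero  = contradiction (trans (sym (lookup-map i (punchIn v) h)) eq) (punchInᵢ≢i v _)
... | suc i | suc j = cong suc (perm-injective h h∈ (punchIn-injective v _ _
  (trans (sym (lookup-map i (punchIn v) h)) (trans eq (lookup-map j (punchIn v) h)))))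

choices : (∀ n → List (Φ n)) → (ns : Vec ℕ k) → List (All Φ ns)
choices f []       = [] ∷ []
choices f (n ∷ ns) = cartesianProductWith _∷_ (f n) (choices f ns)

∑-choices : ∀ (f : ∀ n → List (Φ n)) (φ : ℕ → ℕ) (ns : Vec ℕ k)
            {P : ∀ l → Φ (lookup ns l) → Set} (P? : ∀ l x → Dec (P l x)) →
            (∀ l → ∑ (f (lookup ns l)) (λ x → ⟦ P? l x ⟧) ≡ φ (lookup ns l)) →
            ∑ (choices f ns) (λ g → ⟦ ∀? (λ l → P? l (lookup⁺ g l)) ⟧) ≡ ∏ (mapᵛ φ ns)
∑-choices {Φ = Φ} f φ []       P? eq = cong (_+ 0) (⟦⟧-yes (∀? (λ l → P? l (lookup⁺ {P = Φ} [] l))) (λ ()))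
∑-choices f φ (n ∷ ns) P? eq = begin
  ∑ (choices f (n ∷ ns)) (λ g → ⟦ ∀? (λ l → P? l (lookup⁺ g l)) ⟧)
    ≡⟨ ∑-product _∷_ (f n) (choices f ns) _ ⟩
  ∑ (f n) (λ x → ∑ (choices f ns) (λ g → ⟦ ∀? (λ l → P? l (lookup⁺ (x ∷ g) l)) ⟧))
    ≡⟨ ∑-cong (f n) (λ x → trans (∑-cong (choices f ns) (split x))
                                 (∑-*ˡ (choices f ns) (λ g → ⟦ ∀? (λ l → P? (suc l) (lookup⁺ g l)) ⟧) ⟦ P? zero x ⟧)) ⟩
  ∑ (f n) (λ x → ⟦ P? zero x ⟧ * ∑ (choices f ns) (λ g → ⟦ ∀? (λ l → P? (suc l) (lookup⁺ g l)) ⟧))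
    ≡⟨ ∑-*ʳ (f n) (λ x → ⟦ P? zero x ⟧) _ ⟩
  ∑ (f n) (λ x → ⟦ P? zero x ⟧) * ∑ (choices f ns) (λ g → ⟦ ∀? (λ l → P? (suc l) (lookup⁺ g l)) ⟧)
    ≡⟨ cong₂ _*_ (eq zero) (∑-choices f φ ns (P? ∘ suc) (eq ∘ suc)) ⟩
  φ n * ∏ (mapᵛ φ ns) ∎
  where
  open ≡-Reasoning
  split : ∀ x g → ⟦ ∀? (λ l → P? l (lookup⁺ (x ∷ g) l)) ⟧
                ≡ ⟦ P? zero x ⟧ * ⟦ ∀? (λ l → P? (suc l) (lookup⁺ g l)) ⟧
  split x g with P? zero x
  ... | no ¬p = ⟦⟧-no (∀? (λ l → P? l (lookup⁺ (x ∷ g) l))) (λ h → ¬p (h zero))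
  ... | yes p = trans (⟦⟧-cong (∀? (λ l → P? l (lookup⁺ (x ∷ g) l))) (∀? (λ l → P? (suc l) (lookup⁺ g l)))
                         (λ h l → h (suc l)) (λ { h zero → p ; h (suc l) → h l }))
                      (sym (+-identityʳ _))

length-choices : ∀ (f : ∀ n → List (Φ n)) (φ : ℕ → ℕ) → (∀ n → length (f n) ≡ φ n) →
                 (ns : Vec ℕ k) → length (choices f ns) ≡ ∏ (mapᵛ φ ns)
length-choices f φ eq []       = refl
length-choices f φ eq (n ∷ ns) =
  trans (length≡∑ (choices f (n ∷ ns)))
  (trans (∑-product _∷_ (f n) (choices f ns) _)
  (trans (∑-cong (f n) (λ _ → sym (length≡∑ (choices f ns))))
  (trans (∑-const (f n) _) (cong₂ _*_ (eq n) (length-choices f φ eq ns)))))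
  where
  length≡∑ : ∀ {A : Set} (xs : List A) → length xs ≡ ∑ xs (λ _ → 1)
  length≡∑ xs = sym (trans (∑-const xs 1) (*-identityʳ _))

∈-choices⁺ : ∀ (f : ∀ n → List (Φ n)) {ns : Vec ℕ k} (g : All Φ ns) →
             (∀ l → lookup⁺ g l ∈ f (lookup ns l)) → g ∈ choices f ns
∈-choices⁺ f []      _  = here refl
∈-choices⁺ f (x ∷ g) g∈ = ∈-cartesianProductWith⁺ _∷_ (g∈ zero) (∈-choices⁺ f g (g∈ ∘ suc))

∈-choices⁻ : ∀ (f : ∀ n → List (Φ n)) (ns : Vec ℕ k) {g} → g ∈ choices f ns →
             ∀ l → lookup⁺ g l ∈ f (lookup ns l)
∈-choices⁻ f (n ∷ ns) g∈ l with ∈-cartesianProductWith⁻ _∷_ (f n) (choices f ns) g∈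
∈-choices⁻ f (n ∷ ns) g∈ zero    | x , h , x∈ , h∈ , refl = x∈
∈-choices⁻ f (n ∷ ns) g∈ (suc l) | x , h , x∈ , h∈ , refl = ∈-choices⁻ f ns h∈ l

lookup⁺-lookup⁻ : ∀ (ns : Vec ℕ k) (h : ∀ l → Φ (lookup ns l)) l → lookup⁺ (lookup⁻ {P = Φ} {xs = ns} h) l ≡ h l
lookup⁺-lookup⁻ (n ∷ ns) h zero    = refl
lookup⁺-lookup⁻ {Φ = Φ} (n ∷ ns) h (suc l) = lookup⁺-lookup⁻ {Φ = Φ} ns (h ∘ suc) l

lookup⁺-ext : ∀ {ns : Vec ℕ k} (e f : All Φ ns) → (∀ l → lookup⁺ e l ≡ lookup⁺ f l) → e ≡ f
lookup⁺-ext []      []      eq = refl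
lookup⁺-ext (x ∷ e) (y ∷ f) eq = cong₂ _∷_ (eq zero) (lookup⁺-ext e f (eq ∘ suc))

Perm : ℕ → Set
Perm n = Vec (Fin n) n

groupElements : (ns : Vec ℕ k) → List (All Perm ns)
groupElements = choices perms

allEdges : (ns : Vec ℕ k) → List (Edge ns)
allEdges = choices allFin

length-groupElements : (ns : Vec ℕ k) → length (groupElements ns) ≡ ∏ (mapᵛ _! ns)
length-groupElements = length-choices perms _! length-perms

length-allEdges : (ns : Vec ℕ k) → length (allEdges ns) ≡ ∏ (mapᵛ (λ n → n) ns)
length-allEdges = length-choices allFin (λ n → n) (λ n → length-tabulate {n = n} (λ x → x))

∈-allEdges : (e : Edge ns) → e ∈ allEdges ns
∈-allEdges e = ∈-choices⁺ allFin e (λ l → ∈-allFin (lookup⁺ e l))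

infix 4 _≟ᵉ_
opaque
  _≟ᵉ_ : (e f : Edge ns) → Dec (e ≡ f)
  e ≟ᵉ f = map′ (lookup⁺-ext e f) (λ { refl _ → refl }) (∀? (λ l → lookup⁺ e l ≟ lookup⁺ f l))

opaque
  act : All Perm ns → Edge ns → Edge ns
  act g e = lookup⁻ (λ l → lookup (lookup⁺ g l) (lookup⁺ e l))

  lookup-act : ∀ (g : All Perm ns) e l → lookup⁺ (act g e) l ≡ lookup (lookup⁺ g l) (lookup⁺ e l)
  lookup-act {ns = ns} g e l = lookup⁺-lookup⁻ {Φ = Fin} ns (λ l → lookup (lookup⁺ g l) (lookup⁺ e l)) l

-- W lists the edges of an r-matching in a definite order.

record Ordered {ns : Vec ℕ k} (W : Fin r → Edge ns) : Set where
  constructor ordered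
  field
    injectiveAt : ∀ l → Injective (λ s → lookup⁺ (W s) l)

open Ordered public

act-ordered : ∀ {g : All Perm ns} → g ∈ groupElements ns → ∀ {W : Fin r → Edge ns} → Ordered W → Ordered (act g ∘ W)
act-ordered {ns = ns} {g = g} g∈ {W} W-inj .injectiveAt l {i} {j} eq = injectiveAt W-inj l (perm-injective (lookup⁺ g l) (∈-choices⁻ perms ns g∈ l)
  (trans (sym (lookup-act g (W i) l)) (trans eq (lookup-act g (W j) l))))

-- Equality of edges splits into the coordinates, where `#extensions` counts. `P` may be any
-- formulation of the r equations; for r = 1 it is a single equation.
#actions : ∀ (V W : Fin r → Edge ns) → Ordered V → Ordered W →
           {P : All Perm ns → Set} (P? : ∀ g → Dec (P g)) →
           (∀ g → P g → ∀ s → act g (V s) ≡ W s) → (∀ g → (∀ s → act g (V s) ≡ W s) → P g) →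
           ∑ (groupElements ns) (λ g → ⟦ P? g ⟧) ≡ ∏ (mapᵛ (λ n → (n ∸ r) !) ns)
#actions {r = r} {ns = ns} V W V-inj W-inj P? to from = trans
  (∑-cong (groupElements ns) (λ g → ⟦⟧-cong (P? g) (∀? (λ l → ext? l (lookup⁺ g l)))
     (λ p l s → trans (sym (lookup-act g (V s) l)) (cong (λ e → lookup⁺ e l) (to g p s)))
     (λ p → from g (λ s → lookup⁺-ext _ _ (λ l → trans (lookup-act g (V s) l) (p l s))))))
  (∑-choices perms (λ n → (n ∸ r) !) ns ext? (λ l → #extensions (lookup ns l) (λ s → lookup⁺ (V s) l) (λ s → lookup⁺ (W s) l) (injectiveAt V-inj l) (injectiveAt W-inj l)))
  where
  ext? : ∀ l x → Dec (Extends (λ s → lookup⁺ (V s) l) (λ s → lookup⁺ (W s) l) x)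
  ext? l = extends? (λ s → lookup⁺ (V s) l) (λ s → lookup⁺ (W s) l)

module _ {ns : Vec ℕ k} {r : ℕ} (M : Matching ns r) where

  edge : Fin r → Edge ns
  edge = lookup (Matching.edges M)

  edge-ordered : Ordered edge
  edge-ordered .injectiveAt l = go (Matching.disjoint M)
    where
    go : ∀ {r} {es : Vec (Edge ns) r} → AllPairs Disjoint es → Injective (λ s → lookup⁺ (lookup es s) l)
    go (d ∷ ds) {zero}  {zero}  eq = refl
    go (d ∷ ds) {zero}  {suc j} eq = contradiction eq (lookup⁺ d j l)
    go (d ∷ ds) {suc i} {zero}  eq = contradiction (sym eq) (lookup⁺ d i l)
    go (d ∷ ds) {suc i} {suc j} eq = cong suc (go ds eq)

  position : ∀ {e} → e ∈ᵉ M → Fin r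
  position = Anyᵛ.index

  edge-position : ∀ {e} (e∈ : e ∈ᵉ M) → e ≡ edge (position e∈)
  edge-position = Anyᵛₚ.lookup-index

  edge∈ : ∀ s → edge s ∈ᵉ M
  edge∈ s = ∈-lookup s (Matching.edges M)

  infix 4 _∈ᵉ?
  opaque
    _∈ᵉ? : ∀ e → Dec (e ∈ᵉ M)
    e ∈ᵉ? = DecMembershipᵛ._∈?_ _≟ᵉ_ e (Matching.edges M)

  Lists : (Fin r → Edge ns) → Set
  Lists W = ∀ s → W s ∈ᵉ M

  opaque
    lists? : ∀ W → Dec (Lists W)
    lists? W = ∀? (λ s → W s ∈ᵉ?)

matching : ∀ {ns : Vec ℕ k} (W : Fin r → Edge ns) → Ordered W → Matching ns r
matching W W-inj = record
  { edges    = Vec.tabulate W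
  ; disjoint = AllPairsₚ.tabulate⁺ (λ i≢j l eq → i≢j (injectiveAt W-inj l eq))
  }

module _ {ns : Vec ℕ (suc k)} {r : ℕ} where

  ordered-injective : ∀ {W : Fin r → Edge ns} → Ordered W → Injective W
  ordered-injective W-inj eq = injectiveAt W-inj zero (cong (λ e → lookup⁺ e zero) eq)

  module _ (M : Matching ns r) {W : Fin r → Edge ns} (W-inj : Ordered W) (W⊆M : Lists M W) where

    relabel : Fin r → Fin r
    relabel s = position M (W⊆M s)

    edge-relabel : ∀ s → W s ≡ edge M (relabel s)
    edge-relabel s = edge-position M (W⊆M s)

    relabel-injective : Injective relabel
    relabel-injective {i} {j} eq = ordered-injective W-inj
      (trans (edge-relabel i) (trans (cong (edge M) eq) (sym (edge-relabel j))))

    -- Distinct edges of `M` occupy distinct positions, and r of them occupy all r positions.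
    lists-all : ∀ {e} → e ∈ᵉ M → ∃[ s ] e ≡ W s
    lists-all e∈ with s , eq ← injective⇒surjective relabel relabel-injective (position M e∈) =
      s , trans (edge-position M e∈) (trans (cong (edge M) (sym eq)) (sym (edge-relabel s)))

  lists-≈ : ∀ {W : Fin r → Edge ns} → Ordered W → ∀ M N → Lists M W → Lists N W → M ≈ N
  lists-≈ W-inj M N W⊆M W⊆N e = mk⇔ (move M N W⊆M W⊆N) (move N M W⊆N W⊆M)
    where
    move : ∀ M N → Lists M _ → Lists N _ → e ∈ᵉ M → e ∈ᵉ N
    move M N W⊆M W⊆N e∈ with s , refl ← lists-all M W-inj W⊆M e∈ = W⊆N s

  -- Every ordered listing of M is obtained from M's own listing by exactly one permutation of the positions.

  ⟦lists⟧ : ∀ (M : Matching ns r) {W} → Ordered W →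
            ⟦ lists? M W ⟧ ≡ ∑ (perms r) (λ τ → ⟦ ∀? (λ s → W s ≟ᵉ edge M (lookup τ s)) ⟧)
  ⟦lists⟧ M {W} W-inj with lists? M W
  ... | no  W⊈M = sym (∑-zero (perms r) (λ τ → ⟦⟧-no (∀? (λ s → W s ≟ᵉ edge M (lookup τ s)))
          (λ eq → W⊈M (λ s → subst (_∈ᵉ M) (sym (eq s)) (edge∈ M (lookup τ s))))))
  ... | yes W⊆M = sym (trans
    (∑-cong (perms r) (λ τ → ⟦⟧-cong (∀? (λ s → W s ≟ᵉ edge M (lookup τ s))) (extends? (λ s → s) (relabel M W-inj W⊆M) τ)
       (λ eq s → ordered-injective (edge-ordered M) (trans (sym (eq s)) (edge-relabel M W-inj W⊆M s)))
       (λ eq s → trans (edge-relabel M W-inj W⊆M s) (cong (edge M) (sym (eq s))))))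
    (trans (#extensions r (λ s → s) (relabel M W-inj W⊆M) (λ eq → eq) (relabel-injective M W-inj W⊆M))
           (cong _! (n∸n≡0 r))))

  -- The number of group elements carrying one r-matching onto another: r! orders of the image, and
  -- (n - r)! extensions in each part of size n.
  #stabiliser : ℕ
  #stabiliser = r ! * ∏ (mapᵛ (λ n → (n ∸ r) !) ns)

  ∑-lists : ∀ (M : Matching ns r) {W} → Ordered W →
            ∑ (groupElements ns) (λ g → ⟦ lists? M (act g ∘ W) ⟧) ≡ #stabiliser
  ∑-lists M {W} W-inj = begin
    ∑ G (λ g → ⟦ lists? M (act g ∘ W) ⟧)
      ≡⟨ ∑-cong-∈ G (λ g g∈ → ⟦lists⟧ M (act-ordered g∈ W-inj)) ⟩
    ∑ G (λ g → ∑ (perms r) (λ τ → ⟦ agree? τ g ⟧))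
      ≡⟨ ∑-comm G (perms r) _ ⟩
    ∑ (perms r) (λ τ → ∑ G (λ g → ⟦ agree? τ g ⟧))
      ≡⟨ ∑-cong-∈ (perms r) (λ τ τ∈ → #actions W (edge M ∘ lookup τ) W-inj
           (ordered λ l eq → perm-injective τ τ∈ (injectiveAt (edge-ordered M) l eq)) (agree? τ) (λ _ p → p) (λ _ p → p)) ⟩
    ∑ (perms r) (λ _ → ∏ (mapᵛ (λ n → (n ∸ r) !) ns))
      ≡⟨ trans (∑-const (perms r) _) (cong (_* ∏ (mapᵛ (λ n → (n ∸ r) !) ns)) (length-perms r)) ⟩
    #stabiliser ∎
    where
    open ≡-Reasoning
    G = groupElements ns
    agree? : ∀ τ g → Dec (∀ s → act g (W s) ≡ edge M (lookup τ s))
    agree? τ g = ∀? (λ s → act g (W s) ≟ᵉ edge M (lookup τ s))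

  module _ (F : Family ns r) where

    open Family F

    Listed : (Fin r → Edge ns) → Set
    Listed W = Any.Any (λ M → Lists M W) members

    opaque
      listed? : ∀ W → Dec (Listed W)
      listed? W = Any.any? (λ M → lists? M W) members

    -- Members listing the same `W` are equal as sets of edges, so at most one summand is nonzero.
    ⟦listed⟧ : ∀ {W} → Ordered W → ⟦ listed? W ⟧ ≡ ∑ members (λ M → ⟦ lists? M W ⟧)
    ⟦listed⟧ {W} W-inj = trans (⟦⟧-cong (listed? W) (Any.any? (λ M → lists? M W) members) (λ p → p) (λ p → p)) (go members unique)
      where
      go : ∀ Ms → AllPairsˡ.AllPairs (λ M N → ¬ M ≈ N) Ms →
           ⟦ Any.any? (λ M → lists? M W) Ms ⟧ ≡ ∑ Ms (λ M → ⟦ lists? M W ⟧)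
      go []       _                       = refl
      go (M ∷ Ms) (M≉ AllPairsˡ.∷ uniq) with lists? M W
      ... | no  W⊈M = go Ms uniq
      ... | yes W⊆M = cong suc (sym
              (trans (∑-cong-∈ Ms (λ N N∈ → ⟦⟧-no (lists? N W) (λ W⊆N → Allˡ.lookup M≉ N∈ (lists-≈ W-inj M N W⊆M W⊆N))))
                     (∑-zero Ms (λ _ → refl))))

    -- The value does not depend on `W`, since the group carries an ordered r-matching to every
    -- other one equally often.
    ∑-listed : ∀ {W} → Ordered W →
               ∑ (groupElements ns) (λ g → ⟦ listed? (act g ∘ W) ⟧) ≡ ∣ F ∣ * #stabiliser
    ∑-listed {W} W-inj = begin
      ∑ G (λ g → ⟦ listed? (act g ∘ W) ⟧)
        ≡⟨ ∑-cong-∈ G (λ g g∈ → ⟦listed⟧ (act-ordered g∈ W-inj)) ⟩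
      ∑ G (λ g → ∑ members (λ M → ⟦ lists? M (act g ∘ W) ⟧))
        ≡⟨ ∑-comm G members _ ⟩
      ∑ members (λ M → ∑ G (λ g → ⟦ lists? M (act g ∘ W) ⟧))
        ≡⟨ ∑-cong members (λ M → ∑-lists M W-inj) ⟩
      ∑ members (λ _ → #stabiliser)
        ≡⟨ ∑-const members #stabiliser ⟩
      ∣ F ∣ * #stabiliser ∎
      where
      open ≡-Reasoning
      G = groupElements ns

-- Arcs of cycles

infixl 6 _⊕_

_⊕_ : ∀ {n} → Fin n → ℕ → Fin n
_⊕_ {suc n} i q = fromℕ< (m%n<n (toℕ i + q) (suc n))

toℕ-⊕ : ∀ {n} .{{_ : NonZero n}} (i : Fin n) q → toℕ (i ⊕ q) ≡ (toℕ i + q) % n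
toℕ-⊕ {suc n} i q = toℕ-fromℕ< (m%n<n (toℕ i + q) (suc n))

%-+ʳ : ∀ x c n .{{_ : NonZero n}} → (x % n + c) % n ≡ (x + c) % n
%-+ʳ x c n = trans (%-distribˡ-+ (x % n) c n) (trans (cong (λ z → (z + c % n) % n) (m%n%n≡m%n x n)) (sym (%-distribˡ-+ x c n)))

%-cancelʳ : ∀ x y c n .{{_ : NonZero n}} → (x + c) % n ≡ (y + c) % n → x % n ≡ y % n
%-cancelʳ x y c (suc n) eq = trans (sym (back x)) (trans (cong (λ z → (z + c * n) % suc n) eq) (back y))
  where
  -- Adding `c * n` completes `c` to the multiple `c * suc n` of the modulus, in place of a
  -- subtraction.
  back : ∀ x → ((x + c) % suc n + c * n) % suc n ≡ x % suc n
  back x = trans (%-+ʳ (x + c) (c * n) (suc n))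
    (trans (cong (_% suc n) (trans (+-assoc x c (c * n)) (cong (x +_) (sym (*-suc c n))))) ([m+kn]%n≡m%n x c (suc n)))

%-toℕ : ∀ {n} .{{_ : NonZero n}} (i : Fin n) → toℕ i % n ≡ toℕ i
%-toℕ i = m<n⇒m%n≡m (toℕ<n i)

⊕-injectiveˡ : ∀ {n} {i j : Fin n} q → i ⊕ q ≡ j ⊕ q → i ≡ j
⊕-injectiveˡ {suc n} {i} {j} q eq = toℕ-injective (begin
  toℕ i           ≡⟨ %-toℕ i ⟨
  toℕ i % suc n   ≡⟨ %-cancelʳ (toℕ i) (toℕ j) q (suc n) (trans (sym (toℕ-⊕ i q)) (trans (cong toℕ eq) (toℕ-⊕ j q))) ⟩
  toℕ j % suc n   ≡⟨ %-toℕ j ⟩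
  toℕ j           ∎)
  where open ≡-Reasoning

⊕-injectiveʳ : ∀ {n} (i : Fin n) {a b} → a < n → b < n → i ⊕ a ≡ i ⊕ b → a ≡ b
⊕-injectiveʳ {suc n} i {a} {b} a<n b<n eq = begin
  a           ≡⟨ m<n⇒m%n≡m a<n ⟨
  a % suc n   ≡⟨ %-cancelʳ a b (toℕ i) (suc n) (trans (cong (_% suc n) (+-comm a (toℕ i)))
                  (trans (trans (sym (toℕ-⊕ i a)) (trans (cong toℕ eq) (toℕ-⊕ i b))) (cong (_% suc n) (+-comm (toℕ i) b)))) ⟩
  b % suc n   ≡⟨ m<n⇒m%n≡m b<n ⟩
  b           ∎
  where open ≡-Reasoning

⊕-+ : ∀ {n} (i : Fin n) a b → (i ⊕ a) ⊕ b ≡ i ⊕ (a + b)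
⊕-+ {suc n} i a b = toℕ-injective (begin
  toℕ (i ⊕ a ⊕ b)                     ≡⟨ toℕ-⊕ (i ⊕ a) b ⟩
  (toℕ (i ⊕ a) + b) % suc n           ≡⟨ cong (λ z → (z + b) % suc n) (toℕ-⊕ i a) ⟩
  ((toℕ i + a) % suc n + b) % suc n   ≡⟨ %-+ʳ (toℕ i + a) b (suc n) ⟩
  (toℕ i + a + b) % suc n             ≡⟨ cong (_% suc n) (+-assoc (toℕ i) a b) ⟩
  (toℕ i + (a + b)) % suc n           ≡⟨ toℕ-⊕ i (a + b) ⟨
  toℕ (i ⊕ (a + b))                   ∎)
  where open ≡-Reasoning

⊕-0 : ∀ {n} (i : Fin n) → i ⊕ 0 ≡ i
⊕-0 {suc n} i = toℕ-injective (trans (toℕ-⊕ i 0) (trans (cong (_% suc n) (+-identityʳ (toℕ i))) (%-toℕ i)))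

⊕-fixed : ∀ {n} .{{_ : NonZero n}} (i : Fin n) q → i ⊕ q ≡ i → q % n ≡ 0
⊕-fixed {suc n} i q eq = %-cancelʳ q 0 (toℕ i) (suc n)
  (trans (cong (_% suc n) (+-comm q (toℕ i))) (trans (sym (toℕ-⊕ i q)) (trans (cong toℕ eq) (sym (%-toℕ i)))))

⊕-noWrap : ∀ {n} (i : Fin n) q → toℕ i + q < n → toℕ (i ⊕ q) ≡ toℕ i + q
⊕-noWrap {suc n} i q lt = trans (toℕ-⊕ i q) (m<n⇒m%n≡m lt)

-- Full turns add up when a walk is continued from the remainder; this makes walks along a cycle
-- compose.
/-accumulate : ∀ x e n .{{_ : NonZero n}} → x div n + (x % n + e) div n ≡ (x + e) div n
/-accumulate x e n = begin
  x div n + (x % n + e) div n            ≡⟨ +-comm (x div n) _ ⟩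
  (x % n + e) div n + x div n            ≡⟨ cong ((x % n + e) div n +_) (m*n/n≡m (x div n) n) ⟨
  (x % n + e) div n + (x div n * n) div n  ≡⟨ +-distrib-/-∣ʳ (x % n + e) (divides (x div n) refl) ⟨
  (x % n + e + x div n * n) div n        ≡⟨ /-congˡ {o = n} (trans (+-assoc (x % n) e _) (trans (cong (x % n +_) (+-comm e _)) (sym (+-assoc (x % n) _ e)))) ⟩
  (x % n + x div n * n + e) div n        ≡⟨ /-congˡ {o = n} (cong (_+ e) (sym (m≡m%n+[m/n]*n x n))) ⟩
  (x + e) div n                        ∎
  where
  open ≡-Reasoning

module _ {X : Set} (xs : List X) {r : ℕ} {χ : X → Set} (χ? : ∀ x → Dec (χ x))
         {Q : X → Fin r → Set} (Q? : ∀ x d → Dec (Q x d)) (classify : ∀ x → χ x → ∃[ d ] Q x d)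
         (unique : ∀ d → ∑ xs (λ x → ⟦ Q? x d ⟧) ≤ℕ 1) where

  private
    χ≤Q : ∀ x → ⟦ χ? x ⟧ ≤ℕ ∑ (allFin r) (λ d → ⟦ Q? x d ⟧)
    χ≤Q x with χ? x
    ... | no  _ = z≤n
    ... | yes c with d , q ← classify x c =
      ≤-trans (≤-reflexive (sym (trans (∑-single {φ = λ e → ⟦ e ≟ d ⟧} d (λ e e≢d → ⟦⟧-no (e ≟ d) e≢d)) (⟦⟧-yes (d ≟ d) refl))))
              (∑-mono-∈ (allFin r) (λ e _ → ⟦⟧-mono (e ≟ d) (Q? x e) (λ { refl → q })))

    χ≤∑Q : ∑ xs (λ x → ⟦ χ? x ⟧) ≤ℕ ∑ (allFin r) (λ d → ∑ xs (λ x → ⟦ Q? x d ⟧))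
    χ≤∑Q = ≤-trans (∑-mono-∈ xs (λ x _ → χ≤Q x)) (≤-reflexive (∑-comm xs (allFin r) (λ x d → ⟦ Q? x d ⟧)))

  pigeonhole-≤ : ∑ xs (λ x → ⟦ χ? x ⟧) ≤ℕ r
  pigeonhole-≤ = ≤-trans χ≤∑Q (≤-trans (∑-mono-∈ (allFin r) (λ d _ → unique d))
    (≤-reflexive (trans (∑-allFin-const r 1) (*-identityʳ r))))

  pigeonhole-≡ : r ≤ℕ ∑ xs (λ x → ⟦ χ? x ⟧) → ∀ d → ∃[ x ] Q x d
  pigeonhole-≡ r≤ d = let x , _ , q = ∑-positive xs (λ x → Q? x d) (≤-reflexive (sym one)) in x , q
    where
    one : ∑ xs (λ x → ⟦ Q? x d ⟧) ≡ 1
    one = ∑-tight (allFin r) (λ d _ → unique d)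
      (≤-trans (≤-reflexive (trans (cong (_* 1) (length-tabulate {n = r} (λ x → x))) (*-identityʳ r))) (≤-trans r≤ χ≤∑Q)) d (∈-allFin d)

module _ {X : Set} (xs : List X) (_≟ˣ_ : ∀ (x y : X) → Dec (x ≡ y))
         (simple : ∀ y → ∑ xs (λ x → ⟦ x ≟ˣ y ⟧) ≤ℕ 1) where

  ∑-atMostOne : ∀ {P : X → Set} (P? : ∀ x → Dec (P x)) → (∀ x y → P x → P y → x ≡ y) → ∑ xs (λ x → ⟦ P? x ⟧) ≤ℕ 1
  ∑-atMostOne P? uniq with ∑ xs (λ x → ⟦ P? x ⟧) in eq
  ... | zero  = z≤n
  ... | suc c with y , _ , py ← ∑-positive xs P? (≤-trans (s≤s z≤n) (≤-reflexive (sym eq))) =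
    ≤-trans (≤-reflexive (sym eq)) (≤-trans (∑-mono-∈ xs (λ x _ → ⟦⟧-mono (P? x) (x ≟ˣ y) (λ px → uniq x y px py))) (simple y))

  -- Katona: pairwise intersecting arcs of length r in cycles of length at least 2r.  Relative to a
  -- member x*, class d consists of the arcs d steps after and r - d steps before x*; these two are disjoint.

  module Arcs (step : X → ℕ → X) (step-0 : ∀ x → step x 0 ≡ x) (step-+ : ∀ x a b → step (step x a) b ≡ step x (a + b))
              (step-injective : ∀ {x y} d → step x d ≡ step y d → x ≡ y)
              (r : ℕ) (aperiodic : ∀ x d → 1 ≤ℕ d → d < r + r → step x d ≢ x)
              {χ : X → Set} (χ? : ∀ x → Dec (χ x))
              (meet : ∀ x y → χ x → χ y → ∃₂ λ i j → i < r × j < r × step x i ≡ step y j) where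

    Class : X → X → Fin r → Set
    Class x* x d = χ x × (step x* (toℕ d) ≡ x ⊎ (1 ≤ℕ toℕ d × step x (r ∸ toℕ d) ≡ x*))

    private
      class? : ∀ x* x d → Dec (Class x* x d)
      class? x* x d = χ? x ×-dec ((step x* (toℕ d) ≟ˣ x) ⊎-dec ((1 ≤? toℕ d) ×-dec (step x (r ∸ toℕ d) ≟ˣ x*)))

      shorten : ∀ {x y} i j → j ≤ℕ i → step x i ≡ step y j → step x (i ∸ j) ≡ y
      shorten {x} i j j≤i eq = step-injective j (trans (step-+ x (i ∸ j) j) (trans (cong (step x) (m∸n+n≡m j≤i)) eq))

      classify : ∀ x* x → χ x* → χ x → ∃[ d ] Class x* x d
      classify x* x c* c with i , j , i<r , j<r , eq ← meet x* x c* c with ≤-total j i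
      ... | inj₁ j≤i = fromℕ< i∸j<r , c , inj₁ (trans (cong (step x*) (toℕ-fromℕ< i∸j<r)) (shorten i j j≤i eq))
        where
        i∸j<r : i ∸ j < r
        i∸j<r = ≤-<-trans (m∸n≤m i j) i<r
      ... | inj₂ i≤j with m≤n⇒m<n∨m≡n i≤j
      ...   | inj₂ refl = fromℕ< 0<r , c , inj₁ (trans (cong (step x*) (toℕ-fromℕ< 0<r)) (trans (step-0 x*) (step-injective j eq)))
        where
        0<r : 0 < r
        0<r = ≤-<-trans z≤n i<r
      -- Here `x*` lies `j ∸ i` steps after `x`, so the class is the d with r - d = j - i; it is
      -- positive because j - i < r.
      ...   | inj₁ i<j = fromℕ< e<r , c , inj₂
                ( ≤-trans (m<n⇒0<n∸m (≤-<-trans (m∸n≤m j i) j<r)) (≤-reflexive (sym (toℕ-fromℕ< e<r)))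
                , trans (cong (step x) (trans (cong (r ∸_) (toℕ-fromℕ< e<r)) (m∸[m∸n]≡n (<⇒≤ (≤-<-trans (m∸n≤m j i) j<r)))))
                        (shorten j i i≤j (sym eq)) )
        where
        e<r : r ∸ (j ∸ i) < r
        e<r = ∸-monoʳ-< (m<n⇒0<n∸m i<j) (<⇒≤ (≤-<-trans (m∸n≤m j i) j<r))

      -- Since `step y r ≡ x`, the arc at `x` begins where the arc at `y` ends. A common point would
      -- bring `y` back to itself after r + i - j steps, which is more than 0 and less than 2r; so
      -- the case is impossible.
      opposite : ∀ x* x y d → χ x → χ y → step x* (toℕ d) ≡ x → step y (r ∸ toℕ d) ≡ x* → x ≡ y
      opposite x* x y d cx cy ex ey with i , j , i<r , j<r , eq ← meet x y cx cy =
        contradiction (shorten (r + i) j (<⇒≤ j<r+i) (trans (sym (step-+ y r i)) (trans (cong (λ z → step z i) turn) eq)))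
                      (aperiodic y (r + i ∸ j) (m<n⇒0<n∸m j<r+i) (≤-<-trans (m∸n≤m (r + i) j) (+-monoʳ-< r i<r)))
        where
        j<r+i : j < r + i
        j<r+i = <-≤-trans j<r (m≤m+n r i)
        turn : step y r ≡ x
        turn = trans (cong (step y) (sym (m∸n+n≡m (<⇒≤ (toℕ<n d)))))
                     (trans (sym (step-+ y (r ∸ toℕ d) (toℕ d))) (trans (cong (λ z → step z (toℕ d)) ey) ex))

      same-class : ∀ x* d x y → Class x* x d → Class x* y d → x ≡ y
      same-class x* d x y (cx , inj₁ p)       (cy , inj₁ q)       = trans (sym p) q
      same-class x* d x y (cx , inj₁ p)       (cy , inj₂ (_ , q)) = opposite x* x y d cx cy p q
      same-class x* d x y (cx , inj₂ (_ , p)) (cy , inj₁ q)       = sym (opposite x* y x d cy cx q p)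
      same-class x* d x y (cx , inj₂ (_ , p)) (cy , inj₂ (_ , q)) = step-injective (r ∸ toℕ d) (trans p (sym q))

      unique : ∀ x* d → ∑ xs (λ x → ⟦ class? x* x d ⟧) ≤ℕ 1
      unique x* d = ∑-atMostOne (λ x → class? x* x d) (same-class x* d)

    arcs-≤ : ∑ xs (λ x → ⟦ χ? x ⟧) ≤ℕ r
    arcs-≤ with ∑ xs (λ x → ⟦ χ? x ⟧) in eq
    ... | zero  = z≤n
    ... | suc c with x* , _ , c* ← ∑-positive xs χ? (≤-trans (s≤s z≤n) (≤-reflexive (sym eq))) =
      ≤-trans (≤-reflexive (sym eq)) (pigeonhole-≤ xs χ? (class? x*) (λ x → classify x* x c*) (unique x*))

    arcs-≡ : ∀ x* → χ x* → r ≤ℕ ∑ xs (λ x → ⟦ χ? x ⟧) → ∀ d → ∃[ x ] Class x* x d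
    arcs-≡ x* c* r≤ = pigeonhole-≡ xs χ? (class? x*) (λ x → classify x* x c*) (unique x*) r≤

-- Windows of consecutive edges

∈⇒∈ᶠ : ∀ {k} {ns : Vec ℕ k} {r} (F : Family ns r) {M} → M ∈ Family.members F → M ∈ᶠ F
∈⇒∈ᶠ {ns = ns} {r} F {M} = Any.map (λ { refl → Setoid.refl (matchingSetoid {n = ns} {r}) {M} })

∑-allEdges : ∀ {k} {ns : Vec ℕ k} (f : Edge ns) → ∑ (allEdges ns) (λ e → ⟦ e ≟ᵉ f ⟧) ≤ℕ 1
∑-allEdges {ns = ns} f = ≤-reflexive (trans
  (∑-cong (allEdges ns) (λ e → ⟦⟧-cong (e ≟ᵉ f) (∀? (λ l → lookup⁺ e l ≟ lookup⁺ f l)) (λ { refl _ → refl }) (lookup⁺-ext e f)))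
  (trans (∑-choices allFin (λ _ → 1) ns (λ l x → x ≟ lookup⁺ f l) (λ l → ∑-unique (_≟ lookup⁺ f l) (lookup⁺ f l) refl (λ _ eq → eq)))
         (ones ns)))
  where
  ones : ∀ {k} (ns : Vec ℕ k) → ∏ (mapᵛ (λ _ → 1) ns) ≡ 1
  ones Vec.[] = refl
  ones (n Vec.∷ ns) = trans (+-identityʳ _) (ones ns)

wrap : ∀ n .{{_ : NonZero n}} {x} → x < n + n →
       (x div n ≡ 0 × x % n ≡ x) ⊎ (∃[ y ] (x ≡ n + y × x div n ≡ 1 × x % n ≡ y))
wrap n {x} x<2n with <-≤-connex x n
... | inj₁ x<n = inj₁ (m<n⇒m/n≡0 x<n , m<n⇒m%n≡m x<n)
... | inj₂ n≤x = inj₂ (x ∸ n , sym (m+[n∸m]≡n n≤x) , trans (m/n≡1+[m∸n]/n n≤x) (cong suc (m<n⇒m/n≡0 y<n))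
                      , trans (sym (m≤n⇒[n∸m]%m≡n%m n≤x)) (m<n⇒m%n≡m y<n))
  where
  y<n : x ∸ n < n
  y<n = +-cancelˡ-< n _ _ (≤-<-trans (≤-reflexive (m+[n∸m]≡n n≤x)) x<2n)

act-injective : ∀ {k} {ns : Vec ℕ k} {g : All Perm ns} → g ∈ groupElements ns → ∀ {e f} → act g e ≡ act g f → e ≡ f
act-injective {ns = ns} {g} g∈ {e} {f} eq = lookup⁺-ext e f λ l → perm-injective (lookup⁺ g l) (∈-choices⁻ perms ns g∈ l)
  (trans (sym (lookup-act g e l)) (trans (cong (λ z → lookup⁺ z l) eq) (lookup-act g f l)))

module Coordinates {k} (ns : Vec ℕ k) {m p : Fin k} (m≢p : m ≢ p) where

  private
    build : Fin (lookup ns m) → Fin (lookup ns p) → (∀ l → Fin (lookup ns l)) → ∀ l → Fin (lookup ns l)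
    build x y z l with l ≟ m
    ... | yes refl = x
    ... | no  _ with l ≟ p
    ...   | yes refl = y
    ...   | no  _    = z l

    build-m : ∀ x y z → build x y z m ≡ x
    build-m x y z with m ≟ m
    ... | yes refl = refl
    ... | no  m≢m  = contradiction refl m≢m

    build-p : ∀ x y z → build x y z p ≡ y
    build-p x y z with p ≟ m
    ... | yes p≡m = contradiction (sym p≡m) m≢p
    ... | no  _ with p ≟ p
    ...   | yes refl = refl
    ...   | no  p≢p  = contradiction refl p≢p

    build-other : ∀ x y z {l} → l ≢ m → l ≢ p → build x y z l ≡ z l
    build-other x y z {l} l≢m l≢p with l ≟ m
    ... | yes l≡m = contradiction l≡m l≢m
    ... | no  _ with l ≟ p
    ...   | yes l≡p = contradiction l≡p l≢p
    ...   | no  _   = refl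

  opaque
    compose : Fin (lookup ns m) → Fin (lookup ns p) → (∀ l → Fin (lookup ns l)) → Edge ns
    compose x y z = lookup⁻ (build x y z)

    compose-m : ∀ x y z → lookup⁺ (compose x y z) m ≡ x
    compose-m x y z = trans (lookup⁺-lookup⁻ {Φ = Fin} ns (build x y z) m) (build-m x y z)

    compose-p : ∀ x y z → lookup⁺ (compose x y z) p ≡ y
    compose-p x y z = trans (lookup⁺-lookup⁻ {Φ = Fin} ns (build x y z) p) (build-p x y z)

    compose-other : ∀ x y z {l} → l ≢ m → l ≢ p → lookup⁺ (compose x y z) l ≡ z l
    compose-other x y z {l} l≢m l≢p = trans (lookup⁺-lookup⁻ {Φ = Fin} ns (build x y z) l) (build-other x y z l≢m l≢p)

  coordinatewise : {P : Fin k → Set} → P m → P p → (∀ {l} → l ≢ m → l ≢ p → P l) → ∀ l → P l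
  coordinatewise pm pp po l with l ≟ m | l ≟ p
  ... | yes refl | _        = pm
  ... | no  _    | yes refl = pp
  ... | no  l≢m  | no  l≢p  = po l≢m l≢p

module Windows {k} (ns : Vec ℕ (suc k)) {m p : Fin (suc k)} (m≢p : m ≢ p) {r : ℕ} (1≤r : 1 ≤ℕ r)
               (r≤ : ∀ l → r ≤ℕ lookup ns l) (m-min : ∀ l → lookup ns m ≤ℕ lookup ns l)
               (F : Family ns r) (F-intersecting : Intersecting F) where

  open Family F
  open Coordinates ns m≢p

  instance
    part-nonZero : ∀ {l} → NonZero (lookup ns l)
    part-nonZero {l} = >-nonZero (≤-trans 1≤r (r≤ l))

  -- Rows are the vertices of part m, listed by ρ; columns those of part p, listed by σ.  An offset o
  -- stands for the cell in position o_m of the diagonal with shifts (o_l).  After a full turn through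
  -- the rows, step moves on to the next diagonal if β = 1, and starts the same diagonal again if β = 0.

  module _ (ρ : Fin (lookup ns m) → Fin (lookup ns m)) (ρ-inj : Injective ρ)
           (σ : Fin (lookup ns p) → Fin (lookup ns p)) (σ-inj : Injective σ) where

    -- The other coordinates follow the row `ρ i` itself, not its position i. Up to the shift they
    -- are then the same functions of the row in every arrangement, so that all arrangements for one
    -- g can be compared.
    cell : Edge ns → Edge ns
    cell o = compose (ρ (lookup⁺ o m)) (σ (lookup⁺ o p ⊕ toℕ (lookup⁺ o m))) (λ l → lookup⁺ o l ⊕ toℕ (ρ (lookup⁺ o m)))

    cell-injective : ∀ {o o′} → cell o ≡ cell o′ → o ≡ o′
    cell-injective {o} {o′} eq = lookup⁺-ext o o′ (coordinatewise row
      (⊕-injectiveˡ (toℕ (lookup⁺ o m)) (trans (σ-inj (trans (sym (compose-p _ _ _)) (trans (at p) (compose-p _ _ _))))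
        (cong (λ i → lookup⁺ o′ p ⊕ toℕ i) (sym row))))
      (λ {l} l≢m l≢p → ⊕-injectiveˡ (toℕ (ρ (lookup⁺ o m))) (trans (sym (compose-other _ _ _ l≢m l≢p)) (trans (at l)
        (trans (compose-other _ _ _ l≢m l≢p) (cong (λ i → lookup⁺ o′ l ⊕ toℕ (ρ i)) (sym row)))))))
      where
      at : ∀ l → lookup⁺ (cell o) l ≡ lookup⁺ (cell o′) l
      at l = cong (λ e → lookup⁺ e l) eq
      row : lookup⁺ o m ≡ lookup⁺ o′ m
      row = ρ-inj (trans (sym (compose-m _ _ _)) (trans (at m) (compose-m _ _ _)))

    DiagonalMember : All Perm ns → Set
    DiagonalMember g = ∃[ o ] ∃[ M ] (M ∈ members × (∀ e → e ∈ᵉ M → ∃[ i ]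
      ( lookup⁺ e m ≡ lookup (lookup⁺ g m) (ρ i)
      × lookup⁺ e p ≡ lookup (lookup⁺ g p) (σ (lookup⁺ {P = Fin} {xs = ns} o p ⊕ toℕ i))
      × (∀ {l} → l ≢ m → l ≢ p → lookup⁺ e l ≡ lookup (lookup⁺ g l) (lookup⁺ {P = Fin} {xs = ns} o l ⊕ toℕ (ρ i))))))

    module Steps (β : ℕ) (r+β≤ : r + β ≤ℕ lookup ns m) where

      private
        n = lookup ns m

      turns : Edge ns → ℕ → ℕ
      turns o d = β * ((toℕ (lookup⁺ o m) + d) div n)

      step : Edge ns → ℕ → Edge ns
      step o d = compose (lookup⁺ o m ⊕ d) (lookup⁺ o p ⊕ turns o d) (lookup⁺ o)

      step-0 : ∀ o → step o 0 ≡ o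
      step-0 o = lookup⁺-ext _ o (coordinatewise
        (trans (compose-m _ _ _) (⊕-0 _))
        (trans (compose-p _ _ _) (trans (cong (lookup⁺ o p ⊕_) none) (⊕-0 _)))
        (compose-other _ _ _))
        where
        none : turns o 0 ≡ 0
        none = trans (cong (β *_) (m<n⇒m/n≡0 (subst (_< n) (sym (+-identityʳ _)) (toℕ<n (lookup⁺ o m))))) (*-zeroʳ β)

      step-+ : ∀ o a b → step (step o a) b ≡ step o (a + b)
      step-+ o a b = lookup⁺-ext _ _ (coordinatewise
        (trans (compose-m _ _ _) (trans (cong (_⊕ b) (compose-m _ _ _)) (trans (⊕-+ (lookup⁺ o m) a b) (sym (compose-m _ _ _)))))
        (trans (compose-p _ _ _) (trans (cong₂ _⊕_ (compose-p _ _ _) refl)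
          (trans (⊕-+ (lookup⁺ o p) _ _) (trans (cong (lookup⁺ o p ⊕_) add) (sym (compose-p _ _ _))))))
        (λ l≢m l≢p → trans (compose-other _ _ _ l≢m l≢p) (trans (compose-other _ _ _ l≢m l≢p) (sym (compose-other _ _ _ l≢m l≢p)))))
        where
        open ≡-Reasoning
        i = toℕ (lookup⁺ o m)
        add : turns o a + turns (step o a) b ≡ turns o (a + b)
        add = begin
          turns o a + turns (step o a) b                    ≡⟨ *-distribˡ-+ β _ _ ⟨
          β * ((i + a) div n + (toℕ (lookup⁺ (step o a) m) + b) div n)
            ≡⟨ cong (λ z → β * ((i + a) div n + (z + b) div n)) (trans (cong toℕ (compose-m _ _ _)) (toℕ-⊕ (lookup⁺ o m) a)) ⟩
          β * ((i + a) div n + ((i + a) % n + b) div n)         ≡⟨ cong (β *_) (/-accumulate (i + a) b n) ⟩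
          β * ((i + a + b) div n)                             ≡⟨ cong (λ z → β * (z div n)) (+-assoc i a b) ⟩
          turns o (a + b)                                   ∎

      step-injective : ∀ {o o′} d → step o d ≡ step o′ d → o ≡ o′
      step-injective {o} {o′} d eq = lookup⁺-ext o o′ (coordinatewise row
        (⊕-injectiveˡ (turns o d) (trans (trans (sym (compose-p _ _ _)) (trans (at p) (compose-p _ _ _)))
          (cong (λ i → lookup⁺ o′ p ⊕ (β * ((toℕ i + d) div n))) (sym row))))
        (λ {l} l≢m l≢p → trans (sym (compose-other _ _ _ l≢m l≢p)) (trans (at l) (compose-other _ _ _ l≢m l≢p))))
        where
        at : ∀ l → lookup⁺ (step o d) l ≡ lookup⁺ (step o′ d) l
        at l = cong (λ e → lookup⁺ e l) eq
        row : lookup⁺ o m ≡ lookup⁺ o′ m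
        row = ⊕-injectiveˡ d (trans (sym (compose-m _ _ _)) (trans (at m) (compose-m _ _ _)))

      window : Edge ns → Fin r → Edge ns
      window o s = cell (step o (toℕ s))

      private
        r≤n : r ≤ℕ n
        r≤n = ≤-trans (m≤m+n r β) r+β≤

        column : Edge ns → ℕ → ℕ
        column o d = turns o d + (toℕ (lookup⁺ o m) + d) % n

        window-m : ∀ o s → lookup⁺ (window o s) m ≡ ρ (lookup⁺ o m ⊕ toℕ s)
        window-m o s = trans (compose-m _ _ _) (cong ρ (compose-m _ _ _))

        window-p : ∀ o s → lookup⁺ (window o s) p ≡ σ (lookup⁺ o p ⊕ column o (toℕ s))
        window-p o s = trans (compose-p _ _ _) (cong σ (trans
          (cong₂ _⊕_ (compose-p _ _ _) (trans (cong toℕ (compose-m _ _ _)) (toℕ-⊕ (lookup⁺ o m) (toℕ s))))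
          (⊕-+ (lookup⁺ o p) _ _)))

        window-other : ∀ o s {l} → l ≢ m → l ≢ p → lookup⁺ (window o s) l ≡ lookup⁺ o l ⊕ toℕ (ρ (lookup⁺ o m ⊕ toℕ s))
        window-other o s l≢m l≢p = trans (compose-other _ _ _ l≢m l≢p)
          (cong₂ (λ a b → a ⊕ toℕ (ρ b)) (compose-other _ _ _ l≢m l≢p) (compose-m _ _ _))

        sum-< : ∀ (i : Fin n) {d} → d < r → toℕ i + d < n + n
        sum-< i d<r = +-mono-< (toℕ<n i) (<-≤-trans d<r r≤n)

        -- After the wrap i + d = n + y; together with i < n and d + β ≤ r + β ≤ n this gives β + y
        -- < n.
        column-< : ∀ o {d} → d < r → column o d < n
        column-< o {d} d<r with wrap n (sum-< (lookup⁺ o m) d<r)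
        ... | inj₁ (x/n , x%n) rewrite x/n | *-zeroʳ β = m%n<n (toℕ (lookup⁺ o m) + d) n
        ... | inj₂ (y , x≡ , x/n , x%n) rewrite x/n | x%n | *-identityʳ β = +-cancelˡ-< n _ _ (begin-strict
          n + (β + y)                  ≡⟨ trans (sym (+-assoc n β y)) (trans (cong (_+ y) (+-comm n β)) (+-assoc β n y)) ⟩
          β + (n + y)                  ≡⟨ cong (β +_) x≡ ⟨
          β + (toℕ (lookup⁺ o m) + d)  ≡⟨ trans (+-comm β _) (+-assoc (toℕ (lookup⁺ o m)) d β) ⟩
          toℕ (lookup⁺ o m) + (d + β)  <⟨ +-mono-<-≤ (toℕ<n (lookup⁺ o m)) (≤-trans (+-monoˡ-≤ β (<⇒≤ d<r)) r+β≤) ⟩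
          n + n                        ∎)
          where open ≤-Reasoning

        -- Columns reached after the wrap stay below the initial one: i + e = n + y and β + e < β +
        -- r ≤ n give β + y < i.
        behind : ∀ i {d e y} → e < r → i + e ≡ n + y → i + d ≢ β + y
        behind i {d} {e} {y} e<r x≡ eq = <-irrefl refl (begin-strict
          n                  ≤⟨ m≤m+n n d ⟩
          n + d              ≡⟨ +-cancelˡ-≡ i (n + d) (β + e) (begin-equality
              i + (n + d)    ≡⟨ shuffle i n d ⟩
              n + (i + d)    ≡⟨ cong (n +_) eq ⟩
              n + (β + y)    ≡⟨ shuffle n β y ⟩
              β + (n + y)    ≡⟨ cong (β +_) x≡ ⟨
              β + (i + e)    ≡⟨ shuffle β i e ⟩
              i + (β + e)    ∎) ⟩
          β + e              <⟨ +-monoʳ-< β e<r ⟩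
          β + r              ≡⟨ +-comm β r ⟩
          r + β              ≤⟨ r+β≤ ⟩
          n                  ∎)
          where
          open ≤-Reasoning
          shuffle : ∀ a b c → a + (b + c) ≡ b + (a + c)
          shuffle a b c = trans (sym (+-assoc a b c)) (trans (cong (_+ c) (+-comm a b)) (+-assoc b a c))

        column-injective : ∀ o {d e} → d < r → e < r → column o d ≡ column o e → d ≡ e
        column-injective o {d} {e} d<r e<r eq
          with wrap n (sum-< (lookup⁺ o m) d<r) | wrap n (sum-< (lookup⁺ o m) e<r)
        ... | inj₁ (x/n , x%n) | inj₁ (x′/n , x′%n) rewrite x/n | x%n | x′/n | x′%n =
          +-cancelˡ-≡ (toℕ (lookup⁺ o m)) d e (+-cancelˡ-≡ (β * 0) _ _ eq)
        ... | inj₂ (y , x≡ , x/n , x%n) | inj₂ (y′ , x′≡ , x′/n , x′%n) rewrite x/n | x%n | x′/n | x′%n =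
          +-cancelˡ-≡ (toℕ (lookup⁺ o m)) d e (trans x≡ (trans (cong (n +_) (+-cancelˡ-≡ (β * 1) _ _ eq)) (sym x′≡)))
        ... | inj₁ (x/n , x%n) | inj₂ (y′ , x′≡ , x′/n , x′%n) rewrite x/n | x%n | x′/n | x′%n | *-zeroʳ β | *-identityʳ β =
          contradiction eq (behind (toℕ (lookup⁺ o m)) e<r x′≡)
        ... | inj₂ (y , x≡ , x/n , x%n) | inj₁ (x′/n , x′%n) rewrite x/n | x%n | x′/n | x′%n | *-zeroʳ β | *-identityʳ β =
          contradiction (sym eq) (behind (toℕ (lookup⁺ o m)) d<r x≡)

        row-injective : ∀ (i : Fin n) {s t : Fin r} → i ⊕ toℕ s ≡ i ⊕ toℕ t → s ≡ t
        row-injective i {s} {t} eq = toℕ-injective (⊕-injectiveʳ i (<-≤-trans (toℕ<n s) r≤n) (<-≤-trans (toℕ<n t) r≤n) eq)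

      -- Minimality of part m enters here: the row and column numbers, all below n_m, are distinct
      -- as rotation amounts in every other part as well.
      window-ordered : ∀ o → Ordered (window o)
      window-ordered o .injectiveAt = coordinatewise
        (λ {s} {t} eq → row-injective (lookup⁺ o m) (ρ-inj (trans (sym (window-m o s)) (trans eq (window-m o t)))))
        (λ {s} {t} eq → toℕ-injective (column-injective o (toℕ<n s) (toℕ<n t) (⊕-injectiveʳ (lookup⁺ o p)
          (<-≤-trans (column-< o (toℕ<n s)) (m-min p)) (<-≤-trans (column-< o (toℕ<n t)) (m-min p))
          (σ-inj (trans (sym (window-p o s)) (trans eq (window-p o t)))))))
        (λ {l} l≢m l≢p {s} {t} eq → row-injective (lookup⁺ o m) (ρ-inj (toℕ-injective (⊕-injectiveʳ (lookup⁺ o l)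
          (<-≤-trans (toℕ<n _) (m-min l)) (<-≤-trans (toℕ<n _) (m-min l))
          (trans (sym (window-other o s l≢m l≢p)) (trans eq (window-other o t l≢m l≢p)))))))

      Member : All Perm ns → Edge ns → Set
      Member g o = Listed F (act g ∘ window o)

      member? : ∀ g o → Dec (Member g o)
      member? g o = listed? F (act g ∘ window o)

      meet : ∀ {g} → g ∈ groupElements ns → ∀ o o′ → Member g o → Member g o′ →
             ∃₂ λ i j → i < r × j < r × step o i ≡ step o′ j
      meet {g} g∈ o o′ c c′ =
        let M , M∈ , W⊆M = find c
            N , N∈ , W⊆N = find c′
            e , e∈M , e∈N = F-intersecting M N (∈⇒∈ᶠ F M∈) (∈⇒∈ᶠ F N∈)
            s , eq  = lists-all M (act-ordered g∈ (window-ordered o)) W⊆M e∈M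
            t , eq′ = lists-all N (act-ordered g∈ (window-ordered o′)) W⊆N e∈N
        in toℕ s , toℕ t , toℕ<n s , toℕ<n t , cell-injective (act-injective g∈ (trans (sym eq) eq′))

      unwrapped : ∀ {g} → g ∈ groupElements ns → ∀ o → Member g o →
                  (∀ d → d < r → turns o d ≡ 0) → DiagonalMember g
      unwrapped {g} g∈ o c straight = let M , M∈ , W⊆M = find c in o , M , M∈ , λ e e∈ →
        let s , eq = lists-all M (act-ordered g∈ (window-ordered o)) W⊆M e∈ in lookup⁺ o m ⊕ toℕ s , at s eq
        where
        at : ∀ s {e} → e ≡ act g (window o s) →
             lookup⁺ e m ≡ lookup (lookup⁺ g m) (ρ (lookup⁺ o m ⊕ toℕ s))
             × lookup⁺ e p ≡ lookup (lookup⁺ g p) (σ (lookup⁺ o p ⊕ toℕ (lookup⁺ o m ⊕ toℕ s)))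
             × (∀ {l} → l ≢ m → l ≢ p → lookup⁺ e l ≡ lookup (lookup⁺ g l) (lookup⁺ o l ⊕ toℕ (ρ (lookup⁺ o m ⊕ toℕ s))))
        at s refl = trans (lookup-act g (window o s) m) (cong (lookup (lookup⁺ g m)) (window-m o s))
          , trans (lookup-act g (window o s) p) (cong (lookup (lookup⁺ g p)) (trans (window-p o s)
              (cong (λ z → σ (lookup⁺ o p ⊕ z)) (trans (cong (_+ (toℕ (lookup⁺ o m) + toℕ s) % n) (straight (toℕ s) (toℕ<n s)))
                (sym (toℕ-⊕ (lookup⁺ o m) (toℕ s)))))))
          , (λ {l} l≢m l≢p → trans (lookup-act g (window o s) l) (cong (lookup (lookup⁺ g l)) (window-other o s l≢m l≢p)))

    record Arrangement : Set where
      field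
        bump  : ℕ
        bump≤ : r + bump ≤ℕ lookup ns m
      open Steps bump bump≤
      field
        local-≤ : ∀ {g} → g ∈ groupElements ns → ∑ (allEdges ns) (λ o → ⟦ member? g o ⟧) ≤ℕ r
        local-≡ : ∀ {g} → g ∈ groupElements ns → r ≤ℕ ∑ (allEdges ns) (λ o → ⟦ member? g o ⟧) → DiagonalMember g

    -- Without a free row `bump` must be 0, and every window goes once round a single diagonal.
    -- Diagonals are disjoint, so two members starting in the same row are the same window; there
    -- are r starting rows.
    spanning : r ≡ lookup ns m → Arrangement
    spanning r≡n = record { bump = 0 ; bump≤ = ≤-reflexive (trans (+-identityʳ r) r≡n) ; local-≤ = local-≤ ; local-≡ = local-≡ }
      where
      open Steps 0 (≤-reflexive (trans (+-identityʳ r) r≡n))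

      SameStart : All Perm ns → Edge ns → Fin r → Set
      SameStart g o d = Member g o × toℕ (lookup⁺ o m) ≡ toℕ d

      same-start : ∀ {g} → g ∈ groupElements ns → ∀ d o o′ → SameStart g o d → SameStart g o′ d → o ≡ o′
      same-start g∈ d o o′ (c , eq) (c′ , eq′) = let i , j , _ , _ , meets = meet g∈ o o′ c c′ in
        same-diagonal i j (toℕ-injective (trans eq (sym eq′))) meets
        where
        same-diagonal : ∀ i j → lookup⁺ o m ≡ lookup⁺ o′ m → step o i ≡ step o′ j → o ≡ o′
        same-diagonal i j row meets = lookup⁺-ext o o′ (coordinatewise row
          (trans (sym (trans (compose-p _ _ _) (⊕-0 _))) (trans (at p) (trans (compose-p _ _ _) (⊕-0 _))))
          (λ {l} l≢m l≢p → trans (sym (compose-other _ _ _ l≢m l≢p)) (trans (at l) (compose-other _ _ _ l≢m l≢p))))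
          where
          at : ∀ l → lookup⁺ (step o i) l ≡ lookup⁺ (step o′ j) l
          at l = cong (λ e → lookup⁺ e l) meets

      local-≤ : ∀ {g} → g ∈ groupElements ns → ∑ (allEdges ns) (λ o → ⟦ member? g o ⟧) ≤ℕ r
      local-≤ {g} g∈ = pigeonhole-≤ (allEdges ns) (member? g) sameStart? classify
          (λ d → ∑-atMostOne (allEdges ns) _≟ᵉ_ ∑-allEdges (λ o → sameStart? o d) (same-start g∈ d))
        where
        sameStart? : ∀ o d → Dec (SameStart g o d)
        sameStart? o d = member? g o ×-dec (toℕ (lookup⁺ o m) ≟ℕ toℕ d)
        classify : ∀ o → Member g o → ∃[ d ] SameStart g o d
        classify o c = fromℕ< lt , c , sym (toℕ-fromℕ< lt)
          where
          lt : toℕ (lookup⁺ o m) < r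
          lt = <-≤-trans (toℕ<n _) (≤-reflexive (sym r≡n))

      local-≡ : ∀ {g} → g ∈ groupElements ns → r ≤ℕ ∑ (allEdges ns) (λ o → ⟦ member? g o ⟧) → DiagonalMember g
      local-≡ {g} g∈ r≤∑ =
        let o , _ , c = ∑-positive (allEdges ns) (member? g) (≤-trans 1≤r r≤∑) in unwrapped g∈ o c (λ _ _ → refl)

    -- A free row permits `bump` 1. Returning to the same row takes full turns, and to the same
    -- diagonal a number of turns divisible by n_p; so the period is n_p n_m, at least 2r because 1
    -- ≤ r < n_m ≤ n_p.
    straddling : r < lookup ns m → Arrangement
    straddling r<n = record { bump = 1 ; bump≤ = r+1≤n ; local-≤ = local-≤ ; local-≡ = local-≡ }
      where
      n = lookup ns m
      r+1≤n : r + 1 ≤ℕ n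
      r+1≤n = ≤-trans (≤-reflexive (+-comm r 1)) r<n
      open Steps 1 r+1≤n

      2r≤ : r + r ≤ℕ lookup ns p * n
      2r≤ = ≤-trans (≤-reflexive (cong (r +_) (sym (+-identityʳ r)))) (*-mono-≤ 2≤p (<⇒≤ r<n))
        where
        2≤p : 2 ≤ℕ lookup ns p
        2≤p = ≤-trans (s≤s 1≤r) (≤-trans r<n (m-min p))

      aperiodic : ∀ o d → 1 ≤ℕ d → d < r + r → step o d ≢ o
      aperiodic o d 1≤d d<2r eq = n≮n d (<-≤-trans d<2r (≤-trans 2r≤ (≤-trans (*-monoˡ-≤ n p≤t) (≤-reflexive (sym d≡tn)))))
        where
        d≡tn : d ≡ d div n * n
        d≡tn = trans (m≡m%n+[m/n]*n d n) (cong (_+ d div n * n)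
          (⊕-fixed (lookup⁺ o m) d (trans (sym (compose-m _ _ _)) (cong (λ e → lookup⁺ e m) eq))))
        turns≡ : turns o d ≡ d div n
        turns≡ = trans (+-identityʳ _) (trans (cong (λ z → (toℕ (lookup⁺ o m) + z) div n) d≡tn)
          (trans (+-distrib-/-∣ʳ (toℕ (lookup⁺ o m)) (divides (d div n) refl))
          (trans (cong₂ _+_ (m<n⇒m/n≡0 (toℕ<n (lookup⁺ o m))) (m*n/n≡m (d div n) n)) refl)))
        t%p : (d div n) % lookup ns p ≡ 0
        t%p = ⊕-fixed (lookup⁺ o p) (d div n) (trans (cong (lookup⁺ o p ⊕_) (sym turns≡)) (trans (sym (compose-p _ _ _)) (cong (λ e → lookup⁺ e p) eq)))
        0<t : 0 < d div n
        0<t = n≢0⇒n>0 (λ t≡0 → n≮0 (≤-trans 1≤d (≤-reflexive (trans d≡tn (cong (_* n) t≡0)))))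
        p≤t : lookup ns p ≤ℕ d div n
        p≤t with <-≤-connex (d div n) (lookup ns p)
        ... | inj₂ p≤ = p≤
        ... | inj₁ t<p = contradiction (subst (0 <_) (trans (sym (m<n⇒m%n≡m t<p)) t%p) 0<t) (n≮n 0)

      module Local {g} (g∈ : g ∈ groupElements ns) =
        Arcs (allEdges ns) _≟ᵉ_ ∑-allEdges step step-0 step-+ step-injective r aperiodic (member? g) (meet g∈)

      local-≤ : ∀ {g} → g ∈ groupElements ns → ∑ (allEdges ns) (λ o → ⟦ member? g o ⟧) ≤ℕ r
      local-≤ g∈ = Local.arcs-≤ g∈

      straight : ∀ o → toℕ (lookup⁺ o m) + r ≤ℕ n → ∀ d → d < r → turns o d ≡ 0
      straight o fits d d<r = trans (+-identityʳ _) (m<n⇒m/n≡0 (<-≤-trans (+-monoʳ-< _ d<r) fits))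

      -- A window wrapping around with d rows left is traded for the one starting at the next diagonal
      -- or for the last one inside its own diagonal, as one of these two is in class d.

      local-≡ : ∀ {g} → g ∈ groupElements ns → r ≤ℕ ∑ (allEdges ns) (λ o → ⟦ member? g o ⟧) → DiagonalMember g
      local-≡ {g} g∈ r≤∑ with o , _ , c ← ∑-positive (allEdges ns) (member? g) (≤-trans 1≤r r≤∑)
        with ≤-<-connex (toℕ (lookup⁺ o m) + r) n
      ... | inj₁ fits = unwrapped g∈ o c (straight o fits)
      ... | inj₂ n<i+r = shifted (Local.arcs-≡ g∈ o c r≤∑ (fromℕ< d<r))
        where
        i = toℕ (lookup⁺ o m)
        d = n ∸ i
        i+d≡n : i + d ≡ n
        i+d≡n = m+[n∸m]≡n (<⇒≤ (toℕ<n (lookup⁺ o m)))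
        d<r : d < r
        d<r = +-cancelˡ-< i d r (≤-<-trans (≤-reflexive i+d≡n) n<i+r)
        toℕd : toℕ (fromℕ< d<r) ≡ d
        toℕd = toℕ-fromℕ< d<r
        shifted : ∃[ o′ ] Local.Class g∈ o o′ (fromℕ< d<r) → DiagonalMember g
        shifted (o′ , c′ , inj₁ eq) = unwrapped g∈ o′ c′ (straight o′ (≤-trans (≤-reflexive (cong (_+ r) start)) (<⇒≤ r<n)))
          where
          start : toℕ (lookup⁺ o′ m) ≡ 0
          start = trans (cong (λ e → toℕ (lookup⁺ e m)) (sym eq)) (trans (cong toℕ (compose-m _ _ _))
            (trans (toℕ-⊕ (lookup⁺ o m) _) (trans (cong (λ z → (i + z) % n) toℕd) (trans (cong (_% n) i+d≡n) (n%n≡0 n)))))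
        shifted (o′ , c′ , inj₂ (_ , eq)) = unwrapped g∈ o′ c′ (straight o′ fits)
          where
          j = toℕ (lookup⁺ o′ m)
          e = r ∸ d
          d+e≡r : d + e ≡ r
          d+e≡r = m+[n∸m]≡n (<⇒≤ d<r)
          back : (j + e) % n ≡ i
          back = trans (sym (toℕ-⊕ (lookup⁺ o′ m) e)) (cong toℕ (trans (cong (λ z → lookup⁺ o′ m ⊕ (r ∸ z)) (sym toℕd))
            (trans (sym (compose-m _ _ _)) (cong (λ e → lookup⁺ e m) eq))))
          total : j + e ≡ i → j + r ≤ℕ n
          total j+e≡i = ≤-reflexive (trans (cong (j +_) (trans (sym d+e≡r) (+-comm d e)))
            (trans (sym (+-assoc j e d)) (trans (cong (_+ d) j+e≡i) i+d≡n)))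
          fits : j + r ≤ℕ n
          fits with wrap n {j + e} (+-mono-< (toℕ<n (lookup⁺ o′ m)) (≤-<-trans (m∸n≤m r d) r<n))
          ... | inj₁ (_ , x%n) = total (trans (sym x%n) back)
          -- A wrap means j + r = 2n, which would put the starting row at 2n - r ≥ n.
          ... | inj₂ (y , x≡ , _ , x%n) = contradiction (toℕ<n (lookup⁺ o′ m)) (≤⇒≯ (+-cancelʳ-≤ r n j (begin
              n + r            ≤⟨ +-monoʳ-≤ n (<⇒≤ r<n) ⟩
              n + n            ≡⟨ cong (n +_) (trans (sym i+d≡n) (cong (_+ d) (trans (sym back) x%n))) ⟩
              n + (y + d)      ≡⟨ +-assoc n y d ⟨
              n + y + d        ≡⟨ cong (_+ d) x≡ ⟨
              j + e + d        ≡⟨ trans (+-assoc j e d) (cong (j +_) (trans (+-comm e d) d+e≡r)) ⟩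
              j + r            ∎)))
            where open ≤-Reasoning

    arrangement : Arrangement
    arrangement with m≤n⇒m<n∨m≡n (r≤ m)
    ... | inj₁ r<n = straddling r<n
    ... | inj₂ r≡n = spanning r≡n

    open Arrangement arrangement
    open Steps bump bump≤

    private
      G = groupElements ns
      c = #stabiliser {ns = ns} {r}

      double-count : ∑ G (λ g → ∑ (allEdges ns) (λ o → ⟦ member? g o ⟧)) ≡ length (allEdges ns) * (∣ F ∣ * c)
      double-count = trans (∑-comm G (allEdges ns) (λ g o → ⟦ member? g o ⟧))
        (trans (∑-cong (allEdges ns) (λ o → ∑-listed F (window-ordered o))) (∑-const (allEdges ns) _))

    averaged-bound : length (allEdges ns) * (∣ F ∣ * c) ≤ℕ length G * r
    averaged-bound = ≤-trans (≤-reflexive (sym double-count))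
      (≤-trans (∑-mono-∈ G (λ g g∈ → local-≤ g∈)) (≤-reflexive (∑-const G r)))

    -- `∑-tight` yields r members for every g. The hypothesis does not involve `ρ` and `σ`, so the
    -- conclusion is available for all arrangements.
    equality⇒diagonal : length G * r ≤ℕ length (allEdges ns) * (∣ F ∣ * c) → ∀ {g} → g ∈ G → DiagonalMember g
    equality⇒diagonal ge g∈ = local-≡ g∈ (≤-reflexive (sym
      (∑-tight G (λ g g∈ → local-≤ g∈) (≤-trans ge (≤-reflexive (sym double-count))) _ g∈)))

-- Cyclic words and their consecutive letters

Unique-resp-↭ : ∀ {A : Set} {xs ys : List A} → xs ↭ ys → Unique xs → Unique ys
Unique-resp-↭ ↭.refl       u                            = u
Unique-resp-↭ (↭.prep x p)   (x≢ ∷ u)                     = All-resp-↭ p x≢ ∷ Unique-resp-↭ p u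
Unique-resp-↭ (↭.swap x y p) ((x≢y ∷ x≢) ∷ y≢ ∷ u)        = ((λ e → x≢y (sym e)) ∷ All-resp-↭ p y≢) ∷ All-resp-↭ p x≢ ∷ Unique-resp-↭ p u
Unique-resp-↭ (↭.trans p q)  u                            = Unique-resp-↭ q (Unique-resp-↭ p u)

data Adj {A : Set} (a b : A) : List A → Set where
  here  : ∀ {l} → Adj a b (a ∷ b ∷ l)
  there : ∀ {c l} → Adj a b l → Adj a b (c ∷ l)

module _ {A : Set} where

  private variable
    a b c d e z : A
    l : List A

  adj-∈ : Adj a b l → a ∈ l
  adj-∈ here      = here refl
  adj-∈ (there p) = there (adj-∈ p)

  adj-target : Adj a b (e ∷ l) → b ∈ l
  adj-target here              = here refl
  adj-target {l = _ ∷ _} (there p) = there (adj-target p)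

  adj-∈ʳ : Adj a b l → b ∈ l
  adj-∈ʳ {a = a} p = adj-target (there {c = a} p)

  adj-∷ʳ : ∀ l → Adj a b (l ++ [ z ]) → Adj a b l ⊎ (a ∈ l × b ≡ z)
  adj-∷ʳ []          (there ())
  adj-∷ʳ (c ∷ [])    here              = inj₂ (here refl , refl)
  adj-∷ʳ (c ∷ [])    (there (there ()))
  adj-∷ʳ (c ∷ d ∷ l) here              = inj₁ here
  adj-∷ʳ (c ∷ d ∷ l) (there p) with adj-∷ʳ (d ∷ l) p
  ... | inj₁ q        = inj₁ (there q)
  ... | inj₂ (q , eq) = inj₂ (there q , eq)

  adj-source : ∀ l → Adj a b (l ++ [ z ]) → a ∈ l
  adj-source l p with adj-∷ʳ l p
  ... | inj₁ q       = adj-∈ q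
  ... | inj₂ (q , _) = q

  adj-cyclic : ∀ {l} → l ≢ [] → Adj a b (e ∷ l ++ [ z ]) → (a ≡ e × b ∈ l) ⊎ Adj a b l ⊎ (a ∈ l × b ≡ z)
  adj-cyclic {l = []}    ne p         = contradiction refl ne
  adj-cyclic {l = c ∷ l} ne here      = inj₁ (refl , here refl)
  adj-cyclic {l = c ∷ l} ne (there p) = inj₂ (adj-∷ʳ (c ∷ l) p)

  unique-head : Unique (a ∷ l) → a ∉ l
  unique-head = Unique[x∷xs]⇒x∉xs

  adj-asym : Unique l → Adj a b l → Adj b a l → ⊥
  adj-asym u         here      q         = unique-head u (adj-target q)
  adj-asym u         (there p) here      = unique-head u (there (adj-target p))
  adj-asym (_ ∷ u)   (there p) (there q) = adj-asym u p q

  -- The one new pair leads from the last letter to `a`. Its reverse would need the last letter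
  -- right after `a`, where `b₁` stands, and `b₁` is not last because of `b₂`.
  rotate-adj : ∀ {b₁ b₂ bs} → Unique (a ∷ b₁ ∷ b₂ ∷ bs) → Adj c d (a ∷ b₁ ∷ b₂ ∷ bs) → Adj d c (b₁ ∷ b₂ ∷ bs ++ [ a ]) → ⊥
  rotate-adj {a} {b₁ = b₁} {b₂} {bs} u p q with adj-∷ʳ (b₁ ∷ b₂ ∷ bs) q
  rotate-adj u here      q            | inj₁ q′ = unique-head u (there (adj-target q′))
  rotate-adj (_ ∷ u) (there p) q      | inj₁ q′ = adj-asym u p q′
  rotate-adj u (there p) q            | inj₂ (_ , refl) = unique-head u (adj-∈ p)
  rotate-adj u here      here         | inj₂ (_ , refl) = unique-head u (there (here refl))
  rotate-adj {b₂ = b₂} {bs} (_ ∷ u) here (there q) | inj₂ (_ , refl) = unique-head u (adj-source (b₂ ∷ bs) q)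

  -- The new pairs are (a , b₁) and the one from the last letter to `b`. In the first word nothing
  -- precedes `a`, and `b` is followed by `b₁`, which is not last.
  defer-adj : ∀ {b₁ b₂ bs} → Unique (a ∷ b ∷ b₁ ∷ b₂ ∷ bs) → Adj c d (a ∷ b ∷ b₁ ∷ b₂ ∷ bs) →
              Adj d c (a ∷ b₁ ∷ b₂ ∷ bs ++ [ b ]) → ⊥
  defer-adj u p here = unique-head u (adj-target p)
  defer-adj {b₁ = b₁} {b₂} {bs} u p (there q) with adj-∷ʳ (b₁ ∷ b₂ ∷ bs) q
  defer-adj u p (there q) | inj₁ q′ = adj-asym u p (there (there q′))
  defer-adj u here                 (there q)         | inj₂ (_ , refl) = unique-head u (here refl)
  defer-adj u (there here)         (there here)      | inj₂ (_ , refl) = unique-head (tailᵘ u) (there (here refl))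
    where
    tailᵘ : Unique (e ∷ l) → Unique l
    tailᵘ (_ ∷ u) = u
  defer-adj {b₂ = b₂} {bs} (_ ∷ _ ∷ u) (there here) (there (there q)) | inj₂ (_ , refl) = unique-head u (adj-source (b₂ ∷ bs) q)
  defer-adj (_ ∷ u) (there (there p)) (there q) | inj₂ (_ , refl) = unique-head u (adj-∈ p)

  -- The one new pair is (b , a), but `a` is followed by `b₁`; and the old pair ending in `b` is not
  -- reversed, as `b` is now followed by `a`.
  undefer-adj : ∀ {b₁ bs} → Unique (a ∷ b ∷ b₁ ∷ bs) → Unique (a ∷ b₁ ∷ bs ++ [ b ]) →
                Adj c d (a ∷ b₁ ∷ bs ++ [ b ]) → Adj d c (b ∷ a ∷ b₁ ∷ bs) → ⊥
  undefer-adj (_ ∷ u)    v here      here             = unique-head u (here refl)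
  undefer-adj {b₁ = b₁} {bs} u v (there p) here       = unique-head u (there (adj-source (b₁ ∷ bs) p))
  undefer-adj u          v p         (there here)     = unique-head v (adj-target p)
  undefer-adj u          v here      (there (there q)) = unique-head u (there (there (adj-target q)))
  undefer-adj {b₁ = b₁} {bs} (_ ∷ u) v (there p) (there (there q)) with adj-∷ʳ (b₁ ∷ bs) p
  undefer-adj (_ ∷ _ ∷ u) v (there p) (there (there q)) | inj₁ p′ = adj-asym u p′ q
  undefer-adj (_ ∷ u)     v (there p) (there (there q)) | inj₂ (_ , refl) = unique-head u (adj-∈ q)

  -- Deciding, for every arrangement of the same letters, between T and T′, where no word of type T can
  -- traverse a pair of consecutive letters against a word of type T′.

  module Dichotomy (w₀ : List A) (unique : Unique w₀) (T T′ : List A → Set)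
                   (decide : ∀ w → w ↭ w₀ → T w ⊎ T′ w)
                   (clash : ∀ {w w′} → w ↭ w₀ → w′ ↭ w₀ → T w → T′ w′ → ∃₂ λ a b → Adj a b w × Adj b a w′) where

    transfer : ∀ {w w′} → w ↭ w₀ → w′ ↭ w₀ → (∀ {a b} → Adj a b w → Adj b a w′ → ⊥) → T w → T w′
    transfer p p′ no-clash t with decide _ p′
    ... | inj₁ t′ = t′
    ... | inj₂ t′ with _ , _ , x , y ← clash p p′ t t′ = ⊥-elim (no-clash x y)

    rotate₁ : ∀ {a b₁ b₂ bs} → (a ∷ b₁ ∷ b₂ ∷ bs) ↭ w₀ → T (a ∷ b₁ ∷ b₂ ∷ bs) → T (b₁ ∷ b₂ ∷ bs ++ [ a ])
    rotate₁ {a} {b₁} {b₂} {bs} p = transfer p (↭-trans (↭-sym (∷↭∷ʳ a (b₁ ∷ b₂ ∷ bs))) p) (rotate-adj (Unique-resp-↭ (↭-sym p) unique))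

    -- Exchanging the two letters directly would reverse the pair (a , b). The detour moves `b` to
    -- the end and then round to the front, and neither move reverses a pair.
    swap₁ : ∀ {a b b₁ b₂ bs} → (a ∷ b ∷ b₁ ∷ b₂ ∷ bs) ↭ w₀ → T (a ∷ b ∷ b₁ ∷ b₂ ∷ bs) → T (b ∷ a ∷ b₁ ∷ b₂ ∷ bs)
    swap₁ {a} {b} {b₁} {b₂} {bs} p t =
      transfer q (↭-trans (↭-swap b a ↭-refl) p) (undefer-adj u (Unique-resp-↭ (↭-sym q) unique)) (transfer p q (defer-adj u) t)
      where
      u = Unique-resp-↭ (↭-sym p) unique
      q : (a ∷ b₁ ∷ b₂ ∷ bs ++ [ b ]) ↭ w₀
      q = ↭-trans (↭-prep a (↭-sym (∷↭∷ʳ b (b₁ ∷ b₂ ∷ bs)))) p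

  module Rearrange (w₀ : List A) (T : List A → Set)
                   (rotate-one : ∀ {a w} → (a ∷ w) ↭ w₀ → T (a ∷ w) → T (w ++ [ a ]))
                   (swap-head : ∀ {a b w} → (a ∷ b ∷ w) ↭ w₀ → T (a ∷ b ∷ w) → T (b ∷ a ∷ w)) where

    rotate : ∀ v w → (v ++ w) ↭ w₀ → T (v ++ w) → T (w ++ v)
    rotate []      w p t = subst T (sym (++-identityʳ w)) t
    rotate (a ∷ v) w p t = subst T (++-assoc w [ a ] v) (rotate v (w ++ [ a ])
      (↭-trans (↭-reflexive (sym (++-assoc v w [ a ]))) (↭-trans (↭-sym (∷↭∷ʳ a (v ++ w))) p))
      (subst T (++-assoc v w [ a ]) (rotate-one p t)))

    -- The prefix `v` holds the letters already passed. Two letters behind it are exchanged by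
    -- rotating `v` to the end, swapping at the head, and rotating back.
    rearrange-after : ∀ v {w w′} → w ↭ w′ → (v ++ w) ↭ w₀ → T (v ++ w) → T (v ++ w′)
    rearrange-after v ↭.refl p t = t
    rearrange-after v {x ∷ w} {_ ∷ w′} (↭.prep x q) p t = subst T (++-assoc v [ x ] w′)
      (rearrange-after (v ++ [ x ]) q (↭-trans (↭-reflexive (++-assoc v [ x ] w)) p) (subst T (sym (++-assoc v [ x ] w)) t))
    rearrange-after v {x ∷ y ∷ w} {_ ∷ _ ∷ w′} (↭.swap x y q) p t = subst T (++-assoc v (y ∷ [ x ]) w′)
      (rearrange-after (v ++ y ∷ [ x ]) q (↭-trans (↭-reflexive (++-assoc v (y ∷ [ x ]) w)) p₃) (subst T (sym (++-assoc v (y ∷ [ x ]) w))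
        (rotate (y ∷ x ∷ w) v p₂ (swap-head p₁ (rotate v (x ∷ y ∷ w) p t)))))
      where
      p₁ : ((x ∷ y ∷ w) ++ v) ↭ w₀
      p₁ = ↭-trans (++-comm (x ∷ y ∷ w) v) p
      p₂ : ((y ∷ x ∷ w) ++ v) ↭ w₀
      p₂ = ↭-trans (↭-swap y x ↭-refl) p₁
      p₃ : (v ++ y ∷ x ∷ w) ↭ w₀
      p₃ = ↭-trans (++-comm v (y ∷ x ∷ w)) p₂
    rearrange-after v (↭.trans q q′) p t =
      rearrange-after v q′ (↭-trans (++⁺ˡ v (↭-sym q)) p) (rearrange-after v q p t)

    rearrange : ∀ {w w′} → w ↭ w′ → w ↭ w₀ → T w → T w′
    rearrange = rearrange-after []

  ∈⇒↭ : ∀ {l} → a ∈ l → ∃[ r ] (l ↭ a ∷ r)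
  ∈⇒↭ a∈ with v , w , refl ← ∈-∃++ a∈ = v ++ w , shift _ v w

  module Avoid (Bad : A → A → Set) (bad? : ∀ a b → Dec (Bad a b))
               (functional : ∀ {a b c} → Bad a b → Bad a c → b ≡ c)
               (injective : ∀ {a b c} → Bad a c → Bad b c → a ≡ b) (y : A) where

    Good : List A → Set
    Good u = Linked (λ a b → ¬ Bad a b) (y ∷ u ++ [ y ])

    Fits : A → A → A → Set
    Fits c x z = ¬ Bad x c × ¬ Bad c z

    fits? : ∀ c x z → Fits c x z ⊎ (Bad x c ⊎ Bad c z)
    fits? c x z with bad? x c | bad? c z
    ... | yes p | _     = inj₂ (inj₁ p)
    ... | no _  | yes q = inj₂ (inj₂ q)
    ... | no p  | no q  = inj₁ (p , q)

    -- `c` has at most one bad predecessor and at most one bad successor, and each of these spoils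
    -- at most one gap, as the left ends are distinct and so are the right ends.
    three-gaps : ∀ c {x₁ x₂ x₃ z₁ z₂ z₃} → x₁ ≢ x₂ → x₁ ≢ x₃ → x₂ ≢ x₃ → z₁ ≢ z₂ → z₁ ≢ z₃ → z₂ ≢ z₃ →
                 Fits c x₁ z₁ ⊎ Fits c x₂ z₂ ⊎ Fits c x₃ z₃
    three-gaps c {x₁} {x₂} {x₃} {z₁} {z₂} {z₃} x₁₂ x₁₃ x₂₃ z₁₂ z₁₃ z₂₃
      with fits? c x₁ z₁ | fits? c x₂ z₂ | fits? c x₃ z₃
    ... | inj₁ fit      | _             | _             = inj₁ fit
    ... | inj₂ _        | inj₁ fit      | _             = inj₂ (inj₁ fit)
    ... | inj₂ _        | inj₂ _        | inj₁ fit      = inj₂ (inj₂ fit)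
    ... | inj₂ (inj₁ p) | inj₂ (inj₁ q) | inj₂ _        = contradiction (injective p q) x₁₂
    ... | inj₂ (inj₁ p) | inj₂ (inj₂ _) | inj₂ (inj₁ q) = contradiction (injective p q) x₁₃
    ... | inj₂ (inj₂ _) | inj₂ (inj₁ p) | inj₂ (inj₁ q) = contradiction (injective p q) x₂₃
    ... | inj₂ (inj₂ p) | inj₂ (inj₂ q) | inj₂ _        = contradiction (functional p q) z₁₂
    ... | inj₂ (inj₂ p) | inj₂ (inj₁ _) | inj₂ (inj₂ q) = contradiction (functional p q) z₁₃
    ... | inj₂ (inj₁ _) | inj₂ (inj₂ p) | inj₂ (inj₂ q) = contradiction (functional p q) z₂₃

    Extended : A → List A → Set
    Extended c u = ∃₂ λ a b → ∃[ v ] (a ∷ b ∷ v ↭ c ∷ u × Good (a ∷ b ∷ v))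

    -- The first three gaps of the cycle suffice; they exist because `y`, `a`, `b` already lie on
    -- it. Behind `b` comes the next letter or, at the end of the word, `y` again.
    insert : ∀ {a b} c u → Unique (y ∷ a ∷ b ∷ u) → Good (a ∷ b ∷ u) → Extended c (a ∷ b ∷ u)
    insert {a} {b} c u ((y≢a ∷ y≢b ∷ y∉u) ∷ (a≢b ∷ a∉u) ∷ (b∉u ∷ _)) (ya ∷ ab ∷ rest) = gaps u a∉u b∉u rest
      where
      moved : ∀ {v} → a ∷ b ∷ c ∷ v ↭ c ∷ a ∷ b ∷ v
      moved = ↭-trans (↭-prep a (↭-swap b c ↭-refl)) (↭-swap a c ↭-refl)
      gaps : ∀ u → Allˡ.All (a ≢_) u → Allˡ.All (b ≢_) u → Linked (λ a b → ¬ Bad a b) (b ∷ u ++ [ y ]) → Extended c (a ∷ b ∷ u)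
      gaps [] a∉u b∉u (by ∷ end) with three-gaps c y≢a y≢b a≢b a≢b (λ e → y≢a (sym e)) (λ e → y≢b (sym e))
      ... | inj₁ (p , q)        = c , a , [ b ] , ↭-refl , p ∷ q ∷ ab ∷ by ∷ end
      ... | inj₂ (inj₁ (p , q)) = a , c , [ b ] , ↭-swap a c ↭-refl , ya ∷ p ∷ q ∷ by ∷ end
      ... | inj₂ (inj₂ (p , q)) = a , b , [ c ] , moved , ya ∷ ab ∷ p ∷ q ∷ end
      gaps (d ∷ u) (a≢d ∷ _) (b≢d ∷ _) (bd ∷ rest) with three-gaps c y≢a y≢b a≢b a≢b a≢d b≢d
      ... | inj₁ (p , q)        = c , a , b ∷ d ∷ u , ↭-refl , p ∷ q ∷ ab ∷ bd ∷ rest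
      ... | inj₂ (inj₁ (p , q)) = a , c , b ∷ d ∷ u , ↭-swap a c ↭-refl , ya ∷ p ∷ q ∷ bd ∷ rest
      ... | inj₂ (inj₂ (p , q)) = a , b , c ∷ d ∷ u , moved , ya ∷ ab ∷ p ∷ q ∷ rest

    insert-all : ∀ {a b} r u → Unique (y ∷ r ++ a ∷ b ∷ u) → Good (a ∷ b ∷ u) → ∃[ v ] (v ↭ r ++ a ∷ b ∷ u × Good v)
    insert-all {a} {b} []      u _    good = a ∷ b ∷ u , ↭-refl , good
    insert-all {a} {b} (c ∷ r) u uniq good =
      let a′ , b′ , v , p , good′ = insert c u (suffix r uniq) good
          w , q , good″ = insert-all r v (Unique-resp-↭ (↭-prep y (↭-trans (↭-sym (shift c r (a ∷ b ∷ u))) (++⁺ˡ r (↭-sym p)))) uniq) good′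
      in w , ↭-trans q (↭-trans (++⁺ˡ r p) (shift c r (a ∷ b ∷ u))) , good″
      where
      suffix : ∀ r → Unique (y ∷ c ∷ r ++ a ∷ b ∷ u) → Unique (y ∷ a ∷ b ∷ u)
      suffix []      ((_ ∷ y∉) ∷ _ ∷ u)                   = y∉ ∷ u
      suffix (_ ∷ r) ((y≢c ∷ _ ∷ y∉) ∷ (_ ∷ c∉) ∷ _ ∷ u) = suffix r ((y≢c ∷ y∉) ∷ c∉ ∷ u)

    -- The first letters fit next to e, which no bad pair leaves, and z, which no bad pair joins to another letter.

    avoiding : ∀ {w e z} → Unique (y ∷ w) → e ≢ z → e ∈ y ∷ w → z ∈ y ∷ w →
               (∀ {b} → b ∈ y ∷ w → ¬ Bad e b) → (∀ {b} → Bad z b → b ≡ z) → (∀ {b} → Bad b z → b ≡ z) →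
               ∃[ v ] (v ↭ w × Good v)
    avoiding {w} {e} {z} u e≢z e∈ z∈ free z→ →z = cases e∈ z∈
      where
      complete : ∀ r a b → w ↭ a ∷ b ∷ r → Good (a ∷ b ∷ []) → ∃[ v ] (v ↭ w × Good v)
      complete r a b p good =
        let q = ↭-trans p (++-comm (a ∷ [ b ]) r)
            v , v↭ , good′ = insert-all r [] (Unique-resp-↭ (↭-prep y q) u) good
        in v , ↭-trans v↭ (↭-sym q) , good′
      ≢z : ∀ {b r a} → w ↭ a ∷ b ∷ r → z ∈ y ∷ [ a ] → b ≢ z
      ≢z p (here refl)         refl = unique-head u (∈-resp-↭ (↭-sym p) (there (here refl)))
      ≢z p (there (here refl)) refl with _ ∷ ((z≢z ∷ _) ∷ _) ← Unique-resp-↭ (↭-prep y p) u = z≢z refl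
      e→ : ∀ {b} → b ∈ w → ¬ Bad e b
      e→ b∈ = free (there b∈)
      z→e : ¬ Bad z e
      z→e bad = e≢z (z→ bad)
      cases : e ∈ y ∷ w → z ∈ y ∷ w → ∃[ v ] (v ↭ w × Good v)
      cases (here refl) (here refl) = contradiction refl e≢z
      cases (here refl) (there z∈) with ∈⇒↭ z∈
      ... | []    , p = [ z ] , ↭-sym p , e→ z∈ ∷ z→e ∷ [-]
      ... | b ∷ r , p = complete r b z (↭-trans p (↭-swap z b ↭-refl))
        (e→ (∈-resp-↭ (↭-sym p) (there (here refl))) ∷ (λ bad → ≢z p (there (here refl)) (→z bad)) ∷ z→e ∷ [-])
      cases (there e∈) (here refl) with ∈⇒↭ e∈
      ... | []    , p = [ e ] , ↭-sym p , z→e ∷ free (here refl) ∷ [-]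
      ... | b ∷ r , p = complete r e b p
        (z→e ∷ e→ (∈-resp-↭ (↭-sym p) (there (here refl))) ∷ (λ bad → ≢z p (here refl) (→z bad)) ∷ [-])
      cases (there e∈) (there z∈) with ∈⇒↭ z∈
      ... | r′ , p′ with ∈-resp-↭ p′ e∈
      ...   | here e≡z = contradiction e≡z e≢z
      ...   | there e∈r with ∈⇒↭ e∈r
      ...     | r , p = complete r z e (↭-trans p′ (↭-prep z p))
        ((λ bad → unique-head u (subst (_∈ w) (sym (→z bad)) z∈)) ∷ z→e ∷ free (here refl) ∷ [-])

-- Intersecting families of permutations

-- A family of intersecting injections, presented as a predicate on relations between rows and columns
-- (the graphs containing a member).  Both rows and columns are written as elements of Fin n, and only
-- the rows below ν are genuine.

record System (ν n : ℕ) (f : (Fin n → Fin n → Set) → Set) : Set₁ where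
  field
    mono  : ∀ {ρ ρ′} → (∀ {a b} → toℕ a < ν → ρ a b → ρ′ a b) → f ρ → f ρ′
    dec   : ∀ {ρ} → (∀ a b → Dec (ρ a b)) → Dec (f ρ)
    meet  : ∀ {ρ ρ′} → f ρ → f ρ′ → ∃₂ λ a b → toℕ a < ν × ρ a b × ρ′ a b
    tight : ∀ (α β : Fin n → Fin n) → Injective α → Injective β → (∀ i → toℕ i < ν → toℕ (α i) < ν) →
            ∃[ q ] f (λ a b → ∃[ i ] (a ≡ α i × b ≡ β (i ⊕ toℕ {n} q)))

nth : ∀ {A : Set} → A → List A → ℕ → A
nth d []      _       = d
nth d (a ∷ l) zero    = a
nth d (a ∷ l) (suc t) = nth d l t

module _ {A : Set} where

  nth-∈ : ∀ {d : A} l {t} → t < length l → nth d l t ∈ l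
  nth-∈ (a ∷ l) {zero}  _        = here refl
  nth-∈ (a ∷ l) {suc t} (s≤s lt) = there (nth-∈ l lt)

  nth-injective : ∀ {d : A} {l} → Unique l → ∀ {s t} → s < length l → t < length l → nth d l s ≡ nth d l t → s ≡ t
  nth-injective {l = a ∷ l} u       {zero}  {zero}  _        _        _  = refl
  nth-injective {l = a ∷ l} u       {zero}  {suc t} _        (s≤s lt) eq = ⊥-elim (unique-head u (subst (_∈ l) (sym eq) (nth-∈ l lt)))
  nth-injective {l = a ∷ l} u       {suc s} {zero}  (s≤s lt) _        eq = ⊥-elim (unique-head u (subst (_∈ l) eq (nth-∈ l lt)))
  nth-injective {l = a ∷ l} (_ ∷ u) {suc s} {suc t} (s≤s ls) (s≤s lt) eq = cong suc (nth-injective u ls lt eq)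

  nth-default : ∀ {d d′ : A} l {t} → t < length l → nth d l t ≡ nth d′ l t
  nth-default (a ∷ l) {zero}  _        = refl
  nth-default (a ∷ l) {suc t} (s≤s lt) = nth-default l lt

  nth-end : ∀ {d : A} l → nth d l (length l) ≡ d
  nth-end []      = refl
  nth-end (a ∷ l) = nth-end l

  -- For `t` equal to the length of `l` the target is the default `d`, which is the letter that
  -- closes the cycle.
  adj-nth : ∀ {d e : A} l {t} → t ≤ℕ length l → Adj (nth d (e ∷ l) t) (nth d l t) (e ∷ l ++ [ d ])
  adj-nth []      {zero}  _        = here
  adj-nth (a ∷ l) {zero}  _        = here
  adj-nth (a ∷ l) {suc t} (s≤s le) = there (adj-nth l le)

unique⇒complete : ∀ {n} {l : List (Fin n)} → Unique l → length l ≡ n → ∀ a → a ∈ l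
unique⇒complete {n} {l} u len a with Any.any? (a ≟_) l
... | yes a∈ = a∈
... | no  a∉ = contradiction (≤-trans (injective⇒≤ {f = λ i → nth a (a ∷ l) (toℕ i)} inj) (≤-reflexive (sym len))) 1+n≰n
  where
  inj : Injective (λ (i : Fin (suc (length l))) → nth a (a ∷ l) (toℕ i))
  inj {i} {j} eq = toℕ-injective (nth-injective (Allˡ.tabulate (λ x∈ a≡x → a∉ (subst (_∈ l) (sym a≡x) x∈)) ∷ u) (toℕ<n i) (toℕ<n j) eq)

module _ {A : Set} where

  Transposed : A → A → A → A → Set
  Transposed x y a b = (a ≡ x × b ≡ y) ⊎ (a ≡ y × b ≡ x) ⊎ (a ≢ x × a ≢ y × a ≡ b)

  -- The cycle through y and then the letters of w, with x fixed.

  Cycle : A → A → List A → A → A → Set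
  Cycle x y w a b = (a ≡ x × b ≡ x) ⊎ Adj a b (y ∷ w ++ [ y ])

  -- The cycle through x and then the letters of w in reverse order, with y fixed.

  Reversed : A → A → List A → A → A → Set
  Reversed x y w a b = (a ≡ y × b ≡ y) ⊎ Adj b a (x ∷ w ++ [ x ])

linked-adj : ∀ {A : Set} {R : A → A → Set} {l a b} → Linked R l → Adj a b l → R a b
linked-adj (r ∷ _)  here      = r
linked-adj (_ ∷ rs) (there p) = linked-adj rs p
linked-adj [-]      (there ())

module _ {ν m : ℕ} {f : (Fin (2+ m) → Fin (2+ m) → Set) → Set} (S : System ν (2+ m) f) where

  open System S

  -- Bijections are given as relations because, after the columns are renamed by an injection
  -- `base`, the graph of h becomes the relation `h a ≡ base b`.
  Fixes : Fin (2+ m) → Set₁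
  Fixes x = ∀ {ρ} → (∀ a b → Dec (ρ a b)) → (∀ {a b c} → ρ a b → ρ a c → b ≡ c) → (∀ {a b c} → ρ a c → ρ b c → a ≡ b) →
            (∀ b → ∃[ a ] ρ a b) → f ρ → ρ x x

  Shifted : (Fin (2+ m) → Fin (2+ m)) → (Fin (2+ m) → Fin (2+ m)) → ℕ → Fin (2+ m) → Fin (2+ m) → Set
  Shifted α β q a b = ∃[ i ] (a ≡ α i × b ≡ β (i ⊕ q))

  -- The genuine rows may as well occupy any cyclic interval of positions.

  tight-cyclic : ∀ (α β : Fin (2+ m) → Fin (2+ m)) → Injective α → Injective β → ∀ j → (∀ (i : Fin (2+ m)) → toℕ i < ν → toℕ (α (i ⊕ j)) < ν) →
                 ∃[ q ] f (Shifted α β (toℕ {suc (suc m)} q))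
  tight-cyclic α β α-inj β-inj j rows =
    let q , t = tight (λ i → α (i ⊕ j)) (λ i → β (i ⊕ j)) (⊕-injectiveˡ j ∘ α-inj) (⊕-injectiveˡ j ∘ β-inj) rows
    in q , mono (λ { _ (i , refl , refl) → i ⊕ j , refl ,
      cong β (trans (⊕-+ i (toℕ q) j) (trans (cong (i ⊕_) (+-comm (toℕ q) j)) (sym (⊕-+ i j (toℕ q))))) }) t

  module _ (id∈ : f _≡_) where

    Layout : Fin (2+ m) → Fin (2+ m) → List (Fin (2+ m)) → Set
    Layout x y w = ∃[ j ] (∀ (i : Fin (2+ m)) → toℕ i < ν → toℕ (nth y (x ∷ y ∷ w) (toℕ (i ⊕ j))) < ν)

    -- Of the cyclic shifts of the arrangement x ↦ y, y ↦ x, w ↦ w, only three meet the identity.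

    cycles : ∀ {x y w} → ¬ f (Transposed x y) → length w ≡ m → Unique (x ∷ y ∷ w) → Layout x y w →
             f (Cycle x y w) ⊎ (toℕ y < ν × f (Reversed x y w))
    cycles {x} {y} {w} swap∉ len uniq@((x≢y ∷ x∉w) ∷ y∉w ∷ uniq-w) (j , rows) = split
      where
      α β : Fin (2+ m) → Fin (2+ m)
      α i = nth y (x ∷ y ∷ w) (toℕ i)
      β i = nth y (y ∷ x ∷ w) (toℕ i)
      <len : ∀ (i : Fin (2+ m)) → toℕ i < suc (suc (length w))
      <len i = <-≤-trans (toℕ<n i) (≤-reflexive (cong (λ z → suc (suc z)) (sym len)))
      uniq′ : Unique (y ∷ x ∷ w)
      uniq′ = ((λ e → x≢y (sym e)) ∷ y∉w) ∷ x∉w ∷ uniq-w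
      in-w : ∀ {s} → suc (suc s) < suc (suc (length w)) → nth y w s ∈ w
      in-w lt = nth-∈ w (s≤s⁻¹ (s≤s⁻¹ lt))
      -- `α` and `β` differ only in positions 0 and 1. The arrangement shifted by q meets the
      -- identity where `α` at i equals `β` at i + q, so q is 1, -1 or 0.
      aligned : ∀ {s t} → s < suc (suc (length w)) → t < suc (suc (length w)) → nth y (x ∷ y ∷ w) s ≡ nth y (y ∷ x ∷ w) t →
                (s ≡ 0 × t ≡ 1) ⊎ (s ≡ 1 × t ≡ 0) ⊎ s ≡ t
      aligned {0}           {0}           _ _  eq = contradiction eq x≢y
      aligned {0}           {1}           _ _  eq = inj₁ (refl , refl)
      aligned {0}           {suc (suc t)} _ lt eq = ⊥-elim (Allˡ.lookup x∉w (in-w lt) eq)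
      aligned {1}           {0}           _ _  eq = inj₂ (inj₁ (refl , refl))
      aligned {1}           {1}           _ _  eq = contradiction (sym eq) x≢y
      aligned {1}           {suc (suc t)} _ lt eq = ⊥-elim (Allˡ.lookup y∉w (in-w lt) eq)
      aligned {suc (suc s)} {0}           ls _ eq = ⊥-elim (Allˡ.lookup y∉w (in-w ls) (sym eq))
      aligned {suc (suc s)} {1}           ls _ eq = ⊥-elim (Allˡ.lookup x∉w (in-w ls) (sym eq))
      aligned {suc (suc s)} {suc (suc t)} ls lt eq = inj₂ (inj₂ (cong (λ z → suc (suc z)) (nth-injective uniq-w (s≤s⁻¹ (s≤s⁻¹ ls)) (s≤s⁻¹ (s≤s⁻¹ lt)) eq)))

      unshifted : f (Shifted α β 0) → f (Transposed x y)
      unshifted = mono λ { _ (i , refl , refl) → subst (λ k → Transposed x y (α i) (β k)) (sym (⊕-0 i)) (go (toℕ i) (<len i)) }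
        where
        go : ∀ s → s < suc (suc (length w)) → Transposed x y (nth y (x ∷ y ∷ w) s) (nth y (y ∷ x ∷ w) s)
        go 0             _  = inj₁ (refl , refl)
        go 1             _  = inj₂ (inj₁ (refl , refl))
        go (suc (suc s)) lt = inj₂ (inj₂ ((λ e → Allˡ.lookup x∉w (in-w lt) (sym e)) , (λ e → Allˡ.lookup y∉w (in-w lt) (sym e)) , refl))

      forward : f (Shifted α β 1) → f (Cycle x y w)
      forward = mono λ { _ (i , refl , refl) → go (toℕ i) (toℕ<n i) (toℕ-⊕ i 1) }
        where
        go : ∀ s → s < (2+ m) → ∀ {t} → t ≡ (s + 1) % (2+ m) → Cycle x y w (nth y (x ∷ y ∷ w) s) (nth y (y ∷ x ∷ w) t)
        go zero    _  refl = inj₁ (refl , refl)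
        go (suc s) lt {t} eq with m≤n⇒m<n∨m≡n lt
        ... | inj₁ lt′ = subst (λ t → Cycle x y w (nth y (y ∷ w) s) (nth y (y ∷ x ∷ w) t)) (sym t≡)
                (inj₂ (adj-nth w (≤-trans (s≤s⁻¹ (s≤s⁻¹ (<⇒≤ lt′))) (≤-reflexive (sym len)))))
          where
          t≡ : t ≡ suc (suc s)
          t≡ = trans eq (trans (cong (_% (2+ m)) (+-comm (suc s) 1)) (m<n⇒m%n≡m lt′))
        ... | inj₂ refl = subst (λ t → Cycle x y w (nth y (y ∷ w) s) (nth y (y ∷ x ∷ w) t)) (sym t≡)
                (inj₂ (subst (λ b → Adj (nth y (y ∷ w) s) b (y ∷ w ++ [ y ]))
                  (trans (cong (nth y w) (sym len)) (nth-end w)) (adj-nth w (≤-reflexive (sym len)))))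
          where
          t≡ : t ≡ 0
          t≡ = trans eq (trans (cong (_% (2+ m)) (+-comm (suc s) 1)) (n%n≡0 (2+ m)))

      backward : f (Shifted α β (suc m)) → f (Reversed x y w)
      backward = mono λ { _ (i , refl , refl) → go (toℕ i) (toℕ<n i) (toℕ-⊕ i (suc m)) }
        where
        end : nth x w m ≡ x
        end = trans (cong (nth x w) (sym len)) (nth-end w)
        go : ∀ s → s < (2+ m) → ∀ {t} → t ≡ (s + suc m) % (2+ m) → Reversed x y w (nth y (x ∷ y ∷ w) s) (nth y (y ∷ x ∷ w) t)
        go 0 _ {t} eq = subst (λ t → Reversed x y w x (nth y (y ∷ x ∷ w) t)) (sym (trans eq (m<n⇒m%n≡m (n<1+n (suc m)))))
          (inj₂ (subst₂ (λ b a → Adj b a (x ∷ w ++ [ x ])) (nth-default (x ∷ w) (s≤s (≤-reflexive (sym len)))) end (adj-nth w (≤-reflexive (sym len)))))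
        go 1 _ {t} eq = subst (λ t → Reversed x y w y (nth y (y ∷ x ∷ w) t)) (sym (trans eq (n%n≡0 (2+ m)))) (inj₁ (refl , refl))
        go (suc (suc s)) lt {t} eq = subst (λ t → Reversed x y w (nth y w s) (nth y (y ∷ x ∷ w) t)) (sym t≡)
          (inj₂ (subst₂ (λ b a → Adj b a (x ∷ w ++ [ x ]))
            (nth-default (x ∷ w) (≤-trans s<w (n≤1+n _))) (nth-default w s<w) (adj-nth w (<⇒≤ s<w))))
          where
          s<w : s < length w
          s<w = ≤-trans (s≤s⁻¹ (s≤s⁻¹ lt)) (≤-reflexive (sym len))
          t≡ : t ≡ suc s
          t≡ = trans eq (trans (cong (λ z → suc z % (2+ m)) (sym (+-suc s (suc m)))) (trans ([m+n]%n≡m%n (suc s) (2+ m)) (m<n⇒m%n≡m (<⇒≤ lt))))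

      split : f (Cycle x y w) ⊎ (toℕ y < ν × f (Reversed x y w))
      split with q , t ← tight-cyclic α β (λ {i} {k} eq → toℕ-injective (nth-injective uniq (<len i) (<len k) eq))
                                          (λ {i} {k} eq → toℕ-injective (nth-injective uniq′ (<len i) (<len k) eq)) j rows
        with a , _ , row , (i , refl , eq) , refl ← meet t id∈
        with aligned (<len i) (<len (i ⊕ toℕ q)) eq
      ... | inj₁ (i≡0 , iq≡1) = inj₁ (forward (subst (f ∘ Shifted α β) q≡1 t))
        where
        q≡1 : toℕ q ≡ 1
        q≡1 = trans (sym (m<n⇒m%n≡m (toℕ<n q))) (trans (sym (trans (toℕ-⊕ i (toℕ q)) (cong (λ z → (z + toℕ q) % (2+ m)) i≡0))) iq≡1)
      -- The shift -1 meets the identity only in the cell (y , y), so `y` must be a genuine row.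
      -- This excludes the alternative when `y` is not one.
      ... | inj₂ (inj₁ (i≡1 , iq≡0)) = inj₂ (subst (λ s → toℕ (nth y (x ∷ y ∷ w) s) < ν) i≡1 row , backward (subst (f ∘ Shifted α β) q≡-1 t))
        where
        wraps : (1 + toℕ q) % (2+ m) ≡ 0
        wraps = trans (sym (trans (toℕ-⊕ i (toℕ q)) (cong (λ z → (z + toℕ q) % (2+ m)) i≡1))) iq≡0
        q≡-1 : toℕ q ≡ suc m
        q≡-1 with m≤n⇒m<n∨m≡n (toℕ<n q)
        ... | inj₂ eq  = suc-injective eq
        ... | inj₁ lt with () ← trans (sym (m<n⇒m%n≡m lt)) wraps
      ... | inj₂ (inj₂ i≡iq) = contradiction (unshifted (subst (f ∘ Shifted α β) q≡0 t)) swap∉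
        where
        q≡0 : toℕ q ≡ 0
        q≡0 = trans (sym (m<n⇒m%n≡m (toℕ<n q))) (⊕-fixed i (toℕ q) (toℕ-injective (sym i≡iq)))

    -- The letters of s are not rows, so that they can stay in place.

    fixes : ∀ {x y} s u₀ → Unique (x ∷ y ∷ u₀) → (∀ {u} → u ↭ u₀ → f (Cycle x y (s ++ u))) →
            (∀ {a} → toℕ a < ν → a ∈ x ∷ y ∷ u₀) →
            (∀ {a b u} → toℕ a < ν → Adj a b (y ∷ (s ++ u) ++ [ y ]) → Adj a b (y ∷ u ++ [ y ])) →
            (∀ e → e ∈ x ∷ y ∷ u₀) ⊎ ν ≤ℕ toℕ y →
            Fixes x
    fixes {x} {y} s u₀ uniq@((x≢y ∷ x∉u₀) ∷ uniq-y) cycles∈ rows skip source {ρ} dec-ρ functional injective surjective ρ∈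
      with dec-ρ x x
    ... | yes ρxx = ρxx
    -- If ρ moves `x`, it still meets the identity, in some z other than `x`. A cycle through `y`
    -- whose cells in genuine rows all lie outside ρ then contradicts `meet`.
    ... | no ¬ρxx with z , _ , row-z , ρzz , refl ← meet ρ∈ id∈ = contradiction avoided ¬ρxx
      where
      Bad : Fin (2+ m) → Fin (2+ m) → Set
      Bad a b = toℕ a < ν × ρ a b
      open Avoid Bad (λ a b → (toℕ a <? ν) ×-dec dec-ρ a b) (λ (_ , p) (_ , q) → functional p q) (λ (_ , p) (_ , q) → injective p q) y

      other : ∀ {a} → a ≢ x → a ∈ x ∷ y ∷ u₀ → a ∈ y ∷ u₀
      other a≢x (here a≡x) = contradiction a≡x a≢x
      other a≢x (there a∈) = a∈

      -- Nothing bad leaves `y` if `y` is not a row. If all letters are listed, `e` is the preimage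
      -- of `x` under ρ, whose only image `x` is not on the cycle.
      free : (∀ e → e ∈ x ∷ y ∷ u₀) ⊎ ν ≤ℕ toℕ y → ∃[ e ] (e ∈ y ∷ u₀ × (∀ {b} → b ∈ y ∷ u₀ → ¬ Bad e b) × e ≢ z)
      free (inj₂ ν≤y) = y , here refl , (λ _ (y<ν , _) → n≮n _ (<-≤-trans y<ν ν≤y)) , λ { refl → n≮n _ (<-≤-trans row-z ν≤y) }
      free (inj₁ all-rows) = let e , ρex = surjective x in
        e , other (λ e≡x → ¬ρxx (subst (λ v → ρ v x) e≡x ρex)) (all-rows e) ,
        (λ b∈ (_ , ρeb) → unique-head uniq (subst (_∈ y ∷ u₀) (functional ρeb ρex) b∈)) ,
        λ e≡z → ¬ρxx (subst (λ v → ρ v v) (functional ρzz (subst (λ v → ρ v x) e≡z ρex)) ρzz)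

      avoided : ρ x x
      avoided with e , e∈ , e-free , e≢z ← free source
        with u , u↭ , good ← avoiding uniq-y e≢z e∈ (other (λ { refl → ¬ρxx ρzz }) (rows row-z)) e-free
                                (λ (_ , p) → functional p ρzz) (λ (_ , p) → injective p ρzz)
        with meet (cycles∈ u↭) ρ∈
      ... | a , b , row , inj₁ (refl , refl) , ρab = ρab
      ... | a , b , row , inj₂ adj , ρab = contradiction (row , ρab) (linked-adj good (skip row adj))

module _ {A : Set} where

  -- Each of `x` and `y` is fixed by one of the cycles and has its neighbours in the word on the
  -- other, so a common cell lies inside both words. For empty words both cycles would be the
  -- identity.
  cycle-reversed : ∀ {x y a b : A} {w w′} → w ≢ [] → w′ ≢ [] → Unique (x ∷ y ∷ w) → Unique (x ∷ y ∷ w′) →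
                   Cycle x y w a b → Reversed x y w′ a b → Adj a b w × Adj b a w′
  cycle-reversed {w = w} {w′} w≢[] w′≢[] ((x≢y ∷ x∉w) ∷ y∉w ∷ _) ((_ ∷ x∉w′) ∷ y∉w′ ∷ _) = go
    where
    outˡ : ∀ {v c} → Allˡ.All (v ≢_) w → c ∈ w → c ≢ v
    outˡ v∉ c∈ refl = Allˡ.lookup v∉ c∈ refl
    outʳ : ∀ {v c} → Allˡ.All (v ≢_) w′ → c ∈ w′ → c ≢ v
    outʳ v∉ c∈ refl = Allˡ.lookup v∉ c∈ refl
    go : ∀ {a b} → Cycle _ _ w a b → Reversed _ _ w′ a b → Adj a b w × Adj b a w′
    go (inj₁ (refl , refl)) (inj₁ (x≡y , _)) = contradiction x≡y x≢y
    go (inj₁ (refl , refl)) (inj₂ q) with adj-cyclic w′≢[] q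
    ... | inj₁ (_ , x∈)          = contradiction refl (outʳ x∉w′ x∈)
    ... | inj₂ (inj₁ q′)         = contradiction refl (outʳ x∉w′ (adj-∈ q′))
    ... | inj₂ (inj₂ (x∈ , _))   = contradiction refl (outʳ x∉w′ x∈)
    go (inj₂ p) (inj₁ (refl , refl)) with adj-cyclic w≢[] p
    ... | inj₁ (_ , y∈)          = contradiction refl (outˡ y∉w y∈)
    ... | inj₂ (inj₁ p′)         = contradiction refl (outˡ y∉w (adj-∈ p′))
    ... | inj₂ (inj₂ (y∈ , _))   = contradiction refl (outˡ y∉w y∈)
    go (inj₂ p) (inj₂ q) with adj-cyclic w≢[] p | adj-cyclic w′≢[] q
    ... | inj₁ (refl , b∈)       | inj₁ (refl , _)         = contradiction refl (outˡ x∉w b∈)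
    ... | inj₁ (refl , b∈)       | inj₂ (inj₁ q′)          = contradiction refl (outʳ y∉w′ (adj-∈ʳ q′))
    ... | inj₁ (refl , b∈)       | inj₂ (inj₂ (_ , y≡x))   = contradiction (sym y≡x) x≢y
    ... | inj₂ (inj₁ p′)         | inj₁ (refl , _)         = contradiction refl (outˡ x∉w (adj-∈ʳ p′))
    ... | inj₂ (inj₁ p′)         | inj₂ (inj₁ q′)          = p′ , q′
    ... | inj₂ (inj₁ p′)         | inj₂ (inj₂ (_ , refl))  = contradiction refl (outˡ x∉w (adj-∈ p′))
    ... | inj₂ (inj₂ (_ , refl)) | inj₁ (y≡x , _)          = contradiction (sym y≡x) x≢y
    ... | inj₂ (inj₂ (_ , refl)) | inj₂ (inj₁ q′)          = contradiction refl (outʳ y∉w′ (adj-∈ q′))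
    ... | inj₂ (inj₂ (_ , refl)) | inj₂ (inj₂ (y∈ , refl)) = contradiction refl (outʳ y∉w′ y∈)

  adj-++ˡ : ∀ {a b : A} {l r} → Adj a b l → Adj a b (l ++ r)
  adj-++ˡ here      = here
  adj-++ˡ (there p) = there (adj-++ˡ p)

  adj-++ʳ : ∀ {a b : A} l {r} → Adj a b r → Adj a b (l ++ r)
  adj-++ʳ []      p = p
  adj-++ʳ (_ ∷ l) p = there (adj-++ʳ l p)

  adj-reverse : ∀ {a b : A} {l} → Adj a b l → Adj b a (reverse l)
  adj-reverse {a} {b} (here {l}) = subst (Adj b a) (sym (trans (unfold-reverse a (b ∷ l))
    (trans (cong (_++ [ a ]) (unfold-reverse b l)) (++-assoc (reverse l) [ b ] [ a ])))) (adj-++ʳ (reverse l) here)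
  adj-reverse {a} {b} (there {c} {l} p) = subst (Adj b a) (sym (unfold-reverse c l)) (adj-++ˡ (adj-reverse p))

  reversed⇒cycle : ∀ {x y a b : A} {w} → Reversed x y w a b → Cycle y x (reverse w) a b
  reversed⇒cycle         (inj₁ p) = inj₁ p
  reversed⇒cycle {x} {y} {a} {b} {w} (inj₂ p) = inj₂ (subst (Adj a b)
    (trans (unfold-reverse x (w ++ [ x ])) (cong (_++ [ x ]) (reverse-++ w [ x ]))) (adj-reverse p))

-- Carries relations between distinct letters back to their positions; on four or five points
-- disjointness is then decided by evaluation.
module Letters {A : Set} {N : ℕ} (ℓ : Fin N → A) (ℓ-injective : Injective ℓ) where

  Pulled : (Fin N → Fin N → Set) → A → A → Set
  Pulled ρ a b = ∃₂ λ i j → ρ i j × a ≡ ℓ i × b ≡ ℓ j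

  adj-map : ∀ {a b l} → Adj a b (map ℓ l) → Pulled (λ i j → Adj i j l) a b
  adj-map {l = i ∷ j ∷ l} here = i , j , here , refl , refl
  adj-map {l = i ∷ l} (there p) with i′ , j′ , q , eq , eq′ ← adj-map {l = l} p = i′ , j′ , there q , eq , eq′

  pull-cycle : ∀ x y w {a b} → Cycle (ℓ x) (ℓ y) (map ℓ w) a b → Pulled (Cycle x y w) a b
  pull-cycle x y w (inj₁ (refl , refl)) = x , x , inj₁ (refl , refl) , refl , refl
  pull-cycle x y w {a} {b} (inj₂ p)
    with i , j , q , eq , eq′ ← adj-map {l = y ∷ w ++ [ y ]} (subst (λ z → Adj a b (ℓ y ∷ z)) (sym (map-++ ℓ w [ y ])) p) = i , j , inj₂ q , eq , eq′

  pull-reversed : ∀ x y w {a b} → Reversed (ℓ x) (ℓ y) (map ℓ w) a b → Pulled (Reversed x y w) a b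
  pull-reversed x y w (inj₁ (refl , refl)) = y , y , inj₁ (refl , refl) , refl , refl
  pull-reversed x y w {a} {b} (inj₂ p)
    with i , j , q , eq , eq′ ← adj-map {l = x ∷ w ++ [ x ]} (subst (λ z → Adj b a (ℓ x ∷ z)) (sym (map-++ ℓ w [ x ])) p) = j , i , inj₂ q , eq′ , eq

  pull-transposed : ∀ x y {i j} → Transposed (ℓ x) (ℓ y) (ℓ i) (ℓ j) → Transposed x y i j
  pull-transposed x y (inj₁ (p , q))              = inj₁ (ℓ-injective p , ℓ-injective q)
  pull-transposed x y (inj₂ (inj₁ (p , q)))       = inj₂ (inj₁ (ℓ-injective p , ℓ-injective q))
  pull-transposed x y (inj₂ (inj₂ (p , q , r)))   = inj₂ (inj₂ ((λ e → p (cong ℓ e)) , (λ e → q (cong ℓ e)) , ℓ-injective r))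

  pull-apart : ∀ {ρ ρ′ : Fin N → Fin N → Set} → (∀ i j → ¬ (ρ i j × ρ′ i j)) → ∀ {a b} → Pulled ρ a b → Pulled ρ′ a b → ⊥
  pull-apart apart (i , j , p , refl , refl) (i′ , j′ , q , eq , eq′) with refl ← ℓ-injective eq | refl ← ℓ-injective eq′ = apart i j (p , q)

adj? : ∀ {N} (i j : Fin N) l → Dec (Adj i j l)
adj? i j []          = no λ ()
adj? i j (a ∷ [])    = no λ { (there ()) }
adj? i j (a ∷ b ∷ l) with i ≟ a | j ≟ b | adj? i j (b ∷ l)
... | yes refl | yes refl | _     = yes here
... | yes refl | no j≢b   | yes p = yes (there p)
... | yes refl | no j≢b   | no ¬p = no λ { here → j≢b refl ; (there p) → ¬p p }
... | no i≢a   | _        | yes p = yes (there p)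
... | no i≢a   | _        | no ¬p = no λ { here → i≢a refl ; (there p) → ¬p p }

cycle? : ∀ {N} (x y : Fin N) w i j → Dec (Cycle x y w i j)
cycle? x y w i j = ((i ≟ x) ×-dec (j ≟ x)) ⊎-dec adj? i j (y ∷ w ++ [ y ])

reversed? : ∀ {N} (x y : Fin N) w i j → Dec (Reversed x y w i j)
reversed? x y w i j = ((i ≟ y) ×-dec (j ≟ y)) ⊎-dec adj? j i (x ∷ w ++ [ x ])

transposed? : ∀ {N} (x y i j : Fin N) → Dec (Transposed x y i j)
transposed? x y i j = ((i ≟ x) ×-dec (j ≟ y)) ⊎-dec (((i ≟ y) ×-dec (j ≟ x)) ⊎-dec (¬? (i ≟ x) ×-dec (¬? (i ≟ y) ×-dec (i ≟ j))))

apart? : ∀ {N} {ρ ρ′ : Fin N → Fin N → Set} → (∀ i j → Dec (ρ i j)) → (∀ i j → Dec (ρ′ i j)) → Dec (∀ i j → ¬ (ρ i j × ρ′ i j))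
apart? ρ? ρ′? = all? λ i → all? λ j → ¬? (ρ? i j ×-dec ρ′? i j)

-- Permutations: as many rows as columns

module _ {ν m : ℕ} {f : (Fin (2+ m) → Fin (2+ m) → Set) → Set} (S : System ν (2+ m) f) where

  open System S

  module Bijective (all-rows : ∀ (a : Fin (2+ m)) → toℕ a < ν) (id∈ : f _≡_) where

    decide : ∀ {x y w} → ¬ f (Transposed x y) → length w ≡ m → Unique (x ∷ y ∷ w) → f (Cycle x y w) ⊎ f (Reversed x y w)
    decide swap∉ len uniq with cycles S id∈ swap∉ len uniq (0 , λ i _ → all-rows _)
    ... | inj₁ p       = inj₁ p
    ... | inj₂ (_ , q) = inj₂ q

    apart : ∀ {ρ ρ′} → f ρ → f ρ′ → ¬ (∀ {a b} → ρ a b → ρ′ a b → ⊥)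
    apart p q disjoint with _ , _ , _ , r , r′ ← meet p q = disjoint r r′

    fixed : ∀ {x y w₀} → ¬ f (Transposed x y) → length w₀ ≡ m → w₀ ≢ [] → Unique (x ∷ y ∷ w₀) → f (Cycle x y w₀) → Fixes S x
    fixed {x} {y} {w₀} swap∉ len w₀≢[] uniq t₀ =
      fixes S id∈ [] w₀ uniq (λ p → rearrange (↭-sym p) ↭-refl t₀) (λ {a} _ → complete a) (λ _ p → p) (inj₁ complete)
      where
      complete : ∀ a → a ∈ x ∷ y ∷ w₀
      complete = unique⇒complete uniq (cong (λ z → suc (suc z)) len)
      T T′ : List (Fin (2+ m)) → Set
      T  w = f (Cycle x y w)
      T′ w = f (Reversed x y w)
      uniqueʷ : ∀ {w} → w ↭ w₀ → Unique (x ∷ y ∷ w)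
      uniqueʷ p = Unique-resp-↭ (↭-prep x (↭-prep y (↭-sym p))) uniq
      lengthʷ : ∀ {w} → w ↭ w₀ → length w ≡ m
      lengthʷ p = trans (↭-length p) len
      nonempty : ∀ {w} → w ↭ w₀ → w ≢ []
      nonempty p refl = w₀≢[] (empty w₀ (↭-length p))
        where
        empty : ∀ (v : List (Fin (2+ m))) → 0 ≡ length v → v ≡ []
        empty [] _ = refl
      decideʷ : ∀ w → w ↭ w₀ → T w ⊎ T′ w
      decideʷ w p = decide swap∉ (lengthʷ p) (uniqueʷ p)
      clash : ∀ {w w′} → w ↭ w₀ → w′ ↭ w₀ → T w → T′ w′ → ∃₂ λ a b → Adj a b w × Adj b a w′
      clash p p′ t t′ = let a , b , _ , c , c′ = meet t t′ in
        a , b , cycle-reversed (nonempty p) (nonempty p′) (uniqueʷ p) (uniqueʷ p′) c c′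
      unique-w₀ : Unique w₀
      unique-w₀ = AllPairsˡ.tail (AllPairsˡ.tail uniq)
      open Dichotomy w₀ unique-w₀ T T′ decideʷ clash

      -- On four or five points the two types are told apart by a second transposition (x c), which
      -- cannot belong to the family either.

      two : ∀ {a b} → (a ∷ b ∷ []) ↭ w₀ → T (a ∷ b ∷ []) → T (b ∷ a ∷ [])
      two {a} {b} p t with decideʷ (b ∷ a ∷ []) (↭-trans (↭-swap b a ↭-refl) p)
      ... | inj₁ t′ = t′
      ... | inj₂ t′ = ⊥-elim (absurd (decide swap∉′ (lengthʷ p) (Unique-resp-↭ (↭-prep x (↭-swap y a ↭-refl)) u)))
        where
        u : Unique (x ∷ y ∷ a ∷ b ∷ [])
        u = uniqueʷ p
        ℓ : Fin 4 → Fin (2+ m)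
        ℓ i = nth x (x ∷ y ∷ a ∷ b ∷ []) (toℕ i)
        ℓ-injective : Injective ℓ
        ℓ-injective {i} {j} eq = toℕ-injective (nth-injective u (toℕ<n i) (toℕ<n j) eq)
        open Letters ℓ ℓ-injective
        swap∉′ : ¬ f (Transposed x a)
        swap∉′ s = apart s t λ { r c → let i , j , q , e , e′ = pull-cycle 0F 1F (2F ∷ 3F ∷ []) c in
          toWitness {a? = apart? (transposed? 0F 2F) (cycle? 0F 1F (2F ∷ 3F ∷ []))} _ i j (pull-transposed 0F 2F (subst₂ (Transposed x a) e e′ r) , q) }
        absurd : f (Cycle x a (y ∷ b ∷ [])) ⊎ f (Reversed x a (y ∷ b ∷ [])) → ⊥
        absurd (inj₁ s) = apart s t′ λ r c →
          pull-apart (toWitness {a? = apart? (cycle? 0F 2F (1F ∷ 3F ∷ [])) (reversed? 0F 1F (3F ∷ 2F ∷ []))} _)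
            (pull-cycle 0F 2F (1F ∷ 3F ∷ []) r) (pull-reversed 0F 1F (3F ∷ 2F ∷ []) c)
        absurd (inj₂ s) = apart s t′ λ r c →
          pull-apart (toWitness {a? = apart? (reversed? 0F 2F (1F ∷ 3F ∷ [])) (reversed? 0F 1F (3F ∷ 2F ∷ []))} _)
            (pull-reversed 0F 2F (1F ∷ 3F ∷ []) r) (pull-reversed 0F 1F (3F ∷ 2F ∷ []) c)

      three : ∀ {a b c} → (a ∷ b ∷ c ∷ []) ↭ w₀ → T (a ∷ b ∷ c ∷ []) → T (b ∷ a ∷ c ∷ [])
      three {a} {b} {c} p t with decideʷ (b ∷ a ∷ c ∷ []) (↭-trans (↭-swap b a ↭-refl) p)
      ... | inj₁ t′ = t′
      ... | inj₂ t′ = ⊥-elim (absurd (decide swap∉′ (lengthʷ p) (Unique-resp-↭ (↭-prep x re) u)))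
        where
        u : Unique (x ∷ y ∷ a ∷ b ∷ c ∷ [])
        u = uniqueʷ p
        re : y ∷ a ∷ b ∷ c ∷ [] ↭ c ∷ b ∷ y ∷ a ∷ []
        re = ↭-trans (++-comm (y ∷ a ∷ []) (b ∷ c ∷ [])) (↭-swap b c ↭-refl)
        -- Of the two alternatives for (x c), one is disjoint from the assumed `T′` word, the other
        -- from this rotation of a, b, c.
        rotated : T (c ∷ a ∷ b ∷ [])
        rotated = rotate₁ (↭-trans (↭-sym (∷↭∷ʳ a (b ∷ c ∷ []))) p) (rotate₁ p t)
        ℓ : Fin 5 → Fin (2+ m)
        ℓ i = nth x (x ∷ y ∷ a ∷ b ∷ c ∷ []) (toℕ i)
        ℓ-injective : Injective ℓ
        ℓ-injective {i} {j} eq = toℕ-injective (nth-injective u (toℕ<n i) (toℕ<n j) eq)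
        open Letters ℓ ℓ-injective
        swap∉′ : ¬ f (Transposed x c)
        swap∉′ s = apart s t λ { r c′ → let i , j , q , e , e′ = pull-cycle 0F 1F (2F ∷ 3F ∷ 4F ∷ []) c′ in
          toWitness {a? = apart? (transposed? 0F 4F) (cycle? 0F 1F (2F ∷ 3F ∷ 4F ∷ []))} _ i j (pull-transposed 0F 4F (subst₂ (Transposed x c) e e′ r) , q) }
        absurd : f (Cycle x c (b ∷ y ∷ a ∷ [])) ⊎ f (Reversed x c (b ∷ y ∷ a ∷ [])) → ⊥
        absurd (inj₁ s) = apart s t′ λ r c →
          pull-apart (toWitness {a? = apart? (cycle? 0F 4F (3F ∷ 1F ∷ 2F ∷ [])) (reversed? 0F 1F (3F ∷ 2F ∷ 4F ∷ []))} _)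
            (pull-cycle 0F 4F (3F ∷ 1F ∷ 2F ∷ []) r) (pull-reversed 0F 1F (3F ∷ 2F ∷ 4F ∷ []) c)
        absurd (inj₂ s) = apart s rotated λ r c →
          pull-apart (toWitness {a? = apart? (reversed? 0F 4F (3F ∷ 1F ∷ 2F ∷ [])) (cycle? 0F 1F (4F ∷ 2F ∷ 3F ∷ []))} _)
            (pull-reversed 0F 4F (3F ∷ 1F ∷ 2F ∷ []) r) (pull-cycle 0F 1F (4F ∷ 2F ∷ 3F ∷ []) c)

      swap-head : ∀ {a b w} → (a ∷ b ∷ w) ↭ w₀ → T (a ∷ b ∷ w) → T (b ∷ a ∷ w)
      swap-head {w = []}        = two
      swap-head {w = _ ∷ []}    = three
      swap-head {w = _ ∷ _ ∷ _} = swap₁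

      rotate-one : ∀ {a w} → (a ∷ w) ↭ w₀ → T (a ∷ w) → T (w ++ [ a ])
      rotate-one {w = []}        p t = t
      rotate-one {w = _ ∷ []}    p t = two p t
      rotate-one {w = _ ∷ _ ∷ _} p t = rotate₁ p t

      open Rearrange w₀ T rotate-one swap-head

    bijective : ∀ {x y w} → ¬ f (Transposed x y) → length w ≡ m → w ≢ [] → Unique (x ∷ y ∷ w) → ∃[ z ] Fixes S z
    bijective {x} {y} {w} swap∉ len w≢[] uniq with decide swap∉ len uniq
    ... | inj₁ t = x , fixed swap∉ len w≢[] uniq t
    ... | inj₂ t = y , fixed (λ s → swap∉ (mono (λ _ → turn) s)) (trans (↭-length (↭-reverse w)) len)
                        (λ e → w≢[] (trans (sym (reverse-involutive w)) (cong reverse e)))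
                        (Unique-resp-↭ (↭-trans (↭-swap x y ↭-refl) (↭-prep y (↭-prep x (↭-sym (↭-reverse w))))) uniq)
                        (mono (λ _ → reversed⇒cycle) t)
      where
      turn : ∀ {a b} → Transposed y x a b → Transposed x y a b
      turn (inj₁ p)                  = inj₂ (inj₁ p)
      turn (inj₂ (inj₁ p))           = inj₁ p
      turn (inj₂ (inj₂ (p , q , r))) = inj₂ (inj₂ (q , p , r))

-- Injections, and transpositions leaving the family

filter-↭ : ∀ {A : Set} {P : A → Set} (P? : ∀ a → Dec (P a)) l →
           ∃₂ λ s u → l ↭ s ++ u × Allˡ.All (λ a → ¬ P a) s × Allˡ.All P u
filter-↭ P? [] = [] , [] , ↭-refl , [] , []
filter-↭ P? (a ∷ l) with P? a | filter-↭ P? l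
... | yes p | s , u , q , ns , ps = s , a ∷ u , ↭-trans (↭-prep a q) (↭-sym (shift a s u)) , ns , p ∷ ps
... | no ¬p | s , u , q , ns , ps = a ∷ s , u , ↭-prep a q , ¬p ∷ ns , ps

adj-skip : ∀ {A : Set} {P : A → Set} {a b : A} s {l} → Allˡ.All (λ c → ¬ P c) s → P a → Adj a b (s ++ l) → Adj a b l
adj-skip []      _          _ p         = p
adj-skip (c ∷ s) (¬pc ∷ ns) q p = step s p ns ¬pc q
  where
  step : ∀ {P : _ → Set} {a b c} s {l} → Adj a b (c ∷ s ++ l) → Allˡ.All (λ c → ¬ P c) s → ¬ P c → P a → Adj a b l
  step []      here      _        ¬pc q = contradiction q ¬pc
  step (_ ∷ _) here      _        ¬pc q = contradiction q ¬pc
  step []      (there p) _        ¬pc q = p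
  step (d ∷ s) (there p) (¬pd ∷ ns) ¬pc q = step s p ns ¬pd q

nth-++ : ∀ {A : Set} {d : A} s {u t} → nth d (s ++ u) (length s + t) ≡ nth d u t
nth-++ []      = refl
nth-++ (a ∷ s) = nth-++ s

module _ {n : ℕ} where

  opaque
    exchange : Fin n → Fin n → Fin n → Fin n
    exchange = transpose

    exchange≡transpose : ∀ i j a → exchange i j a ≡ transpose i j a
    exchange≡transpose i j a = refl

    exchange-≡ˡ : ∀ (i j : Fin n) → exchange i j i ≡ j
    exchange-≡ˡ i j with i ≟ i
    ... | yes _ = refl
    ... | no ne = contradiction refl ne

    exchange-≡ʳ : ∀ (i j : Fin n) → exchange i j j ≡ i
    exchange-≡ʳ i j with j ≟ i
    ... | yes e = e
    ... | no _ with j ≟ j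
    ...   | yes _ = refl
    ...   | no ne = contradiction refl ne

    exchange-≢ : ∀ {i j k : Fin n} → k ≢ i → k ≢ j → exchange i j k ≡ k
    exchange-≢ {i} {j} {k} k≢i k≢j with k ≟ i
    ... | yes e = contradiction e k≢i
    ... | no _ with k ≟ j
    ...   | yes e = contradiction e k≢j
    ...   | no _  = refl

    exchange-self : ∀ (i a : Fin n) → exchange i i a ≡ a
    exchange-self i a with a ≟ i
    ... | yes e = sym e
    ... | no ne with a ≟ i
    ...   | yes e = sym e
    ...   | no _  = refl

    exchange-injective : ∀ (i j : Fin n) → Injective (exchange i j)
    exchange-injective i j {a} {b} eq = trans (sym (transpose-inverse j i)) (trans (cong (transpose j i) eq) (transpose-inverse j i))

  exchange-swap : ∀ (i j a : Fin n) → exchange i j a ≡ exchange j i a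
  exchange-swap i j a = go (a ≟ i) (a ≟ j)
    where
    go : Dec (a ≡ i) → Dec (a ≡ j) → exchange i j a ≡ exchange j i a
    go (yes refl) _          = trans (exchange-≡ˡ i j) (sym (exchange-≡ʳ j i))
    go (no _)     (yes refl) = trans (exchange-≡ʳ i j) (sym (exchange-≡ˡ j i))
    go (no a≢i)   (no a≢j)   = trans (exchange-≢ a≢i a≢j) (sym (exchange-≢ a≢j a≢i))

  -- Conjugating (j v) by (i v) gives (i j). A transposition of two rows is thereby replaced by
  -- three that involve the non-row `v`.
  exchange-via : ∀ {i j v : Fin n} → i ≢ j → i ≢ v → j ≢ v → ∀ a → exchange i v (exchange j v (exchange i v a)) ≡ exchange i j a
  exchange-via {i} {j} {v} i≢j i≢v j≢v a = go (a ≟ i) (a ≟ j) (a ≟ v)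
    where
    t = exchange
    chain : ∀ a {b c d} → t i v a ≡ b → t j v b ≡ c → t i v c ≡ d → t i v (t j v (t i v a)) ≡ d
    chain _ refl refl refl = refl
    go : Dec (a ≡ i) → Dec (a ≡ j) → Dec (a ≡ v) → t i v (t j v (t i v a)) ≡ t i j a
    go (yes refl) _          _          = trans (chain i (exchange-≡ˡ i v) (exchange-≡ʳ j v) (exchange-≢ (λ e → i≢j (sym e)) j≢v)) (sym (exchange-≡ˡ i j))
    go (no a≢i)   (yes refl) _          = trans (chain j (exchange-≢ a≢i j≢v) (exchange-≡ˡ j v) (exchange-≡ʳ i v)) (sym (exchange-≡ʳ i j))
    go (no a≢i)   (no a≢j)   (yes refl) = trans (chain v (exchange-≡ʳ i v) (exchange-≢ i≢j i≢v) (exchange-≡ˡ i v)) (sym (exchange-≢ a≢i a≢j))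
    go (no a≢i)   (no a≢j)   (no a≢v)   = trans (chain a (exchange-≢ a≢i a≢v) (exchange-≢ a≢j a≢v) (exchange-≢ a≢i a≢v)) (sym (exchange-≢ a≢i a≢j))

module _ {ν m : ℕ} {f : (Fin (2+ m) → Fin (2+ m) → Set) → Set} (S : System ν (2+ m) f) where

  open System S

  -- As `y` is not a row, `cycles` leaves only the first alternative, and all the required cycles (y
  -- w) are available at once. The non-rows `s` follow `y`, so that the rows in `u` and then `x`
  -- form a cyclic interval.
  injective : ν ≤ℕ 2+ m → f _≡_ → ∀ {x y} → x ≢ y → toℕ x < ν → ν ≤ℕ toℕ y → ¬ f (Transposed x y) → Fixes S x
  injective ν≤n id∈ {x} {y} x≢y row-x ν≤y swap∉
    with r , p ← ∈⇒↭ (∈-allFin {n = 2+ m} x)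
    with ∈-resp-↭ p (∈-allFin y)
  ... | here y≡x = contradiction (sym y≡x) x≢y
  ... | there y∈r with r′ , p′ ← ∈⇒↭ y∈r
                  with s , u₀ , q , nonrows , rows ← filter-↭ (λ a → toℕ a <? ν) r′ =
    fixes S id∈ s u₀ (Unique-resp-↭ arrange₂ (drop s (Unique-resp-↭ arrange₃ uniq)))
      cycle∈ rows-listed skip (inj₂ ν≤y)
    where
    arrange : allFin (2+ m) ↭ x ∷ y ∷ s ++ u₀
    arrange = ↭-trans p (↭-prep x (↭-trans p′ (↭-prep y q)))
    uniq : Unique (x ∷ y ∷ s ++ u₀)
    uniq = Unique-resp-↭ arrange (allFin⁺ (2+ m))
    arrange₂ : u₀ ++ x ∷ y ∷ [] ↭ x ∷ y ∷ u₀
    arrange₂ = ++-comm u₀ (x ∷ y ∷ [])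
    arrange₃ : x ∷ y ∷ s ++ u₀ ↭ s ++ (u₀ ++ x ∷ y ∷ [])
    arrange₃ = ↭-trans (++-comm (x ∷ y ∷ []) (s ++ u₀)) (↭-reflexive (++-assoc s u₀ _))
    drop : ∀ s {l} → Unique (s ++ l) → Unique l
    drop []      u = u
    drop (_ ∷ s) u = drop s (AllPairsˡ.tail u)
    length≡ : length s + length u₀ ≡ m
    length≡ = suc-injective (suc-injective (trans (cong (λ z → suc (suc z)) (sym (length-++ s)))
      (trans (sym (↭-length arrange)) (length-tabulate {n = 2+ m} id))))

    rows-listed : ∀ {a} → toℕ a < ν → a ∈ x ∷ y ∷ u₀
    rows-listed {a} row with ∈-resp-↭ arrange (∈-allFin a)
    ... | here e           = here e
    ... | there (here e)   = there (here e)
    ... | there (there a∈) with ∈-++⁻ s a∈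
    ...   | inj₁ a∈s = contradiction row (Allˡ.lookup nonrows a∈s)
    ...   | inj₂ a∈u = there (there a∈u)

    rowᶠ : Fin ν → Fin (2+ m)
    rowᶠ i = inject≤ i ν≤n
    row∈ : ∀ i → rowᶠ i ∈ x ∷ u₀
    row∈ i with rows-listed (≤-trans (s≤s (≤-reflexive (toℕ-inject≤ i ν≤n))) (toℕ<n i))
    ... | here e           = here e
    ... | there (here e)   = contradiction (≤-trans (s≤s (≤-reflexive (trans (cong toℕ (sym e)) (toℕ-inject≤ i ν≤n)))) (toℕ<n i)) (≤⇒≯ ν≤y)
    ... | there (there a∈) = there a∈
    ν≤u : ν ≤ℕ suc (length u₀)
    ν≤u = injective⇒≤ {f = λ i → Any.index (row∈ i)} λ {i} {j} eq → inject≤-injective ν≤n ν≤n i j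
      (trans (Anyₚ.lookup-index (row∈ i)) (trans (cong (List.lookup (x ∷ u₀)) eq) (sym (Anyₚ.lookup-index (row∈ j)))))

    skip : ∀ {a b u} → toℕ a < ν → Adj a b (y ∷ (s ++ u) ++ [ y ]) → Adj a b (y ∷ u ++ [ y ])
    skip {a} {b} {u} row adj = there (adj-skip (y ∷ s) (≤⇒≯ ν≤y ∷ nonrows) row (subst (λ l → Adj a b (y ∷ l)) (++-assoc s u [ y ]) adj))

    cycle∈ : ∀ {u} → u ↭ u₀ → f (Cycle x y (s ++ u))
    cycle∈ {u} u↭ with cycles S id∈ {w = s ++ u} swap∉
        (trans (length-++ s) (trans (cong (length s +_) (↭-length u↭)) length≡))
        (Unique-resp-↭ (↭-prep x (↭-prep y (++⁺ˡ s (↭-sym u↭)))) uniq)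
        -- Positions are counted from the first letter of `u`; the interval formed by `u` and `x`
        -- has at least ν positions.
        (2 + length s , layout)
      where
      layout : ∀ (i : Fin (2+ m)) → toℕ i < ν → toℕ (nth y (x ∷ y ∷ s ++ u) (toℕ (i ⊕ (2 + length s)))) < ν
      layout i i<ν with m≤n⇒m<n∨m≡n i+≤n
        where
        i+≤n : toℕ i + (2 + length s) ≤ℕ 2+ m
        i+≤n = ≤-trans (+-monoˡ-≤ (2 + length s) (s≤s⁻¹ (≤-trans i<ν ν≤u)))
          (≤-reflexive (trans (+-comm (length u₀) _) (cong (λ z → suc (suc z)) length≡)))
      ... | inj₁ lt = subst (λ t → toℕ (nth y (x ∷ y ∷ s ++ u) t) < ν) (sym t≡)
          (subst (λ a → toℕ a < ν) (sym (nth-++ s)) (Allˡ.lookup rows (∈-resp-↭ u↭ (nth-∈ u i<u))))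
        where
        t≡ : toℕ (i ⊕ (2 + length s)) ≡ 2 + (length s + toℕ i)
        t≡ = trans (⊕-noWrap i _ lt) (trans (+-comm (toℕ i) _) refl)
        i<u : toℕ i < length u
        i<u = +-cancelʳ-≤ (2 + length s) _ _ (≤-trans lt (≤-reflexive (trans (cong (λ z → suc (suc z)) (sym length≡))
          (trans (+-comm (2 + length s) (length u₀)) (cong (_+ (2 + length s)) (sym (↭-length u↭)))))))
      ... | inj₂ eq = subst (λ t → toℕ (nth y (x ∷ y ∷ s ++ u) t) < ν) (sym t≡) row-x
        where
        t≡ : toℕ (i ⊕ (2 + length s)) ≡ 0
        t≡ = trans (toℕ-⊕ i _) (trans (cong (_% (2+ m)) eq) (n%n≡0 (2+ m)))
    ... | inj₁ t         = t
    ... | inj₂ (y<ν , _) = contradiction y<ν (≤⇒≯ ν≤y)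

  Graph : (Fin (2+ m) → Fin (2+ m)) → Fin (2+ m) → Fin (2+ m) → Set
  Graph h a b = h a ≡ b

  Holds : (Fin (2+ m) → Fin (2+ m)) → Set
  Holds h = f (Graph h)

  holds? : ∀ h → Dec (Holds h)
  holds? h = dec (λ a b → h a ≟ b)

  holds-cong : ∀ {h h′} → (∀ a → toℕ a < ν → h a ≡ h′ a) → Holds h → Holds h′
  holds-cong eq = mono (λ {a} row p → trans (sym (eq a row)) p)

  record Leaving (P : Fin (2+ m) → Fin (2+ m) → Set) : Set where
    constructor leaving
    field
      {base}    : Fin (2+ m) → Fin (2+ m)
      base-inj  : Injective base
      inside    : Holds base
      {x y}     : Fin (2+ m)
      positions : P x y
      outside   : ¬ Holds (base ∘ exchange x y)

  eval-injective : ∀ ts → Injective (eval {2+ m} ts ⟨$⟩ʳ_)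
  eval-injective ts {i} {j} eq = trans (sym (inverseˡ (eval ts))) (trans (cong (_⟨$⟩ˡ_ (eval ts)) eq) (inverseˡ (eval ts)))

  -- Along the partial products of the transpositions the family is left at some step, and this step
  -- is a single transposition.
  walk : ∀ ts {h} → Injective h → Holds h → ¬ Holds (h ∘ (eval ts ⟨$⟩ʳ_)) → Leaving (λ _ _ → Fin (2+ m))
  walk []             h-inj h∈ h∉ = contradiction h∈ h∉
  walk ((i , j) ∷ ts) {h} h-inj h∈ h∉ with holds? (h ∘ (eval ts ⟨$⟩ʳ_))
  ... | yes in∈ = leaving (λ eq → eval-injective ts (h-inj eq)) in∈ {i} {j} i
    (λ out → h∉ (holds-cong (λ a _ → cong (λ b → h (eval ts ⟨$⟩ʳ b)) (exchange≡transpose i j a)) out))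
  ... | no  out = walk ts h-inj h∈ out

  start : ∃[ h ] (Injective h × Holds h)
  start with q , t ← tight id id (λ eq → eq) (λ eq → eq) (λ _ row → row) =
    (_⊕ toℕ q) , ⊕-injectiveˡ (toℕ q) , mono (λ { _ (i , refl , refl) → refl }) t

  private
    turn : ∀ (i : Fin (2+ m)) {a b} → a + b ≡ (2+ m) → i ⊕ a ⊕ b ≡ i
    turn i {a} {b} eq = trans (⊕-+ i a b) (trans (cong (i ⊕_) eq) (toℕ-injective
      (trans (toℕ-⊕ i (2+ m)) (trans ([m+n]%n≡m%n (toℕ i) (2+ m)) (m<n⇒m%n≡m (toℕ<n i))))))

  rotation : Permutation′ (2+ m)
  rotation = permutation (_⊕ 1) (_⊕ suc m) (λ i → turn i (+-comm (suc m) 1)) (λ i → turn i refl)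

  rotated∉ : ∀ {h h′} → Injective h → Holds h → (∀ a → h′ a ≡ h (a ⊕ 1)) → ¬ Holds h′
  rotated∉ h-inj h∈ eq h′∈ with a , _ , _ , p , q ← meet h∈ h′∈
    with () ← ⊕-fixed a 1 (h-inj (trans (sym (eq a)) (trans q (sym p))))

  leave : Leaving (λ _ _ → Fin (2+ m))
  leave = let h , h-inj , h∈ = start in
    walk (decompose rotation) h-inj h∈ (rotated∉ h-inj h∈ (λ a → cong h (eval-decompose rotation a)))

  -- Transposing two non-rows changes nothing on the rows. A transposition of two rows i, j is
  -- factored as (i v)(j v)(i v) with a non-row `v`, and one of the three steps leaves the family.
  leave-rows : ν < (2+ m) → Leaving (λ x y → toℕ x < ν × ν ≤ℕ toℕ y)
  leave-rows ν<n = through leave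
    where
    through : Leaving (λ _ _ → Fin (2+ m)) → Leaving (λ x y → toℕ x < ν × ν ≤ℕ toℕ y)
    through (leaving {h} h-inj h∈ {i} {j} _ h∉) with toℕ i <? ν | toℕ j <? ν
    ... | yes i<ν | no j≮ν  = leaving h-inj h∈ (i<ν , ≮⇒≥ j≮ν) h∉
    ... | no i≮ν  | yes j<ν = leaving h-inj h∈ (j<ν , ≮⇒≥ i≮ν) (λ out → h∉ (holds-cong (λ a _ → cong h (exchange-swap j i a)) out))
    ... | no i≮ν  | no j≮ν  = contradiction (holds-cong (λ a row → cong h (sym (exchange-≢ (λ { refl → i≮ν row }) (λ { refl → j≮ν row })))) h∈) h∉
    ... | yes i<ν | yes j<ν = via (holds? (h ∘ exchange i v)) (holds? (h ∘ exchange i v ∘ exchange j v))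
      where
      v : Fin (2+ m)
      v = fromℕ< ν<n
      ν≤v : ν ≤ℕ toℕ v
      ν≤v = ≤-reflexive (sym (toℕ-fromℕ< ν<n))
      ≢v : ∀ {a : Fin (2+ m)} → toℕ a < ν → a ≢ v
      ≢v row refl = ≤⇒≯ ν≤v row
      i≢j : i ≢ j
      i≢j refl = h∉ (holds-cong (λ a _ → cong h (sym (exchange-self i a))) h∈)
      via : Dec (Holds (h ∘ exchange i v)) → Dec (Holds (h ∘ exchange i v ∘ exchange j v)) → Leaving (λ x y → toℕ x < ν × ν ≤ℕ toℕ y)
      via (no out)  _         = leaving h-inj h∈ (i<ν , ν≤v) out
      via (yes in₁) (no out)  = leaving (λ eq → exchange-injective i v (h-inj eq)) in₁ (j<ν , ν≤v) out
      via (yes in₁) (yes in₂) = leaving (λ eq → exchange-injective j v (exchange-injective i v (h-inj eq))) in₂ (i<ν , ν≤v)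
        (λ out → h∉ (holds-cong (λ a _ → cong h (exchange-via i≢j (≢v i<ν) (≢v j<ν) a)) out))

  Renamed : (Fin (2+ m) → Fin (2+ m)) → (Fin (2+ m) → Fin (2+ m) → Set) → Set
  Renamed h ρ = f (λ a b → ∃[ c ] (ρ a c × b ≡ h c))

  renamed : ∀ {h} → Injective h → System ν (2+ m) (Renamed h)
  renamed {h} h-inj = record
    { mono  = λ imp → mono (λ { row (c , p , eq) → c , imp row p , eq })
    ; dec   = λ dec-ρ → dec (λ a b → any? (λ c → dec-ρ a c ×-dec (b ≟ h c)))
    ; meet  = λ {_} {ρ′} p q → let a , b , row , (c , r , eq) , (c′ , r′ , eq′) = meet p q in
                      a , c , row , r , subst (ρ′ a) (h-inj (trans (sym eq′) eq)) r′
    ; tight = λ α β α-inj β-inj rows → let q , t = tight α (h ∘ β) α-inj (λ eq → β-inj (h-inj eq)) rows in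
                      q , mono (λ { _ (i , refl , refl) → β (i ⊕ toℕ q) , (i , refl , refl) , refl }) t
    }

  module _ {P : Fin (2+ m) → Fin (2+ m) → Set} (l : Leaving P) where

    open Leaving l

    base-id : Renamed base _≡_
    base-id = mono (λ { _ refl → _ , refl , refl }) inside

    base-swap : ¬ Renamed base (Transposed x y)
    base-swap t = outside (mono (λ { _ (c , p , refl) → cong base (follow p) }) t)
      where
      follow : ∀ {a c} → Transposed x y a c → exchange x y a ≡ c
      follow (inj₁ (refl , refl))            = exchange-≡ˡ x y
      follow (inj₂ (inj₁ (refl , refl)))     = exchange-≡ʳ x y
      follow (inj₂ (inj₂ (a≢x , a≢y , refl))) = exchange-≢ a≢x a≢y

    x≢y : x ≢ y
    x≢y eq = outside (holds-cong (λ a _ → cong base (sym (trans (cong (λ z → exchange x z a) (sym eq)) (exchange-self x a)))) inside)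

    conclude : ∀ {z} → Fixes (renamed base-inj) z → ∀ h → Injective h → Holds h → h z ≡ base z
    conclude fix h h-inj h∈ = fix (λ a b → h a ≟ base b) (λ p q → base-inj (trans (sym p) q)) (λ p q → h-inj (trans p (sym q)))
      (λ b → injective⇒surjective h h-inj (base b))
      (mono (λ { {a} _ refl → let c , eq = injective⇒surjective base base-inj (h a) in c , sym eq , sym eq }) h∈)

module _ {ν m : ℕ} {f : (Fin (2+ m) → Fin (2+ m) → Set) → Set} (S : System ν (2+ m) f) where

  arrangement-from : ∀ {x y : Fin (2+ m)} → x ≢ y → ∃[ w ] (allFin (2+ m) ↭ x ∷ y ∷ w)
  arrangement-from {x} {y} x≢y = let r , p = ∈⇒↭ (∈-allFin {n = 2+ m} x) in further p (∈-resp-↭ p (∈-allFin y))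
    where
    further : ∀ {r} → allFin (2+ m) ↭ x ∷ r → y ∈ x ∷ r → ∃[ w ] (allFin (2+ m) ↭ x ∷ y ∷ w)
    further p (here y≡x) = contradiction (sym y≡x) x≢y
    further p (there y∈) = let w , p′ = ∈⇒↭ y∈ in w , ↭-trans p (↭-prep x p′)

  -- `1 ≤ m` makes the words nonempty. With spare columns the transposition joins a row `x` to a
  -- non-row, and `x` is the central row; otherwise the dichotomy of the cycles decides which of its
  -- two points is.
  centre : 1 ≤ℕ m → ν ≤ℕ 2+ m → ∃₂ λ a b → toℕ a < ν × (∀ h → Injective h → Holds S h → h a ≡ b)
  centre 1≤m ν≤n with m≤n⇒m<n∨m≡n ν≤n
  ... | inj₁ ν<n = some-row (leave-rows S ν<n)
    where
    some-row : Leaving S (λ x y → toℕ x < ν × ν ≤ℕ toℕ y) → _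
    some-row l@(leaving {base} base-inj _ {x} (x<ν , ν≤y) _) =
      x , base x , x<ν , conclude S l (injective (renamed S base-inj) ν≤n (base-id S l) (x≢y S l) x<ν ν≤y (base-swap S l))
  ... | inj₂ refl = any-point (leave S)
    where
    any-point : Leaving S (λ _ _ → Fin (2+ m)) → _
    any-point l@(leaving {base} base-inj _ {x} {y} _ _) =
      let w , p = arrangement-from (x≢y S l)
          len   = suc-injective (suc-injective (trans (sym (↭-length p)) (length-tabulate {n = 2+ m} id)))
          z , fix = Bijective.bijective (renamed S base-inj) toℕ<n (base-id S l) (base-swap S l) len (nonempty len) (Unique-resp-↭ p (allFin⁺ (2+ m)))
      in z , base z , toℕ<n z , conclude S l fix
      where
      nonempty : ∀ {w : List (Fin (2+ m))} → length w ≡ m → w ≢ []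
      nonempty refl refl = contradiction 1≤m λ ()

-- From the permutations to all coordinates

⊕-transitive : ∀ {n} (a b : Fin n) → ∃[ j ] a ⊕ toℕ {n} j ≡ b
⊕-transitive {n} a b = injective⇒surjective (λ j → a ⊕ toℕ j) (λ eq → toℕ-injective (⊕-injectiveʳ a (toℕ<n _) (toℕ<n _) eq)) b

⊕-free : ∀ {n} {a b y : Fin n} (j : Fin n) → a ⊕ toℕ j ≡ b → b ≢ a → y ⊕ toℕ j ≢ y
⊕-free {suc n} {a} {b} {y} j eq b≢a fixed = b≢a (trans (sym eq) (trans (cong (a ⊕_) j≡0) (⊕-0 a)))
  where
  j≡0 : toℕ j ≡ 0
  j≡0 = trans (sym (%-toℕ j)) (⊕-fixed y (toℕ j) fixed)

another : ∀ {n} → 3 ≤ℕ n → (a b : Fin n) → ∃[ c ] (c ≢ a × c ≢ b)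
another {suc (suc (suc n))} _ 0F            0F            = 1F , (λ ()) , λ ()
another {suc (suc (suc n))} _ 0F            1F            = 2F , (λ ()) , λ ()
another {suc (suc (suc n))} _ 0F            (suc (suc b)) = 1F , (λ ()) , λ ()
another {suc (suc (suc n))} _ 1F            0F            = 2F , (λ ()) , λ ()
another {suc (suc (suc n))} _ (suc (suc a)) 0F            = 1F , (λ ()) , λ ()
another {suc (suc (suc n))} _ (suc a)       (suc b)       = 0F , (λ ()) , λ ()
another {suc zero}          (s≤s ())
another {suc (suc zero)}    (s≤s (s≤s ()))

extend : ∀ {n r} (a b : Fin r → Fin n) → Injective a → Injective b →
         ∃[ h ] (Injective h × (∀ s → h (a s) ≡ b s))
extend a b a-inj b-inj = let g , g∈ , ext = extension a b a-inj b-inj in lookup g , perm-injective g g∈ , ext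

point : ∀ {n} (a b : Fin n) → ∃[ h ] (Injective h × h a ≡ b)
point a b = let h , h-inj , eq = extend {r = 1} (λ _ → a) (λ _ → b) only only in h , h-inj , eq 0F
  where
  only : ∀ {A : Set} {c : A} → Injective {A = Fin 1} (λ _ → c)
  only {i = 0F} {j = 0F} _ = refl

two-points : ∀ {n} {a a′ b b′ : Fin n} → a ≢ a′ → b ≢ b′ → ∃[ h ] (Injective h × h a ≡ b × h a′ ≡ b′)
two-points {a = a} {a′} {b} {b′} a≢a′ b≢b′ =
  let h , h-inj , eq = extend (pair a a′) (pair b b′) (pair-inj a≢a′) (pair-inj b≢b′) in h , h-inj , eq 0F , eq 1F
  where
  pair : ∀ {A : Set} → A → A → Fin 2 → A
  pair c d 0F = c
  pair c d 1F = d
  pair-inj : ∀ {A : Set} {c d : A} → c ≢ d → Injective (pair c d)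
  pair-inj c≢d {0F} {0F} _  = refl
  pair-inj c≢d {0F} {1F} eq = contradiction eq c≢d
  pair-inj c≢d {1F} {0F} eq = contradiction (sym eq) c≢d
  pair-inj c≢d {1F} {1F} _  = refl

-- `h′` is `h` precomposed with a nontrivial rotation, so the two agree nowhere. The rotation takes
-- `a′` to a point where `h` has the value `b′`: this is `a` if b = b′, and a third point `c`
-- otherwise.
nowhere-equal : ∀ {n} → 3 ≤ℕ n → {a a′ b b′ : Fin n} → ¬ (a ≡ a′ × b ≡ b′) →
                ∃₂ λ h h′ → Injective h × Injective h′ × h a ≡ b × h′ a′ ≡ b′ × (∀ y → h y ≢ h′ y)
nowhere-equal 3≤n {a} {a′} {b} {b′} differ with b ≟ b′
... | yes refl = let h , h-inj , eq = point a b in shifted h-inj eq eq (λ a≡a′ → differ (a≡a′ , refl))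
  where
  shifted : ∀ {h c b′} → Injective h → h a ≡ b → h c ≡ b′ → c ≢ a′ →
            ∃₂ λ h h′ → Injective h × Injective h′ × h a ≡ b × h′ a′ ≡ b′ × (∀ y → h y ≢ h′ y)
  shifted {h} {c} h-inj eq eq′ c≢a′ = let j , to = ⊕-transitive a′ c in
    h , (λ y → h (y ⊕ toℕ j)) , h-inj , (λ e → ⊕-injectiveˡ (toℕ j) (h-inj e)) , eq , trans (cong h to) eq′ ,
    λ y e → ⊕-free j to c≢a′ (sym (h-inj e))
... | no b≢b′ = let c , c≢a , c≢a′ = another 3≤n a a′
                    h , h-inj , eq , eq′ = two-points (λ a≡c → c≢a (sym a≡c)) b≢b′
                    j , to = ⊕-transitive a′ c
                in h , (λ y → h (y ⊕ toℕ j)) , h-inj , (λ e → ⊕-injectiveˡ (toℕ j) (h-inj e)) , eq , trans (cong h to) eq′ ,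
                   λ y e → ⊕-free j to c≢a′ (sym (h-inj e))

-- The points other than `a` are rotated by one step, which leaves none of them in place because
-- there are at least two.
equal-only-at : ∀ {n} → 3 ≤ℕ n → (a : Fin n) (h : Fin n → Fin n) → Injective h →
                ∃[ h′ ] (Injective h′ × h′ a ≡ h a × (∀ y → h y ≡ h′ y → y ≡ a))
equal-only-at {suc n} (s≤s 2≤n) a h h-inj = h ∘ π , (λ eq → π-inj (h-inj eq)) , cong h fixed , λ y eq → only y (sym (h-inj eq))
  where
  move : ∀ y → Dec (a ≡ y) → Fin (suc n)
  move y (yes _)  = a
  move y (no a≢y) = punchIn a (punchOut a≢y ⊕ 1)
  π : Fin (suc n) → Fin (suc n)
  π y = move y (a ≟ y)
  fixed : π a ≡ a
  fixed with a ≟ a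
  ... | yes _  = refl
  ... | no a≢a = contradiction refl a≢a
  π-inj : Injective π
  π-inj {y} {z} eq with a ≟ y | a ≟ z
  ... | yes refl | yes refl = refl
  ... | yes _    | no _     = contradiction (sym eq) (punchInᵢ≢i a _)
  ... | no _     | yes _    = contradiction eq (punchInᵢ≢i a _)
  ... | no a≢y   | no a≢z   = punchOut-injective a≢y a≢z (⊕-injectiveˡ 1 (punchIn-injective a _ _ eq))
  only : ∀ y → π y ≡ y → y ≡ a
  only y eq with a ≟ y
  ... | yes a≡y = sym a≡y
  ... | no a≢y  = contradiction (trans (sym (m<n⇒m%n≡m 2≤n)) (⊕-fixed (punchOut a≢y) 1
                    (punchIn-injective a _ _ (trans eq (sym (punchIn-punchOut a≢y)))))) λ ()
    where
    instance
      n-nonZero : NonZero n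
      n-nonZero = >-nonZero (≤-trans (s≤s z≤n) 2≤n)

opaque
  system-centre : ∀ {ν n f} → System ν n f → 3 ≤ℕ n → ν ≤ℕ n →
                  ∃₂ λ a b → toℕ a < ν × (∀ h → Injective h → f (λ a b → h a ≡ b) → h a ≡ b)
  system-centre {n = suc (suc m)} S (s≤s (s≤s 1≤m)) ν≤n = centre S 1≤m ν≤n

module Gluing {k} (ns : Vec ℕ (suc k)) {m p : Fin (suc k)} (m≢p : m ≢ p) {r : ℕ} (1≤r : 1 ≤ℕ r)
              (r≤ : ∀ l → r ≤ℕ lookup ns l) (m-min : ∀ l → lookup ns m ≤ℕ lookup ns l) (3≤p : 3 ≤ℕ lookup ns p)
              (F : Family ns r) (F-intersecting : Intersecting F)
              (tight : length (groupElements ns) * r ≤ℕ length (allEdges ns) * (∣ F ∣ * #stabiliser {ns = ns} {r})) where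

  open Family F
  open Coordinates ns m≢p
  open Windows ns m≢p 1≤r r≤ m-min F F-intersecting using (equality⇒diagonal; DiagonalMember)

  private
    G = groupElements ns
    Row = Fin (lookup ns m)
    Col = Fin (lookup ns p)

  row : Row → Col
  row i = inject≤ i (m-min p)

  row-injective : Injective row
  row-injective = inject≤-injective (m-min p) (m-min p) _ _

  row-< : ∀ i → toℕ (row i) < lookup ns m
  row-< i = ≤-trans (s≤s (≤-reflexive (toℕ-inject≤ i (m-min p)))) (toℕ<n i)

  -- Rows and columns are related by ρ; up to a rotation, each other coordinate is the function of the
  -- row prescribed by g.

  record Follows (g : All Perm ns) (ρ : Col → Col → Set) (o e : Edge ns) : Set where
    constructor _,_
    field
      related : ρ (row (lookup⁺ e m)) (lookup⁺ e p)
      others  : ∀ l → l ≢ m → l ≢ p → lookup⁺ e l ≡ lookup (lookup⁺ g l) (lookup⁺ o l ⊕ toℕ (lookup⁺ e m))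

  record Containing (g : All Perm ns) (ρ : Col → Col → Set) : Set where
    no-eta-equality
    constructor containing
    field
      {member} : Matching ns r
      member∈  : member ∈ members
      offset   : Edge ns
      along    : ∀ s → Follows g ρ offset (edge member s)

    along-∈ : ∀ {e} → e ∈ᵉ member → Follows g ρ offset e
    along-∈ e∈ = subst (Follows g ρ offset) (sym (edge-position member e∈)) (along (position member e∈))

  open Follows
  open Containing

  shared : ∀ {g g′ ρ ρ′} (c : Containing g ρ) (c′ : Containing g′ ρ′) →
           ∃[ e ] (e ∈ᵉ member c × Follows g ρ (offset c) e × Follows g′ ρ′ (offset c′) e)
  shared c c′ =
    let e , e∈ , e∈′ = F-intersecting (member c) (member c′) (∈⇒∈ᶠ F (member∈ c)) (∈⇒∈ᶠ F (member∈ c′)) in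
    e , e∈ , along-∈ c e∈ , along-∈ c′ e∈′

  containing? : ∀ g {ρ} → (∀ a b → Dec (ρ a b)) → Dec (Containing g ρ)
  containing? g {ρ} dec-ρ = map′
    (λ any → let M , M∈ , any′ = find any ; o , _ , all = find any′ in containing M∈ o all)
    (λ c → lose (member∈ c) (lose (∈-allEdges (offset c)) (along c)))
    (Any.any? (λ M → Any.any? (λ o → ∀? (λ s → follows? o (edge M s))) (allEdges ns)) members)
    where
    follows? : ∀ o e → Dec (Follows g ρ o e)
    follows? o e = map′ (λ (p , q) → p , q) (λ (p , q) → p , q)
      (dec-ρ _ _ ×-dec ∀? (λ l → ¬? (l ≟ m) →-dec (¬? (l ≟ p) →-dec (lookup⁺ e l ≟ _))))

  -- Parts m and p are permuted by the arrangement itself, so that g only has to act on the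
  -- remaining parts.
  record Normal (g : All Perm ns) : Set where
    field
      g∈ : g ∈ G
      at-m : ∀ i → lookup (lookup⁺ g m) i ≡ i
      at-p : ∀ i → lookup (lookup⁺ g p) i ≡ i

  open Normal

  -- `tight` restates `equality⇒diagonal`: rows are listed by the restriction of `α`, columns by
  -- `β`, and the rotation q is the column shift of the diagonal containing a member.
  normal-system : ∀ {g} → Normal g → System (lookup ns m) (lookup ns p) (Containing g)
  normal-system {g} normal = record
    { mono  = λ imp c → containing (member∈ c) (offset c) λ s → imp (row-< _) (related (along c s)) , others (along c s)
    ; dec   = containing? g
    ; meet  = λ c c′ → let e , _ , q , q′ = shared c c′ in _ , _ , row-< _ , related q , related q′
    ; tight = diagonals
    }
    where
    diagonals : ∀ (α β : Col → Col) → Injective α → Injective β → (∀ i → toℕ i < lookup ns m → toℕ (α i) < lookup ns m) →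
                ∃[ q ] Containing g (λ a b → ∃[ i ] (a ≡ α i × b ≡ β (i ⊕ toℕ {lookup ns p} q)))
    diagonals α β α-inj β-inj rows =
      let o , M , M∈ , all = equality⇒diagonal ρ ρ-inj β β-inj tight (g∈ normal) in
      lookup⁺ o p , containing M∈ o λ s →
        let i , em , ep , el = all _ (edge∈ M s)
            em′ = trans em (at-m normal _)
        in (row i , trans (cong row em′) (row-ρ i) , trans ep (trans (at-p normal _) (cong β (commute (lookup⁺ o p) i))))
           , λ l l≢m l≢p → trans (el l≢m l≢p) (cong (λ z → lookup (lookup⁺ g l) (lookup⁺ o l ⊕ toℕ z)) (sym em′))
      where
      ρ : Row → Row
      ρ i = fromℕ< (rows (row i) (row-< i))
      row-ρ : ∀ i → row (ρ i) ≡ α (row i)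
      row-ρ i = toℕ-injective (trans (toℕ-inject≤ (ρ i) (m-min p)) (toℕ-fromℕ< (rows (row i) (row-< i))))
      ρ-inj : Injective ρ
      ρ-inj {i} {j} eq = row-injective (α-inj (trans (sym (row-ρ i)) (trans (cong row eq) (row-ρ j))))
      commute : ∀ (q : Col) i → q ⊕ toℕ i ≡ row i ⊕ toℕ q
      commute q i = toℕ-injective (trans (toℕ-⊕ q (toℕ i)) (trans (cong (_% lookup ns p)
        (trans (+-comm (toℕ q) (toℕ i)) (cong (_+ toℕ q) (sym (toℕ-inject≤ i (m-min p)))))) (sym (toℕ-⊕ (row i) (toℕ q)))))
        where
        instance
          p-nonZero : NonZero (lookup ns p)
          p-nonZero = >-nonZero (≤-trans (s≤s z≤n) 3≤p)

  record Centre (g : All Perm ns) : Set where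
    field
      a b     : Col
      a-row   : toℕ a < lookup ns m
      through : ∀ {h} → Injective h → Containing g (λ x y → h x ≡ y) → h a ≡ b
      filled  : ∀ {h} → Injective h → h a ≡ b → Containing g (λ x y → h x ≡ y)

  open Centre

  module _ {g} (normal : Normal g) where

    private
      S = normal-system normal

    -- Some rotation of `h` contains a member. By `through` it maps `a` to `b` as `h` does, so the
    -- rotation fixes `a` and is trivial.
    fill : ∀ {a b} → (∀ h → Injective h → Containing g (λ x y → h x ≡ y) → h a ≡ b) →
           ∀ {h} → Injective h → h a ≡ b → Containing g (λ x y → h x ≡ y)
    fill {a} through {h} h-inj ha≡b = unrotate (System.tight S id h (λ eq → eq) h-inj (λ _ lt → lt))
      where
      unturned : ∀ (q : Col) → a ⊕ toℕ q ≡ a → ∀ x → x ⊕ toℕ q ≡ x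
      unturned q fixed x with x ⊕ toℕ q ≟ x
      ... | yes eq = eq
      ... | no  ne = contradiction fixed (⊕-free {b = x ⊕ toℕ q} q refl ne)
      unrotate : ∃[ q ] Containing g (λ a b → ∃[ i ] (a ≡ i × b ≡ h (i ⊕ toℕ {lookup ns p} q))) → Containing g (λ x y → h x ≡ y)
      unrotate (q , c) = System.mono S (λ {x} _ eq → trans (cong h (sym (unturned q turn x))) eq) c′
        where
        c′ : Containing g (λ x y → h (x ⊕ toℕ q) ≡ y)
        c′ = System.mono S (λ { _ (i , refl , refl) → refl }) c
        turn : a ⊕ toℕ q ≡ a
        turn = h-inj (trans (through (λ x → h (x ⊕ toℕ q)) (λ eq → ⊕-injectiveˡ (toℕ q) (h-inj eq)) c′) (sym ha≡b))

    centre-of : Centre g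
    centre-of = from (system-centre S 3≤p (m-min p))
      where
      from : (∃₂ λ a b → toℕ a < lookup ns m × (∀ h → Injective h → Containing g (λ x y → h x ≡ y) → h a ≡ b)) → Centre g
      from (a , b , a-row , through) = record
        { a = a ; b = b ; a-row = a-row ; through = λ {h} → through h ; filled = fill through }

  -- Two permutations through different centres could be chosen to agree nowhere. Both contain
  -- members, even for different g and g′, and the shared edge of these members is a contradiction.
  same-centre : ∀ {g g′} (c : Centre g) (c′ : Centre g′) → a c ≡ a c′ × b c ≡ b c′
  same-centre c c′ with (a c ≟ a c′) ×-dec (b c ≟ b c′)
  ... | yes same  = same
  ... | no differ =
    let h , h′ , h-inj , h′-inj , eq , eq′ , disjoint = nowhere-equal 3≤p differ
        e , _ , q , q′ = shared (filled c h-inj eq) (filled c′ h′-inj eq′)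
    in contradiction (trans (related q) (sym (related q′))) (disjoint _)

  private
    Choice : Fin (suc k) → (∀ l → Perm (lookup ns l) → Set) → Set
    Choice l P = ∃[ g ] (g ∈ perms (lookup ns l) × (l ≡ m ⊎ l ≡ p → ∀ i → lookup g i ≡ i) × (l ≢ m → l ≢ p → P l g))

    identity : ∀ l P → (l ≡ m ⊎ l ≡ p) ⊎ (∀ g → P l g) → Choice l P
    identity l P other = let g , g∈ , ext = extension {n = lookup ns l} id id (λ eq → eq) (λ eq → eq) in
      g , g∈ , (λ _ → ext) , resolve other
      where
      resolve : (l ≡ m ⊎ l ≡ p) ⊎ (∀ g → P l g) → ∀ {g} → l ≢ m → l ≢ p → P l g
      resolve (inj₁ (inj₁ l≡m)) l≢m _   = contradiction l≡m l≢m
      resolve (inj₁ (inj₂ l≡p)) _   l≢p = contradiction l≡p l≢p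
      resolve (inj₂ always)     _   _   = always _

    choose : ∀ P → (∀ l → Choice l P) → ∃[ g ] (Normal g × (∀ l → l ≢ m → l ≢ p → P l (lookup⁺ g l)))
    choose P c = lookup⁻ g , record
        { g∈   = ∈-choices⁺ perms (lookup⁻ g) (λ l → subst (_∈ perms (lookup ns l)) (sym (at l)) (proj₁ (proj₂ (c l))))
        ; at-m = subst (λ v → ∀ i → lookup v i ≡ i) (sym (at m)) (proj₁ (proj₂ (proj₂ (c m))) (inj₁ refl))
        ; at-p = subst (λ v → ∀ i → lookup v i ≡ i) (sym (at p)) (proj₁ (proj₂ (proj₂ (c p))) (inj₂ refl)) }
      , λ l l≢m l≢p → subst (P l) (sym (at l)) (proj₂ (proj₂ (proj₂ (c l))) l≢m l≢p)
      where
      g : ∀ l → Perm (lookup ns l)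
      g l = proj₁ (c l)
      at : ∀ l → lookup⁺ (lookup⁻ {P = Perm} {xs = ns} g) l ≡ g l
      at = lookup⁺-lookup⁻ {Φ = Perm} ns g

  GraphOf : Matching ns r → Set
  GraphOf M = ∃[ g ] (Normal g × ∃[ h ] (Injective h × ∃[ c ] member {g} {λ x y → h x ≡ y} c ≡ M))

  -- The edges of a member have distinct entries in every part, so its columns and its remaining
  -- coordinates, as functions of the row, extend to permutations h and g.
  graph-of : ∀ M → M ∈ members → GraphOf M
  graph-of M M∈ =
    let g , normal , agrees = choose Values choice
        h , h-inj , eq = extend (λ s → row (lookup⁺ (edge M s) m)) (λ s → lookup⁺ (edge M s) p)
                           (λ eq → injectiveAt (edge-ordered M) m (row-injective eq)) (injectiveAt (edge-ordered M) p)
    in g , normal , h , h-inj , containing M∈ o (λ s → eq s , λ l l≢m l≢p → sym (agrees l l≢m l≢p s)) , refl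
    where
    -- Any offset would serve, since g is chosen to fit it.
    o : Edge ns
    o = edge M (fromℕ< 1≤r)
    Values : ∀ l → Perm (lookup ns l) → Set
    Values l g = ∀ s → lookup g (lookup⁺ o l ⊕ toℕ (lookup⁺ (edge M s) m)) ≡ lookup⁺ (edge M s) l
    choice : ∀ l → Choice l Values
    choice = coordinatewise (identity m Values (inj₁ (inj₁ refl))) (identity p Values (inj₁ (inj₂ refl))) λ {l} l≢m l≢p →
      let g , g∈ , ext = extension (λ s → lookup⁺ o l ⊕ toℕ (lookup⁺ (edge M s) m)) (λ s → lookup⁺ (edge M s) l)
                           (λ eq → injectiveAt (edge-ordered M) m (toℕ-injective (⊕-injectiveʳ (lookup⁺ o l)
                             (<-≤-trans (toℕ<n _) (m-min l)) (<-≤-trans (toℕ<n _) (m-min l)) eq)))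
                           (injectiveAt (edge-ordered M) l)
      in g , g∈ , (λ { (inj₁ l≡m) → contradiction l≡m l≢m ; (inj₂ l≡p) → contradiction l≡p l≢p }) , λ _ _ → ext

  module _ {g₀} (normal₀ : Normal g₀) (c₀ : Centre g₀) {h₀ : Col → Col} (K₀ : Containing g₀ (λ x y → h₀ x ≡ y)) where

    private
      i* : Row
      i* = fromℕ< (a-row c₀)

      row-i* : row i* ≡ a c₀
      row-i* = toℕ-injective (trans (toℕ-inject≤ i* (m-min p)) (toℕ-fromℕ< (a-row c₀)))

      same-offset : ∀ {h : Col → Col} (K : Containing g₀ (λ x y → h x ≡ y)) l → l ≢ m → l ≢ p → lookup⁺ (offset K) l ≡ lookup⁺ (offset K₀) l
      same-offset K l l≢m l≢p = let e , _ , f , f₀ = shared K K₀ in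
        ⊕-injectiveˡ (toℕ (lookup⁺ e m)) (perm-injective (lookup⁺ g₀ l) (∈-choices⁻ perms ns (g∈ normal₀) l)
          (trans (sym (others f l l≢m l≢p)) (others f₀ l l≢m l≢p)))

    central-edge : Edge ns
    central-edge = compose i* (b c₀) (λ l → lookup (lookup⁺ g₀ l) (lookup⁺ (offset K₀) l ⊕ toℕ i*))

    -- `M` follows a permutation h through the common centre. Over g₀ there is a member following
    -- some h′ that agrees with h only at the centre; the edge shared with it lies in that cell, and
    -- g₀ prescribes its other coordinates.
    central∈ : ∀ {M} → GraphOf M → central-edge ∈ᵉ M
    central∈ (g , normal , h , h-inj , K , refl) = meeting (equal-only-at 3≤p (a c₀) h h-inj)
      where
      ha≡b : h (a c₀) ≡ b c₀
      ha≡b = let c = centre-of normal ; a≡ , b≡ = same-centre c₀ c in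
        trans (cong h a≡) (trans (through c h-inj K) (sym b≡))
      meeting : ∃[ h′ ] (Injective h′ × h′ (a c₀) ≡ h (a c₀) × (∀ y → h y ≡ h′ y → y ≡ a c₀)) → central-edge ∈ᵉ member K
      meeting (h′ , h′-inj , h′a , only) = identify (shared K K′)
        where
        K′ : Containing g₀ (λ x y → h′ x ≡ y)
        K′ = filled c₀ h′-inj (trans h′a ha≡b)
        identify : ∃[ e ] (e ∈ᵉ member K × Follows g (λ x y → h x ≡ y) (offset K) e × Follows g₀ (λ x y → h′ x ≡ y) (offset K′) e) →
                   central-edge ∈ᵉ member K
        identify (e , e∈ , q , q′) = subst (_∈ᵉ member K) (lookup⁺-ext e central-edge (coordinatewise
            (trans em (sym (compose-m _ _ _)))
            (trans (sym (related q)) (trans (cong h at-a) (trans ha≡b (sym (compose-p _ _ _)))))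
            (λ {l} l≢m l≢p → trans (others q′ l l≢m l≢p) (trans
              (cong₂ (λ x y → lookup (lookup⁺ g₀ l) (x ⊕ toℕ y)) (same-offset K′ l l≢m l≢p) em)
              (sym (compose-other _ _ _ l≢m l≢p)))))) e∈
          where
          at-a : row (lookup⁺ e m) ≡ a c₀
          at-a = only _ (trans (related q) (sym (related q′)))
          em : lookup⁺ e m ≡ i*
          em = row-injective (trans at-a (sym row-i*))

  common-edge : ∃[ e ] (∀ M → M ∈ members → e ∈ᵉ M)
  common-edge = from (choose (λ _ _ → ⊤) (λ l → identity l _ (inj₂ (λ _ → tt))))
    where
    from : ∃[ g ] (Normal g × (∀ l → l ≢ m → l ≢ p → ⊤)) → ∃[ e ] (∀ M → M ∈ members → e ∈ᵉ M)
    from (g₀ , normal₀ , _) = around (centre-of normal₀)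
      where
      around : Centre g₀ → ∃[ e ] (∀ M → M ∈ members → e ∈ᵉ M)
      around c₀ = let h₀ , h₀-inj , eq = point (a c₀) (b c₀) in
        central-edge normal₀ c₀ {h₀} (filled c₀ h₀-inj eq) , λ M M∈ → central∈ normal₀ c₀ {h₀} (filled c₀ h₀-inj eq) (graph-of M M∈)

-- The bound and its equality case

fraction-≤ : ∀ a b d .{{_ : NonZero d}} → a * d ≤ℕ b → fromℕ a ≤ ℤ.+ b / d
fraction-≤ a b (suc d) le = ℚₚ.toℚᵘ-cancel-≤ (ℚᵘₚ.≤-respˡ-≃ (ℚᵘₚ.≃-sym (ℚₚ.toℚᵘ-fromℚᵘ (mkℚᵘ (ℤ.+ a) 0)))
  (ℚᵘₚ.≤-respʳ-≃ (ℚᵘₚ.≃-sym (ℚₚ.toℚᵘ-fromℚᵘ (mkℚᵘ (ℤ.+ b) d)))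
    (*≤* (subst₂ ℤ._≤_ (ℤₚ.pos-* a (suc d)) (trans (cong ℤ.+_ (sym (*-identityʳ b))) (ℤₚ.pos-* b 1)) (ℤ.+≤+ le)))))

fraction-≡ : ∀ a b d .{{_ : NonZero d}} → fromℕ a ≡ ℤ.+ b / d ⇔ a * d ≡ b
fraction-≡ a b (suc d) = mk⇔
  (λ eq → trans (ℤₚ.+-injective (trans (ℤₚ.pos-* a (suc d))
    (trans (ℚᵘₚ.drop-*≡* (ℚₚ./-injective-≃ (mkℚᵘ (ℤ.+ a) 0) (mkℚᵘ (ℤ.+ b) d) eq)) (sym (ℤₚ.pos-* b 1))))) (*-identityʳ b))
  (λ eq → ℚₚ.fromℚᵘ-cong {mkℚᵘ (ℤ.+ a) 0} {mkℚᵘ (ℤ.+ b) d} (*≡* (trans (sym (ℤₚ.pos-* a (suc d)))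
    (trans (cong ℤ.+_ (trans eq (sym (*-identityʳ b)))) (ℤₚ.pos-* b 1)))))

falling-! : ∀ n k → k ≤ℕ n → (n ↓ k) * (n ∸ k) ! ≡ n !
falling-! n k k≤n = trans (cong (_* (n ∸ k) !) (nPk≡n!/[n∸k]! k≤n)) (m/n*n≡m {{(n ∸ k) !≢0}} (∣-trans (m∣m*n (k !)) ([n∸k]!k!∣n! k≤n)))

∏-* : ∀ {k} (φ ψ χ : ℕ → ℕ) (ns : Vec ℕ k) → (∀ l → φ (lookup ns l) * ψ (lookup ns l) ≡ χ (lookup ns l)) →
      ∏ (mapᵛ φ ns) * ∏ (mapᵛ ψ ns) ≡ ∏ (mapᵛ χ ns)
∏-* φ ψ χ []       eq = refl
∏-* φ ψ χ (n ∷ ns) eq = trans (CommSemigroup.interchange *-commutativeSemigroup (φ n) (∏ (mapᵛ φ ns)) (ψ n) (∏ (mapᵛ ψ ns)))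
  (cong₂ _*_ (eq zero) (∏-* φ ψ χ ns (eq ∘ suc)))

∏-1 : ∀ {k} (φ : ℕ → ℕ) (ns : Vec ℕ k) → (∀ l → φ (lookup ns l) ≡ 1) → ∏ (mapᵛ φ ns) ≡ 1
∏-1 φ []       eq = refl
∏-1 φ (n ∷ ns) eq = cong₂ _*_ (eq zero) (∏-1 φ ns (eq ∘ suc))

∏-nonZero : ∀ {k} (φ : ℕ → ℕ) (ns : Vec ℕ k) → (∀ l → NonZero (φ (lookup ns l))) → NonZero (∏ (mapᵛ φ ns))
∏-nonZero φ []       nz = _
∏-nonZero φ (n ∷ ns) nz = m*n≢0 (φ n) (∏ (mapᵛ φ ns)) {{nz zero}} {{∏-nonZero φ ns (nz ∘ suc)}}

argmin : ∀ {k} (φ : Fin (suc k) → ℕ) → ∃[ m ] (∀ l → φ m ≤ℕ φ l)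
argmin {zero}  φ = zero , λ { zero → ≤-refl }
argmin {suc k} φ with m , least ← argmin (φ ∘ suc) with ≤-total (φ zero) (φ (suc m))
... | inj₁ le = zero  , λ { zero → ≤-refl ; (suc l) → ≤-trans le (least l) }
... | inj₂ ge = suc m , λ { zero → ge ; (suc l) → least l }

module Parts {k : ℕ} (ns : Vec ℕ (suc k)) {r : ℕ} (r≤ : ∀ l → suc r ≤ℕ lookup ns l) where

  private
    N = ∏ (mapᵛ id ns)
    D = ∏ (mapᵛ (λ n → (n ∸ suc r) !) ns)
    Π↓ = ∏ (mapᵛ (λ n → (n ∸ 1) ↓ r) ns)
    c = #stabiliser {ns = ns} {suc r}
    instance
      K-nonZero : NonZero (N * D * suc r)
      K-nonZero = m*n≢0 (N * D) (suc r) {{m*n≢0 N D {{∏-nonZero id ns (λ l → >-nonZero (≤-trans (s≤s z≤n) (r≤ l)))}}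
        {{∏-nonZero (λ n → (n ∸ suc r) !) ns (λ l → (lookup ns l ∸ suc r) !≢0)}}}}

  private
    -- Matchings have r + 1 edges here. Both sides of the double count have the factor N D (r + 1),
    -- and cancelling it leaves a r! against the product of the (n - 1)_r.
    shape₁ : ∀ a f → N * (a * (suc r * f * D)) ≡ (N * D * suc r) * (a * f)
    shape₁ a f = solve 5 (λ N D s a f → N :* (a :* (s :* f :* D)) := (N :* D :* s) :* (a :* f)) refl N D (suc r) a f
      where open +-*-Solver

    shape₂ : ∏ (mapᵛ _! ns) * suc r ≡ (N * D * suc r) * Π↓
    shape₂ = trans (cong (_* suc r) (sym all)) (solve 4 (λ N D Π↓ s → (N :* (Π↓ :* D)) :* s := (N :* D :* s) :* Π↓) refl N D Π↓ (suc r))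
      where
      open +-*-Solver
      parts : Π↓ * D ≡ ∏ (mapᵛ (λ n → (n ∸ 1) !) ns)
      parts = ∏-* (λ n → (n ∸ 1) ↓ r) (λ n → (n ∸ suc r) !) (λ n → (n ∸ 1) !) ns (λ l → coordinate (lookup ns l) (r≤ l))
        where
        coordinate : ∀ n → suc r ≤ℕ n → ((n ∸ 1) ↓ r) * (n ∸ suc r) ! ≡ (n ∸ 1) !
        coordinate (suc n) (s≤s r≤n) = falling-! n r r≤n
      all : N * (Π↓ * D) ≡ ∏ (mapᵛ _! ns)
      all = trans (cong (N *_) parts) (∏-* id (λ n → (n ∸ 1) !) _! ns (λ l → coordinate (lookup ns l) (r≤ l)))
        where
        coordinate : ∀ n → suc r ≤ℕ n → n * (n ∸ 1) ! ≡ n !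
        coordinate (suc n) _ = refl

    edges≡ : length (allEdges ns) ≡ N
    edges≡ = length-allEdges ns

    group≡ : length (groupElements ns) ≡ ∏ (mapᵛ _! ns)
    group≡ = length-groupElements ns

    lhs : ∀ a → length (allEdges ns) * (a * c) ≡ (N * D * suc r) * (a * r !)
    lhs a = trans (cong (_* (a * c)) edges≡) (shape₁ a (r !))

    rhs : length (groupElements ns) * suc r ≡ (N * D * suc r) * Π↓
    rhs = trans (cong (_* suc r) group≡) shape₂

  counted-≤ : ∀ a → length (allEdges ns) * (a * c) ≤ℕ length (groupElements ns) * suc r → a * r ! ≤ℕ Π↓
  counted-≤ a le = *-cancelˡ-≤ (N * D * suc r) (≤-trans (≤-reflexive (sym (lhs a))) (≤-trans le (≤-reflexive rhs)))

  counted-≡ : ∀ a → a * r ! ≡ Π↓ → length (groupElements ns) * suc r ≡ length (allEdges ns) * (a * c)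
  counted-≡ a eq = trans rhs (trans (cong ((N * D * suc r) *_) (sym eq)) (sym (lhs a)))

  module _ (F : Family ns (suc r)) where

    open Family F

    private
      G = groupElements ns

      base : Fin (suc r) → Edge ns
      base s = lookup⁻ (λ l → inject≤ s (r≤ l))

      base-ordered : Ordered base
      base-ordered .injectiveAt l {i} {j} eq = inject≤-injective (r≤ l) (r≤ l) i j
        (trans (sym (lookup⁺-lookup⁻ {Φ = Fin} ns (λ l → inject≤ i (r≤ l)) l)) (trans eq (lookup⁺-lookup⁻ {Φ = Fin} ns (λ l → inject≤ j (r≤ l)) l)))

    listed⇒∈ᶠ : ∀ M → Listed F (edge M) → M ∈ᶠ F
    listed⇒∈ᶠ M listed = Any.map (λ {N} M⊆N → lists-≈ (edge-ordered M) M N (edge∈ M) M⊆N) listed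

    ∈ᶠ⇒listed : ∀ {W : Fin (suc r) → Edge ns} M → M ∈ᶠ F → (∀ s → W s ∈ᵉ M) → Listed F W
    ∈ᶠ⇒listed M M∈ W⊆M = Any.map (λ M≈N s → Equivalence.to (M≈N _) (W⊆M s)) M∈

    -- Every star has the same size, as the translates of a fixed matching pass through a given edge equally often.

    star-size : IsStar F → length G * suc r ≡ length (allEdges ns) * (∣ F ∣ * c)
    star-size (e , star) = begin
      length G * suc r                                   ≡⟨ cong (_* suc r) group≡ ⟩
      ∏ (mapᵛ _! ns) * suc r                              ≡⟨ cong (_* suc r) (sym through≡) ⟩
      N * S * suc r                                      ≡⟨ trans (*-assoc N S (suc r)) (cong (N *_) (*-comm S (suc r))) ⟩
      N * (suc r * S)                                    ≡⟨ cong₂ _*_ (sym edges≡) (sym counted) ⟩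
      length (allEdges ns) * (∣ F ∣ * c)                 ∎
      where
      open ≡-Reasoning
      S = ∏ (mapᵛ (λ n → (n ∸ 1) !) ns)
      through≡ : N * S ≡ ∏ (mapᵛ _! ns)
      through≡ = ∏-* id (λ n → (n ∸ 1) !) _! ns (λ l → coordinate (lookup ns l) (r≤ l))
        where
        coordinate : ∀ n → suc r ≤ℕ n → n * (n ∸ 1) ! ≡ n !
        coordinate (suc n) _ = refl
      hits : ∀ g → g ∈ G → Listed F (act g ∘ base) → ∃[ s ] act g (base s) ≡ e
      hits g g∈ listed =
        let M , M∈ , W⊆M = find listed
            s , eq = lists-all M (act-ordered g∈ base-ordered) W⊆M (Equivalence.to (star M) (∈⇒∈ᶠ F M∈))
        in s , sym eq
      covers : ∀ g → g ∈ G → ∃[ s ] act g (base s) ≡ e → Listed F (act g ∘ base)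
      covers g g∈ (s , eq) = ∈ᶠ⇒listed translate (Equivalence.from (star translate) (subst (_∈ᵉ translate) eq (translate∈ s))) translate∈
        where
        translate = matching (act g ∘ base) (act-ordered g∈ base-ordered)
        translate∈ : ∀ s → act g (base s) ∈ᵉ translate
        translate∈ s = subst (_∈ᵉ translate) (lookup∘tabulate (act g ∘ base) s) (edge∈ translate s)
      split : ∀ g → g ∈ G → ⟦ listed? F (act g ∘ base) ⟧ ≡ ∑ (allFin (suc r)) (λ s → ⟦ act g (base s) ≟ᵉ e ⟧)
      split g g∈ with listed? F (act g ∘ base)
      ... | yes listed = let s , eq = hits g g∈ listed in sym (∑-unique (λ s → act g (base s) ≟ᵉ e) s eq
              (λ t eq′ → ordered-injective (act-ordered g∈ base-ordered) (trans eq′ (sym eq))))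
      ... | no unlisted = sym (∑-zero (allFin (suc r)) (λ s → ⟦⟧-no (act g (base s) ≟ᵉ e) (λ eq → unlisted (covers g g∈ (s , eq)))))
      single : ∀ f → Ordered {r = 1} {ns = ns} (λ _ → f)
      single f = ordered λ { _ {0F} {0F} _ → refl }
      each : ∀ s → ∑ G (λ g → ⟦ act g (base s) ≟ᵉ e ⟧) ≡ S
      each s = #actions {r = 1} (λ _ → base s) (λ _ → e) (single (base s)) (single e) (λ g → act g (base s) ≟ᵉ e) (λ _ eq _ → eq) (λ _ eq → eq 0F)
      counted : ∣ F ∣ * c ≡ suc r * S
      counted = begin
        ∣ F ∣ * c                                                              ≡⟨ ∑-listed F base-ordered ⟨
        ∑ G (λ g → ⟦ listed? F (act g ∘ base) ⟧)                              ≡⟨ ∑-cong-∈ G split ⟩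
        ∑ G (λ g → ∑ (allFin (suc r)) (λ s → ⟦ act g (base s) ≟ᵉ e ⟧))        ≡⟨ ∑-comm G (allFin (suc r)) (λ g s → ⟦ act g (base s) ≟ᵉ e ⟧) ⟩
        ∑ (allFin (suc r)) (λ s → ∑ G (λ g → ⟦ act g (base s) ≟ᵉ e ⟧))        ≡⟨ ∑-cong (allFin (suc r)) each ⟩
        ∑ (allFin (suc r)) (λ _ → S)                                           ≡⟨ ∑-allFin-const (suc r) S ⟩
        suc r * S                                                              ∎

    star⇒≡ : IsStar F → ∣ F ∣ * r ! ≡ Π↓
    star⇒≡ star = *-cancelˡ-≡ _ _ (N * D * suc r) (trans (sym (lhs ∣ F ∣)) (trans (sym (star-size star)) rhs))

    -- A family of maximal size all of whose members contain e is the star at e: any further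
    -- matching through e could be added.

    substar⇒star : (∀ (F′ : Family ns (suc r)) → Intersecting F′ → ∣ F′ ∣ * r ! ≤ℕ Π↓) → Π↓ ≤ℕ ∣ F ∣ * r ! →
                   ∀ e → (∀ M → M ∈ members → e ∈ᵉ M) → IsStar F
    substar⇒star bounded large e all = e , λ M → mk⇔ (through M) (belongs M)
      where
      through : ∀ M → M ∈ᶠ F → e ∈ᵉ M
      through M M∈ = let N , N∈ , M≈N = find M∈ in Equivalence.from (M≈N e) (all N N∈)
      belongs : ∀ M → e ∈ᵉ M → M ∈ᶠ F
      belongs M e∈ with listed? F (edge M)
      ... | yes listed  = listed⇒∈ᶠ M listed
      ... | no unlisted = contradiction (≤-trans (bounded F+M intersecting) large) (<⇒≱ (<+ (r !) {{r !≢0}}))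
        where
        <+ : ∀ d .{{_ : NonZero d}} → ∣ F ∣ * d < suc (∣ F ∣) * d
        <+ (suc d) = s≤s (m≤n+m (∣ F ∣ * suc d) d)
        F+M : Family ns (suc r)
        F+M = record
          { members = M ∷ members
          ; unique  = Allˡ.tabulate (λ N∈ M≈N → unlisted (lose N∈ (λ s → Equivalence.to (M≈N _) (edge∈ M s)))) AllPairsˡ.∷ unique
          }
        through′ : ∀ N → N ∈ᶠ F+M → e ∈ᵉ N
        through′ N (here N≈M)  = Equivalence.from (N≈M e) e∈
        through′ N (there N∈)  = through N N∈
        intersecting : Intersecting F+M
        intersecting N N′ N∈ N′∈ = e , through′ N N∈ , through′ N′ N′∈

    -- If no part has more than two vertices then the bound is 1.

    small : Π↓ ≤ℕ ∣ F ∣ * r ! → ∣ F ∣ * r ! ≤ℕ Π↓ → (∀ l → lookup ns l ≤ℕ 2) → ∃[ e ] (∀ M → M ∈ members → e ∈ᵉ M)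
    small ge le ≤2 = only members (trans (sym (trans (cong (∣ F ∣ *_) r!≡1) (*-identityʳ _))) (trans (≤-antisym le ge) Π↓≡1))
      where
      r≤1 : r ≤ℕ 1
      r≤1 = s≤s⁻¹ (≤-trans (r≤ zero) (≤2 zero))
      one! : ∀ {n} → n ≤ℕ 1 → n ! ≡ 1
      one! z≤n       = refl
      one! (s≤s z≤n) = refl
      r!≡1 : r ! ≡ 1
      r!≡1 = one! r≤1
      Π↓≡1 : Π↓ ≡ 1
      Π↓≡1 = ∏-1 (λ n → (n ∸ 1) ↓ r) ns (λ l → coordinate r (lookup ns l) (r≤ l) (≤2 l))
        where
        coordinate : ∀ r n → suc r ≤ℕ n → n ≤ℕ 2 → (n ∸ 1) ↓ r ≡ 1
        coordinate 0             n             _                _ = refl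
        coordinate 1             2             _                _ = refl
        coordinate 1             1             (s≤s ())         _
        coordinate (suc (suc r)) (suc (suc 0)) (s≤s (s≤s ()))   _
        coordinate (suc (suc r)) 1             (s≤s ())         _
        coordinate (suc _) (suc (suc (suc _))) _ (s≤s (s≤s ()))
      only : ∀ Ms → length Ms ≡ 1 → ∃[ e ] (∀ M → M ∈ Ms → e ∈ᵉ M)
      only (M ∷ []) _ = edge M zero , λ { _ (here refl) → edge∈ M zero }

theorem1p3 : ∀ (k r : ℕ) (n : Vec ℕ k) → 2 ≤ℕ k → 1 ≤ℕ r → (∀ i → r ≤ℕ lookup n i) →
    (F : Family n r) → Intersecting F →
    (fromℕ ∣ F ∣ ≤ bound n r) × (fromℕ ∣ F ∣ ≡ bound n r ⇔ IsStar F)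
theorem1p3 (suc (suc k)) (suc r) ns (s≤s (s≤s _)) 1≤r r≤ F F-int =
  fraction-≤ ∣ F ∣ _ (r !) {{r !≢0}} (bounded F F-int) ,
  mk⇔ (λ eq → maximal⇒star (Equivalence.to (fraction-≡ ∣ F ∣ _ (r !) {{r !≢0}}) eq))
      (λ star → Equivalence.from (fraction-≡ ∣ F ∣ _ (r !) {{r !≢0}}) (star⇒≡ F star))
  where
  open Parts ns r≤

  m : Fin (suc (suc k))
  m = proj₁ (argmin (lookup ns))
  m-min : ∀ l → lookup ns m ≤ℕ lookup ns l
  m-min = proj₂ (argmin (lookup ns))

  other : ∀ m → ∃[ p ] m ≢ p
  other zero    = 1F , λ ()
  other (suc _) = 0F , λ ()

  bounded : ∀ (F : Family ns (suc r)) → Intersecting F → ∣ F ∣ * r ! ≤ℕ ∏ (mapᵛ (λ n → (n ∸ 1) ↓ r) ns)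
  bounded F F-int = counted-≤ ∣ F ∣ (Windows.averaged-bound ns (proj₂ (other m)) 1≤r r≤ m-min F F-int id (λ eq → eq) id (λ eq → eq))

  common : ∣ F ∣ * r ! ≡ ∏ (mapᵛ (λ n → (n ∸ 1) ↓ r) ns) → ∃[ e ] (∀ M → M ∈ Family.members F → e ∈ᵉ M)
  common eq with any? (λ p → ¬? (m ≟ p) ×-dec (3 ≤? lookup ns p))
  ... | yes (p , m≢p , 3≤p) = Gluing.common-edge ns m≢p 1≤r r≤ m-min 3≤p F F-int (≤-reflexive (counted-≡ ∣ F ∣ eq))
  ... | no none = small F (≤-reflexive (sym eq)) (≤-reflexive eq) at-most-two
    where
    away : ∀ {p} → m ≢ p → lookup ns p ≤ℕ 2
    away {p} m≢p with 3 ≤? lookup ns p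
    ... | yes 3≤p = contradiction (p , m≢p , 3≤p) none
    ... | no  3≰p = s≤s⁻¹ (≰⇒> 3≰p)
    at-most-two : ∀ l → lookup ns l ≤ℕ 2
    at-most-two l with m ≟ l
    ... | no m≢l   = away m≢l
    -- The smallest part is bounded by any other one.
    ... | yes refl = ≤-trans (m-min (proj₁ (other m))) (away (proj₂ (other m)))

  maximal⇒star : ∣ F ∣ * r ! ≡ ∏ (mapᵛ (λ n → (n ∸ 1) ↓ r) ns) → IsStar F
  maximal⇒star eq = let e , all = common eq in substar⇒star F bounded (≤-reflexive (sym eq)) e all
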